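{- The theory of valued vector spaces is model complete relative to the skeleton in the languages $\mathrm{L}_{S,K}$ and $\mathrm{L}_S$. More precisely, given two models $\mathcal{V}\subseteq\mathcal{W}$ (in the language $\mathrm{L}_{S,K}$, resp. $\mathrm{L}_S$), one has $\mathcal{V}\preceq\mathcal{W}$ if and only if $S(V)\preceq S(W)$.
   Context: Valued vector space: $K$ is a field, $V$ a $K$-vector space, $(\Gamma,<,\infty)$ a totally ordered set with last element $\infty$, and $\mathrm{val}:V\to\Gamma$ a surjective map such that $\mathrm{val}(x)=\infty$ iff $x=0$, $\mathrm{val}(x-y)\ge\min(\mathrm{val}(x),\mathrm{val}(y))$, and $\mathrm{val}(kx)=\mathrm{val}(x)$ for all $k\in K\setminus\{0\}$, $x\in V$. For $\gamma\in\Gamma$ write $V_\gamma=\{x\mid\mathrm{val}(x)>\gamma\}$. Skeleton: $S(V)$ is the quotient of $\{(\gamma,v)\in\Gamma\times V\mid\mathrm{val}(v)\ge\gamma\}$ by $(\gamma,v)\simeq(\gamma',v')$ iff $\gamma=\gamma'$ and $\mathrm{val}(v-v')>\gamma$. The class of $(\gamma,v)$ is written $(\gamma,v+V_\gamma)$, and $\mathbf{0}=(\infty,0)$ is the unique class over $\infty$. Maps: $\pi:V\to S(V)$, $v\mapsto(\mathrm{val}(v),v+V_{\mathrm{val}(v)})$; $\mathrm{val}_S:S(V)\to\Gamma$, $(\gamma,v+V_\gamma)\mapsto\gamma$; $\mathrm{scal}_\bullet(k,(\gamma,v+V_\gamma)):=(\gamma,kv+V_\gamma)$ (also $\mathrm{scal}_{\bullet,k}$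 for fixed $k$); $(\gamma,v+V_\gamma)+_\bullet(\gamma',v'+V_{\gamma'}):=(\gamma,v+v'+V_\gamma)$ if $\gamma=\gamma'$, and $\mathbf{0}$ otherwise. Languages: $\mathrm{L}_{S,K}$ (fixed base field $K$) consists of $(V,+,0,(\mathrm{scal}_k:V\to V)_{k\in K})$, $(\Gamma,<,\infty)$, $\mathrm{val}:V\to\Gamma$, $(S(V),+_\bullet,\mathbf{0},(\mathrm{scal}_{\bullet,k})_{k\in K})$, $\mathrm{val}_S$ and $\pi$. $\mathrm{L}_S$ (variable base field) consists of $(V,+,0)$, $(K,+,\cdot,0,1)$, $(\Gamma,<,\infty)$, $\mathrm{scal}:K\times V\to V$, $\mathrm{val}$, $(S(V),+_\bullet,\mathbf{0})$, $\mathrm{scal}_\bullet:K\times S(V)\to S(V)$, $\mathrm{val}_S$ and $\pi$. The skeleton $S(V)$ as a structure means the structure in the sublanguage $\{(S(V),+_\bullet,(\mathrm{scal}_{\bullet,k})_k,\mathbf{0}),(\Gamma,<),\mathrm{val}_S\}$ (case $\mathrm{L}_{S,K}$), resp. $\{(S(V),+_\bullet,\mathbf{0}),(\Gamma,<),(K,+,\cdot,0,1),\mathrm{scal}_\bullet,\mathrm{val}_S\}$ (case $\mathrm{L}_S$). -}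

module Defs where

open import Level using (Level; _⊔_; suc; 0ℓ)
open import Algebra.Bundles using (CommutativeRing; CommutativeMonoid; AbelianGroup)
open import Algebra.Module.Bundles using (LeftModule)
import Algebra.Construct.NaturalChoice.Min as Min
import Algebra.Properties.AbelianGroup as AbelianGroupProperties
import Algebra.Properties.CommutativeSemigroup as CommutativeSemigroupProperties
import Algebra.Construct.NaturalChoice.MinOp as MinOp
open import Data.Empty.Polymorphic using (⊥)
open import Data.List.Base using (List; []; _∷_)
open import Data.List.Membership.Propositional using (_∈_)
open import Data.List.Relation.Unary.All as All using (All; []; _∷_)
open import Data.Product.Base using (∃-syntax; _×_; _,_; proj₁)
open import Data.Sum.Base using (_⊎_; inj₁; inj₂)
open import Function.Base using (_∘_)
open import Function.Bundles using (_⇔_; Equivalence)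
open import Function.Definitions using (Congruent; Injective; Surjective)
open import Relation.Binary.Bundles using (Setoid; StrictTotalOrder; DecTotalOrder; TotalOrder)
open import Relation.Binary.Definitions using (Maximum)
import Relation.Binary.Properties.StrictTotalOrder as STOProperties
import Relation.Binary.Reasoning.Setoid as SetoidReasoning
open import Relation.Nullary.Decidable using (yes; no)
open import Relation.Nullary.Negation using (¬_; contradiction)

private variable
  ℓ ℓf ℓm : Level

------------------------------------------------------------------------
-- Many-sorted first-order logic

-- Equality at every sort is a logical symbol and is not listed in `Rel`.

record Signature ℓf : Set (suc ℓf) where
  field
    Sort     : Set
    Func     : Set ℓf
    domain   : Func → List Sort
    codomain : Func → Sort
    Rel      : Set
    arity    : Rel → List Sort

data Equalities {I : Set} (A : I → Setoid ℓm ℓm) :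
     ∀ {is} → All (Setoid.Carrier ∘ A) is → All (Setoid.Carrier ∘ A) is → Set ℓm where
  []  : Equalities A [] []
  _∷_ : ∀ {i is} {x y : Setoid.Carrier (A i)} {xs ys : All (Setoid.Carrier ∘ A) is} →
        Setoid._≈_ (A i) x y → Equalities A xs ys → Equalities A (x ∷ xs) (y ∷ ys)

module _ (L : Signature ℓf) where
  open Signature L

  data Term (Δ : List Sort) : Sort → Set ℓf where
    var : ∀ {s} → s ∈ Δ → Term Δ s
    app : (f : Func) → All (Term Δ) (domain f) → Term Δ (codomain f)

  -- The satisfaction relation is used under excluded middle, where the
  -- remaining connectives are definable from these.

  data Formula (Δ : List Sort) : Set ℓf where
    falsum : Formula Δ
    equal  : ∀ {s} → Term Δ s → Term Δ s → Formula Δ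
    rel    : (R : Rel) → All (Term Δ) (arity R) → Formula Δ
    _⇒_    : Formula Δ → Formula Δ → Formula Δ
    all    : (s : Sort) → Formula (s ∷ Δ) → Formula Δ

  -- Carriers are setoids because the skeleton is a quotient.

  record Structure ℓm : Set (ℓf ⊔ suc ℓm) where
    field
      sort : Sort → Setoid ℓm ℓm

    ∣_∣ : Sort → Set ℓm
    ∣ s ∣ = Setoid.Carrier (sort s)

    field
      func      : (f : Func) → All ∣_∣ (domain f) → ∣ codomain f ∣
      func-cong : ∀ f {xs ys} → Equalities sort xs ys →
                  Setoid._≈_ (sort (codomain f)) (func f xs) (func f ys)
      relation  : (R : Rel) → All ∣_∣ (arity R) → Set ℓm
      rel-cong  : ∀ R {xs ys} → Equalities sort xs ys → relation R xs → relation R ys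

module Semantics {L : Signature ℓf} (M : Structure L ℓm) where
  open Signature L
  open Structure M

  mutual
    eval : ∀ {Δ s} → Term L Δ s → All ∣_∣ Δ → ∣ s ∣
    eval (var i)    ρ = All.lookup ρ i
    eval (app f ts) ρ = func f (evals ts ρ)

    evals : ∀ {Δ ss} → All (Term L Δ) ss → All ∣_∣ Δ → All ∣_∣ ss
    evals []       ρ = []
    evals (t ∷ ts) ρ = eval t ρ ∷ evals ts ρ

  Sat : ∀ {Δ} → Formula L Δ → All ∣_∣ Δ → Set ℓm
  Sat falsum          ρ = ⊥
  Sat (equal {s} t u) ρ = Setoid._≈_ (sort s) (eval t ρ) (eval u ρ)
  Sat (rel R ts)      ρ = relation R (evals ts ρ)
  Sat (φ ⇒ ψ)         ρ = Sat φ ρ → Sat ψ ρ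
  Sat (all s φ)       ρ = (x : ∣ s ∣) → Sat φ (x ∷ ρ)

-- M ⊆ N is rendered as an embedding of M into N, and M ≼ N as the
-- statement that this embedding is elementary.

record Embedding {L : Signature ℓf} (M N : Structure L ℓm) : Set (ℓf ⊔ ℓm) where
  open Signature L
  private
    module M = Structure M
    module N = Structure N
  field
    map       : ∀ {s} → M.∣ s ∣ → N.∣ s ∣
    map-cong  : ∀ {s} → Congruent (Setoid._≈_ (M.sort s)) (Setoid._≈_ (N.sort s)) map
    injective : ∀ {s} → Injective (Setoid._≈_ (M.sort s)) (Setoid._≈_ (N.sort s)) map
    map-func  : ∀ f xs → Setoid._≈_ (N.sort (codomain f))
                           (map (M.func f xs)) (N.func f (All.map map xs))
    map-rel   : ∀ R xs → M.relation R xs ⇔ N.relation R (All.map map xs)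

IsElementary : {L : Signature ℓf} {M N : Structure L ℓm} → Embedding M N → Set (ℓf ⊔ ℓm)
IsElementary {L = L} {M} {N} h =
  ∀ {Δ} (φ : Formula L Δ) (ρ : All ∣_∣ Δ) →
    Semantics.Sat M φ ρ ⇔ Semantics.Sat N φ (All.map map ρ)
  where
  open Structure M using (∣_∣)
  open Embedding h using (map)

------------------------------------------------------------------------
-- Valued vector spaces

record Field ℓ : Set (suc ℓ) where
  field
    commutativeRing : CommutativeRing ℓ ℓ
  open CommutativeRing commutativeRing public
  field
    1≉0     : ¬ 1# ≈ 0#
    inverse : ∀ x → ¬ x ≈ 0# → ∃[ y ] x * y ≈ 1#

record ValuedVectorSpace {ℓ} (K : Field ℓ) : Set (suc ℓ) where
  private module K = Field K
  field
    vectorSpace : LeftModule K.ring ℓ ℓ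
    valueSet    : StrictTotalOrder ℓ ℓ ℓ

  module V = LeftModule vectorSpace
  module Γ = StrictTotalOrder valueSet
  open V using (Carrierᴹ; _≈ᴹ_; _+ᴹ_; -ᴹ_; 0ᴹ; _*ₗ_) public
  open Γ using () renaming (Carrier to Value; _<_ to infix 4 _<_; _≈_ to infix 4 _≈Γ_) public

  Γ-totalOrder : TotalOrder ℓ ℓ ℓ
  Γ-totalOrder = DecTotalOrder.totalOrder (STOProperties.decTotalOrder valueSet)

  open TotalOrder Γ-totalOrder using () renaming (_≤_ to infix 4 _≤_) public
  open Min Γ-totalOrder using (_⊓_) public

  infixl 6 _−_
  _−_ : Carrierᴹ → Carrierᴹ → Carrierᴹ
  x − y = x +ᴹ (-ᴹ y)

  field
    ∞          : Value
    ∞-maximum  : Maximum _≤_ ∞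
    val        : Carrierᴹ → Value
    val-cong   : Congruent _≈ᴹ_ _≈Γ_ val
    val-surj   : Surjective _≈ᴹ_ _≈Γ_ val
    val-∞      : ∀ x → val x ≈Γ ∞ ⇔ x ≈ᴹ 0ᴹ
    val-−      : ∀ x y → val x ⊓ val y ≤ val (x − y)
    val-scalar : ∀ k x → ¬ k K.≈ K.0# → val (k *ₗ x) ≈Γ val x

  V-setoid Γ-setoid : Setoid ℓ ℓ
  V-setoid = AbelianGroup.setoid V.+ᴹ-abelianGroup
  Γ-setoid = Γ.Eq.setoid

------------------------------------------------------------------------
-- The skeleton

module Skeleton {ℓ} {K : Field ℓ} (𝒱 : ValuedVectorSpace K) where
  open ValuedVectorSpace 𝒱
  private
    module K = Field K
    module ≤ = TotalOrder Γ-totalOrder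
    module VP = AbelianGroupProperties V.+ᴹ-abelianGroup
    module VC = CommutativeSemigroupProperties
                  (CommutativeMonoid.commutativeSemigroup V.+ᴹ-commutativeMonoid)
    module ⊓ = MinOp (Min.minOperator Γ-totalOrder)
    module VR = SetoidReasoning V-setoid

    <⇒≤ : ∀ {α β} → α < β → α ≤ β
    <⇒≤ = inj₁

    ≈⇒≤ : ∀ {α β} → α ≈Γ β → α ≤ β
    ≈⇒≤ = inj₂

    <-≤-trans : ∀ {α β γ} → α < β → β ≤ γ → α < γ
    <-≤-trans p (inj₁ q) = Γ.trans p q
    <-≤-trans p (inj₂ q) = Γ.<-respʳ-≈ q p

    ⊓-glb< : ∀ {α β γ} → α < β → α < γ → α < β ⊓ γ
    ⊓-glb< {α} {β} {γ} p q with ⊓.⊓-sel β γ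
    ... | inj₁ e = Γ.<-respʳ-≈ (Γ.Eq.sym e) p
    ... | inj₂ e = Γ.<-respʳ-≈ (Γ.Eq.sym e) q

    ∞≤ : ∀ {α} → ∞ ≤ α → α ≈Γ ∞
    ∞≤ {α} = ≤.antisym (∞-maximum α)

  val-0 : val 0ᴹ ≈Γ ∞
  val-0 = Equivalence.from (val-∞ 0ᴹ) V.≈ᴹ-refl

  val-neg-≤ : ∀ x → val x ≤ val (-ᴹ x)
  val-neg-≤ x = ≤.trans
    (⊓.⊓-glb (≤.trans (∞-maximum _) (≈⇒≤ (Γ.Eq.sym val-0))) ≤.refl)
    (≤.trans (val-− 0ᴹ x) (≈⇒≤ (val-cong (V.+ᴹ-identityˡ (-ᴹ x)))))

  val-+ : ∀ x y → val x ⊓ val y ≤ val (x +ᴹ y)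
  val-+ x y = ≤.trans (⊓.⊓-monoʳ-≤ (val x) (val-neg-≤ y))
    (≤.trans (val-− x (-ᴹ y))
      (≈⇒≤ (val-cong (V.+ᴹ-congˡ (VP.⁻¹-involutive y)))))

  val-scalar-≤ : ∀ k x → val x ≤ val (k *ₗ x)
  val-scalar-≤ k x with ≤.total (val x) (val (k *ₗ x))
  ... | inj₁ p = p
  ... | inj₂ (inj₂ e) = ≈⇒≤ (Γ.Eq.sym e)
  ... | inj₂ (inj₁ q) = contradiction k≈0 k≉0
    where
    k≉0 : ¬ k K.≈ K.0#
    k≉0 e = Γ.irrefl Γ.Eq.refl (<-≤-trans q (≤.trans (∞-maximum _)
      (≈⇒≤ (Γ.Eq.sym (Γ.Eq.trans
        (val-cong (V.≈ᴹ-trans (V.*ₗ-congʳ e) (V.*ₗ-zeroˡ x))) val-0)))))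

    k≈0 : k K.≈ K.0#
    k≈0 = contradiction q (Γ.irrefl (val-scalar k x k≉0))

  record Rep : Set ℓ where
    constructor ⟨_,_,_⟩
    field
      level  : Value
      vector : Carrierᴹ
      bound  : level ≤ val vector
  open Rep public

  -- The clause level ≈ ∞ is needed only because the ball {x | val x > ∞}
  -- is empty: it makes (∞ , 0) equivalent to itself.  As the only vector
  -- of value ≥ ∞ is 0, there is then exactly one class over ∞.

  infix 4 _≃_
  _≃_ : Rep → Rep → Set ℓ
  σ ≃ τ = level σ ≈Γ level τ ×
          (level σ < val (vector σ − vector τ) ⊎ level σ ≈Γ ∞)

  private
    ball-refl : ∀ γ {v w} → v ≈ᴹ w → γ < val (v − w) ⊎ γ ≈Γ ∞
    ball-refl γ {v} {w} e with ∞-maximum γ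
    ... | inj₂ γ≈∞ = inj₂ γ≈∞
    ... | inj₁ γ<∞ = inj₁ (Γ.<-respʳ-≈ (Γ.Eq.sym (Γ.Eq.trans (val-cong v−w≈0) val-0)) γ<∞)
      where
      v−w≈0 : v − w ≈ᴹ 0ᴹ
      v−w≈0 = V.≈ᴹ-trans (V.+ᴹ-congʳ e) (V.-ᴹ‿inverseʳ w)

    neg-− : ∀ v w → -ᴹ (v − w) ≈ᴹ w − v
    neg-− v w = VR.begin
      -ᴹ (v − w)            VR.≈⟨ VP.⁻¹-anti-homo-∙ v (-ᴹ w) ⟩
      -ᴹ (-ᴹ w) +ᴹ (-ᴹ v)   VR.≈⟨ V.+ᴹ-congʳ (VP.⁻¹-involutive w) ⟩
      w − v                 VR.∎

    −-+-− : ∀ u v w → (u − v) +ᴹ (v − w) ≈ᴹ u − w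
    −-+-− u v w = VR.begin
      (u − v) +ᴹ (v − w)            VR.≈⟨ V.+ᴹ-assoc u (-ᴹ v) (v − w) ⟩
      u +ᴹ (-ᴹ v +ᴹ (v − w))        VR.≈⟨ V.+ᴹ-congˡ (V.+ᴹ-assoc (-ᴹ v) v (-ᴹ w)) ⟨
      u +ᴹ ((-ᴹ v +ᴹ v) +ᴹ (-ᴹ w))  VR.≈⟨ V.+ᴹ-congˡ (V.+ᴹ-congʳ (V.-ᴹ‿inverseˡ v)) ⟩
      u +ᴹ (0ᴹ +ᴹ (-ᴹ w))           VR.≈⟨ V.+ᴹ-congˡ (V.+ᴹ-identityˡ (-ᴹ w)) ⟩
      u − w                         VR.∎

    +-−-+ : ∀ u v u′ v′ → (u − u′) +ᴹ (v − v′) ≈ᴹ (u +ᴹ v) − (u′ +ᴹ v′)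
    +-−-+ u v u′ v′ = V.≈ᴹ-trans (VC.interchange u (-ᴹ u′) v (-ᴹ v′))
                                 (V.+ᴹ-congˡ (VP.⁻¹-∙-comm u′ v′))

    scal-neg : ∀ k v → k *ₗ (-ᴹ v) ≈ᴹ -ᴹ (k *ₗ v)
    scal-neg k v = VP.inverseʳ-unique (k *ₗ v) (k *ₗ (-ᴹ v)) (VR.begin
      k *ₗ v +ᴹ k *ₗ (-ᴹ v)  VR.≈⟨ V.*ₗ-distribˡ k v (-ᴹ v) ⟨
      k *ₗ (v − v)           VR.≈⟨ V.*ₗ-congˡ (V.-ᴹ‿inverseʳ v) ⟩
      k *ₗ 0ᴹ                VR.≈⟨ V.*ₗ-zeroʳ k ⟩
      0ᴹ                     VR.∎)

    ball-scal : ∀ k {γ} v w → γ < val (v − w) → γ < val (k *ₗ v − k *ₗ w)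
    ball-scal k v w p = <-≤-trans p (≤.trans (val-scalar-≤ k (v − w))
      (≈⇒≤ (val-cong (V.≈ᴹ-trans (V.*ₗ-distribˡ k v (-ᴹ w)) (V.+ᴹ-congˡ (scal-neg k w))))))

    ≃-refl : ∀ {σ} → σ ≃ σ
    ≃-refl {σ} = Γ.Eq.refl , ball-refl (level σ) V.≈ᴹ-refl

    ≃-sym : ∀ {σ τ} → σ ≃ τ → τ ≃ σ
    ≃-sym (e , inj₂ p) = Γ.Eq.sym e , inj₂ (Γ.Eq.trans (Γ.Eq.sym e) p)
    ≃-sym {σ} {τ} (e , inj₁ p) = Γ.Eq.sym e , inj₁ (Γ.<-respˡ-≈ e
      (<-≤-trans p (≤.trans (val-neg-≤ _) (≈⇒≤ (val-cong (neg-− (vector σ) (vector τ)))))))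

    ≃-trans : ∀ {σ τ υ} → σ ≃ τ → τ ≃ υ → σ ≃ υ
    ≃-trans (e , inj₂ p) (e′ , _) = Γ.Eq.trans e e′ , inj₂ p
    ≃-trans (e , inj₁ p) (e′ , inj₂ q) = Γ.Eq.trans e e′ , inj₂ (Γ.Eq.trans e q)
    ≃-trans {σ} {τ} {υ} (e , inj₁ p) (e′ , inj₁ q) = Γ.Eq.trans e e′ , inj₁
      (<-≤-trans (⊓-glb< p (Γ.<-respˡ-≈ (Γ.Eq.sym e) q))
        (≤.trans (val-+ _ _) (≈⇒≤ (val-cong (−-+-− (vector σ) (vector τ) (vector υ))))))

  S : Setoid ℓ ℓ
  S = record
    { Carrier = Rep
    ; _≈_ = _≃_
    ; isEquivalence = record
        { refl  = λ {σ} → ≃-refl {σ}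
        ; sym   = λ {σ} {τ} → ≃-sym {σ} {τ}
        ; trans = λ {σ} {τ} {υ} → ≃-trans {σ} {τ} {υ} }
    }

  𝟎 : Rep
  𝟎 = ⟨ ∞ , 0ᴹ , ≈⇒≤ (Γ.Eq.sym val-0) ⟩

  π : Carrierᴹ → Rep
  π v = ⟨ val v , v , ≤.refl ⟩

  valₛ : Rep → Value
  valₛ = level

  infixr 7 _*•_
  _*•_ : Field.Carrier K → Rep → Rep
  k *• ⟨ γ , v , b ⟩ = ⟨ γ , k *ₗ v , ≤.trans b (val-scalar-≤ k v) ⟩

  infixl 6 _+•_
  _+•_ : Rep → Rep → Rep
  ⟨ γ , v , b ⟩ +• ⟨ γ′ , v′ , b′ ⟩ with γ Γ.≟ γ′
  ... | yes e = ⟨ γ , v +ᴹ v′ , ≤.trans (⊓.⊓-glb b (≤.trans (≈⇒≤ e) b′)) (val-+ v v′) ⟩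
  ... | no  _ = 𝟎

  π-cong : ∀ {v w} → v ≈ᴹ w → π v ≃ π w
  π-cong {v} e = val-cong e , ball-refl (val v) e

  *•-cong : ∀ {k k′ σ τ} → k K.≈ k′ → σ ≃ τ → (k *• σ) ≃ (k′ *• τ)
  *•-cong d (e , inj₂ p) = e , inj₂ p
  *•-cong {k} {k′} {σ} {τ} d (e , inj₁ p) = e , inj₁ (Γ.<-respʳ-≈
    (val-cong (V.+ᴹ-congˡ (V.-ᴹ‿cong (V.*ₗ-congʳ d))))
    (ball-scal k (vector σ) (vector τ) p))

  +•-cong : ∀ {σ σ′ τ τ′} → σ ≃ σ′ → τ ≃ τ′ → (σ +• τ) ≃ (σ′ +• τ′)
  +•-cong {σ} {σ′} {τ} {τ′} (e , p) (d , q)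
    with level σ Γ.≟ level τ | level σ′ Γ.≟ level τ′
  ... | no _   | no _   = ≃-refl {𝟎}
  ... | yes c  | no ¬c  = contradiction (Γ.Eq.trans (Γ.Eq.sym e) (Γ.Eq.trans c d)) ¬c
  ... | no ¬c  | yes c  = contradiction (Γ.Eq.trans e (Γ.Eq.trans c (Γ.Eq.sym d))) ¬c
  ... | yes c  | yes _  = e , sum p q
    where
    sum : level σ < val (vector σ − vector σ′) ⊎ level σ ≈Γ ∞ →
          level τ < val (vector τ − vector τ′) ⊎ level τ ≈Γ ∞ →
          level σ < val ((vector σ +ᴹ vector τ) − (vector σ′ +ᴹ vector τ′)) ⊎ level σ ≈Γ ∞
    sum (inj₂ r) _        = inj₂ r
    sum (inj₁ _) (inj₂ r) = inj₂ (Γ.Eq.trans c r)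
    sum (inj₁ r) (inj₁ s) = inj₁ (<-≤-trans (⊓-glb< r (Γ.<-respˡ-≈ (Γ.Eq.sym c) s))
      (≤.trans (val-+ _ _)
        (≈⇒≤ (val-cong (+-−-+ (vector σ) (vector τ) (vector σ′) (vector τ′))))))

-- The only relation symbol of the languages below.

data LessSymbol : Set where
  less : LessSymbol

------------------------------------------------------------------------
-- Fixed base field: the language L_{S,K}, its sublanguage on the skeleton

module FixedField (K : Field ℓ) where
  private module K = Field K

  data Sort : Set where
    V Γ S : Sort

  data Func : Set ℓ where
    +ⱽ 0ⱽ : Func
    scal  : K.Carrier → Func
    ∞ᶠ    : Func
    valᶠ  : Func
    +•ᶠ   : Func
    𝟎ᶠ    : Func
    scal• : K.Carrier → Func
    valₛᶠ : Func
    πᶠ    : Func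

  domain : Func → List Sort
  domain +ⱽ        = V ∷ V ∷ []
  domain 0ⱽ        = []
  domain (scal _)  = V ∷ []
  domain ∞ᶠ        = []
  domain valᶠ      = V ∷ []
  domain +•ᶠ       = S ∷ S ∷ []
  domain 𝟎ᶠ        = []
  domain (scal• _) = S ∷ []
  domain valₛᶠ     = S ∷ []
  domain πᶠ        = V ∷ []

  codomain : Func → Sort
  codomain +ⱽ        = V
  codomain 0ⱽ        = V
  codomain (scal _)  = V
  codomain ∞ᶠ        = Γ
  codomain valᶠ      = Γ
  codomain +•ᶠ       = S
  codomain 𝟎ᶠ        = S
  codomain (scal• _) = S
  codomain valₛᶠ     = Γ
  codomain πᶠ        = S

  L : Signature ℓ
  L = record
    { Sort = Sort ; Func = Func ; domain = domain ; codomain = codomain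
    ; Rel = LessSymbol ; arity = λ { less → Γ ∷ Γ ∷ [] } }

  -- Without ∞ as a symbol, which is the value valₛ 𝟎.

  data SkSort : Set where
    Γ S : SkSort

  data SkFunc : Set ℓ where
    +•ᶠ   : SkFunc
    𝟎ᶠ    : SkFunc
    scal• : K.Carrier → SkFunc
    valₛᶠ : SkFunc

  skDomain : SkFunc → List SkSort
  skDomain +•ᶠ       = S ∷ S ∷ []
  skDomain 𝟎ᶠ        = []
  skDomain (scal• _) = S ∷ []
  skDomain valₛᶠ     = S ∷ []

  skCodomain : SkFunc → SkSort
  skCodomain +•ᶠ       = S
  skCodomain 𝟎ᶠ        = S
  skCodomain (scal• _) = S
  skCodomain valₛᶠ     = Γ

  SkL : Signature ℓ
  SkL = record
    { Sort = SkSort ; Func = SkFunc ; domain = skDomain ; codomain = skCodomain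
    ; Rel = LessSymbol ; arity = λ { less → Γ ∷ Γ ∷ [] } }

  module _ (𝒱 : ValuedVectorSpace K) where
    open ValuedVectorSpace 𝒱 hiding (module V; module Γ)
    private
      module V′ = ValuedVectorSpace.V 𝒱
      module Γ′ = ValuedVectorSpace.Γ 𝒱
      module Sk = Skeleton 𝒱
    open Sk using (_+•_; _*•_; 𝟎; π; valₛ)

    structure : Structure L ℓ
    structure = record
      { sort      = λ { V → V-setoid ; Γ → Γ-setoid ; S → Sk.S }
      ; func      = λ
          { +ⱽ        (x ∷ y ∷ []) → x +ᴹ y
          ; 0ⱽ        []           → 0ᴹ
          ; (scal k)  (x ∷ [])     → k *ₗ x
          ; ∞ᶠ        []           → ∞
          ; valᶠ      (x ∷ [])     → val x
          ; +•ᶠ       (σ ∷ τ ∷ []) → σ +• τ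
          ; 𝟎ᶠ        []           → 𝟎
          ; (scal• k) (σ ∷ [])     → k *• σ
          ; valₛᶠ     (σ ∷ [])     → valₛ σ
          ; πᶠ        (x ∷ [])     → π x
          }
      ; func-cong = λ
          { +ⱽ        (p ∷ q ∷ []) → V′.+ᴹ-cong p q
          ; 0ⱽ        []           → V′.≈ᴹ-refl
          ; (scal k)  (p ∷ [])     → V′.*ₗ-congˡ p
          ; ∞ᶠ        []           → Γ′.Eq.refl
          ; valᶠ      (p ∷ [])     → val-cong p
          ; +•ᶠ {σ ∷ τ ∷ []} {σ′ ∷ τ′ ∷ []} (p ∷ q ∷ []) → Sk.+•-cong {σ} {σ′} {τ} {τ′} p q
          ; 𝟎ᶠ        []           → Setoid.refl Sk.S {𝟎}
          ; (scal• k) {σ ∷ []} {τ ∷ []} (p ∷ []) → Sk.*•-cong {σ = σ} {τ} K.refl p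
          ; valₛᶠ     (p ∷ [])     → proj₁ p
          ; πᶠ        (p ∷ [])     → Sk.π-cong p
          }
      ; relation  = λ { less (α ∷ β ∷ []) → α < β }
      ; rel-cong  = λ { less (p ∷ q ∷ []) r → Γ′.<-respʳ-≈ q (Γ′.<-respˡ-≈ p r) }
      }

    skeleton : Structure SkL ℓ
    skeleton = record
      { sort      = λ { Γ → Γ-setoid ; S → Sk.S }
      ; func      = λ
          { +•ᶠ       (σ ∷ τ ∷ []) → σ +• τ
          ; 𝟎ᶠ        []           → 𝟎
          ; (scal• k) (σ ∷ [])     → k *• σ
          ; valₛᶠ     (σ ∷ [])     → valₛ σ
          }
      ; func-cong = λ
          { +•ᶠ {σ ∷ τ ∷ []} {σ′ ∷ τ′ ∷ []} (p ∷ q ∷ []) → Sk.+•-cong {σ} {σ′} {τ} {τ′} p q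
          ; 𝟎ᶠ        []           → Setoid.refl Sk.S {𝟎}
          ; (scal• k) {σ ∷ []} {τ ∷ []} (p ∷ []) → Sk.*•-cong {σ = σ} {τ} K.refl p
          ; valₛᶠ     (p ∷ [])     → proj₁ p
          }
      ; relation  = λ { less (α ∷ β ∷ []) → α < β }
      ; rel-cong  = λ { less (p ∷ q ∷ []) r → Γ′.<-respʳ-≈ q (Γ′.<-respˡ-≈ p r) }
      }

  skeletonEmbedding : {𝒱 𝒲 : ValuedVectorSpace K} →
    Embedding (structure 𝒱) (structure 𝒲) → Embedding (skeleton 𝒱) (skeleton 𝒲)
  skeletonEmbedding h = record
    { map       = λ { {Γ} → map {Γ} ; {S} → map {S} }
    ; map-cong  = λ { {Γ} → map-cong {Γ} ; {S} → map-cong {S} }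
    ; injective = λ { {Γ} → injective {Γ} ; {S} → injective {S} }
    ; map-func  = λ
        { +•ᶠ       (σ ∷ τ ∷ []) → map-func +•ᶠ (σ ∷ τ ∷ [])
        ; 𝟎ᶠ        []           → map-func 𝟎ᶠ []
        ; (scal• k) (σ ∷ [])     → map-func (scal• k) (σ ∷ [])
        ; valₛᶠ     (σ ∷ [])     → map-func valₛᶠ (σ ∷ [])
        }
    ; map-rel   = λ { less (α ∷ β ∷ []) → map-rel less (α ∷ β ∷ []) }
    }
    where open Embedding h

------------------------------------------------------------------------
-- Variable base field: the language L_S, its sublanguage on the skeleton

module VariableField where

  data Sort : Set where
    V K Γ S : Sort

  data Func : Set where
    +ⱽ 0ⱽ       : Func
    +ᴷ *ᴷ 0ᴷ 1ᴷ : Func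
    ∞ᶠ          : Func
    scal        : Func
    valᶠ        : Func
    +•ᶠ         : Func
    𝟎ᶠ          : Func
    scal•       : Func
    valₛᶠ       : Func
    πᶠ          : Func

  domain : Func → List Sort
  domain +ⱽ    = V ∷ V ∷ []
  domain 0ⱽ    = []
  domain +ᴷ    = K ∷ K ∷ []
  domain *ᴷ    = K ∷ K ∷ []
  domain 0ᴷ    = []
  domain 1ᴷ    = []
  domain ∞ᶠ    = []
  domain scal  = K ∷ V ∷ []
  domain valᶠ  = V ∷ []
  domain +•ᶠ   = S ∷ S ∷ []
  domain 𝟎ᶠ    = []
  domain scal• = K ∷ S ∷ []
  domain valₛᶠ = S ∷ []
  domain πᶠ    = V ∷ []

  codomain : Func → Sort
  codomain +ⱽ    = V
  codomain 0ⱽ    = V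
  codomain +ᴷ    = K
  codomain *ᴷ    = K
  codomain 0ᴷ    = K
  codomain 1ᴷ    = K
  codomain ∞ᶠ    = Γ
  codomain scal  = V
  codomain valᶠ  = Γ
  codomain +•ᶠ   = S
  codomain 𝟎ᶠ    = S
  codomain scal• = S
  codomain valₛᶠ = Γ
  codomain πᶠ    = S

  L : Signature 0ℓ
  L = record
    { Sort = Sort ; Func = Func ; domain = domain ; codomain = codomain
    ; Rel = LessSymbol ; arity = λ { less → Γ ∷ Γ ∷ [] } }

  data SkSort : Set where
    K Γ S : SkSort

  data SkFunc : Set where
    +ᴷ *ᴷ 0ᴷ 1ᴷ : SkFunc
    +•ᶠ         : SkFunc
    𝟎ᶠ          : SkFunc
    scal•       : SkFunc
    valₛᶠ       : SkFunc

  skDomain : SkFunc → List SkSort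
  skDomain +ᴷ    = K ∷ K ∷ []
  skDomain *ᴷ    = K ∷ K ∷ []
  skDomain 0ᴷ    = []
  skDomain 1ᴷ    = []
  skDomain +•ᶠ   = S ∷ S ∷ []
  skDomain 𝟎ᶠ    = []
  skDomain scal• = K ∷ S ∷ []
  skDomain valₛᶠ = S ∷ []

  skCodomain : SkFunc → SkSort
  skCodomain +ᴷ    = K
  skCodomain *ᴷ    = K
  skCodomain 0ᴷ    = K
  skCodomain 1ᴷ    = K
  skCodomain +•ᶠ   = S
  skCodomain 𝟎ᶠ    = S
  skCodomain scal• = S
  skCodomain valₛᶠ = Γ

  SkL : Signature 0ℓ
  SkL = record
    { Sort = SkSort ; Func = SkFunc ; domain = skDomain ; codomain = skCodomain
    ; Rel = LessSymbol ; arity = λ { less → Γ ∷ Γ ∷ [] } }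

  module _ {F : Field ℓ} (𝒱 : ValuedVectorSpace F) where
    open ValuedVectorSpace 𝒱 hiding (module V; module Γ)
    private
      module F = Field F
      module V′ = ValuedVectorSpace.V 𝒱
      module Γ′ = ValuedVectorSpace.Γ 𝒱
      module Sk = Skeleton 𝒱
    open Sk using (_+•_; _*•_; 𝟎; π; valₛ)

    structure : Structure L ℓ
    structure = record
      { sort      = λ { V → V-setoid ; K → F.setoid ; Γ → Γ-setoid ; S → Sk.S }
      ; func      = λ
          { +ⱽ    (x ∷ y ∷ []) → x +ᴹ y
          ; 0ⱽ    []           → 0ᴹ
          ; +ᴷ    (a ∷ b ∷ []) → a F.+ b
          ; *ᴷ    (a ∷ b ∷ []) → a F.* b
          ; 0ᴷ    []           → F.0#
          ; 1ᴷ    []           → F.1#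
          ; ∞ᶠ    []           → ∞
          ; scal  (k ∷ x ∷ []) → k *ₗ x
          ; valᶠ  (x ∷ [])     → val x
          ; +•ᶠ   (σ ∷ τ ∷ []) → σ +• τ
          ; 𝟎ᶠ    []           → 𝟎
          ; scal• (k ∷ σ ∷ []) → k *• σ
          ; valₛᶠ (σ ∷ [])     → valₛ σ
          ; πᶠ    (x ∷ [])     → π x
          }
      ; func-cong = λ
          { +ⱽ    (p ∷ q ∷ []) → V′.+ᴹ-cong p q
          ; 0ⱽ    []           → V′.≈ᴹ-refl
          ; +ᴷ    (p ∷ q ∷ []) → F.+-cong p q
          ; *ᴷ    (p ∷ q ∷ []) → F.*-cong p q
          ; 0ᴷ    []           → F.refl
          ; 1ᴷ    []           → F.refl
          ; ∞ᶠ    []           → Γ′.Eq.refl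
          ; scal  (p ∷ q ∷ []) → V′.*ₗ-cong p q
          ; valᶠ  (p ∷ [])     → val-cong p
          ; +•ᶠ {σ ∷ τ ∷ []} {σ′ ∷ τ′ ∷ []} (p ∷ q ∷ []) → Sk.+•-cong {σ} {σ′} {τ} {τ′} p q
          ; 𝟎ᶠ    []           → Setoid.refl Sk.S {𝟎}
          ; scal• {_ ∷ σ ∷ []} {_ ∷ τ ∷ []} (p ∷ q ∷ []) → Sk.*•-cong {σ = σ} {τ} p q
          ; valₛᶠ (p ∷ [])     → proj₁ p
          ; πᶠ    (p ∷ [])     → Sk.π-cong p
          }
      ; relation  = λ { less (α ∷ β ∷ []) → α < β }
      ; rel-cong  = λ { less (p ∷ q ∷ []) r → Γ′.<-respʳ-≈ q (Γ′.<-respˡ-≈ p r) }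
      }

    skeleton : Structure SkL ℓ
    skeleton = record
      { sort      = λ { K → F.setoid ; Γ → Γ-setoid ; S → Sk.S }
      ; func      = λ
          { +ᴷ    (a ∷ b ∷ []) → a F.+ b
          ; *ᴷ    (a ∷ b ∷ []) → a F.* b
          ; 0ᴷ    []           → F.0#
          ; 1ᴷ    []           → F.1#
          ; +•ᶠ   (σ ∷ τ ∷ []) → σ +• τ
          ; 𝟎ᶠ    []           → 𝟎
          ; scal• (k ∷ σ ∷ []) → k *• σ
          ; valₛᶠ (σ ∷ [])     → valₛ σ
          }
      ; func-cong = λ
          { +ᴷ    (p ∷ q ∷ []) → F.+-cong p q
          ; *ᴷ    (p ∷ q ∷ []) → F.*-cong p q
          ; 0ᴷ    []           → F.refl
          ; 1ᴷ    []           → F.refl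
          ; +•ᶠ {σ ∷ τ ∷ []} {σ′ ∷ τ′ ∷ []} (p ∷ q ∷ []) → Sk.+•-cong {σ} {σ′} {τ} {τ′} p q
          ; 𝟎ᶠ    []           → Setoid.refl Sk.S {𝟎}
          ; scal• {_ ∷ σ ∷ []} {_ ∷ τ ∷ []} (p ∷ q ∷ []) → Sk.*•-cong {σ = σ} {τ} p q
          ; valₛᶠ (p ∷ [])     → proj₁ p
          }
      ; relation  = λ { less (α ∷ β ∷ []) → α < β }
      ; rel-cong  = λ { less (p ∷ q ∷ []) r → Γ′.<-respʳ-≈ q (Γ′.<-respˡ-≈ p r) }
      }

  skeletonEmbedding : {F G : Field ℓ} {𝒱 : ValuedVectorSpace F} {𝒲 : ValuedVectorSpace G} →
    Embedding (structure 𝒱) (structure 𝒲) → Embedding (skeleton 𝒱) (skeleton 𝒲)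
  skeletonEmbedding h = record
    { map       = λ { {K} → map {K} ; {Γ} → map {Γ} ; {S} → map {S} }
    ; map-cong  = λ { {K} → map-cong {K} ; {Γ} → map-cong {Γ} ; {S} → map-cong {S} }
    ; injective = λ { {K} → injective {K} ; {Γ} → injective {Γ} ; {S} → injective {S} }
    ; map-func  = λ
        { +ᴷ    (a ∷ b ∷ []) → map-func +ᴷ (a ∷ b ∷ [])
        ; *ᴷ    (a ∷ b ∷ []) → map-func *ᴷ (a ∷ b ∷ [])
        ; 0ᴷ    []           → map-func 0ᴷ []
        ; 1ᴷ    []           → map-func 1ᴷ []
        ; +•ᶠ   (σ ∷ τ ∷ []) → map-func +•ᶠ (σ ∷ τ ∷ [])
        ; 𝟎ᶠ    []           → map-func 𝟎ᶠ []
        ; scal• (k ∷ σ ∷ []) → map-func scal• (k ∷ σ ∷ [])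
        ; valₛᶠ (σ ∷ [])     → map-func valₛᶠ (σ ∷ [])
        }
    ; map-rel   = λ { less (α ∷ β ∷ []) → map-rel less (α ∷ β ∷ []) }
    }
    where open Embedding h

{-# OPTIONS --safe #-}
module Submission where

-- The vector quantifiers can be eliminated in favour of skeletal ones.  Given vectors
-- w₁, …, w_p, write x = a + y, where a is taken from a set of combinations of the wᵢ
-- so that y has the greatest possible value.  Then val (k y + u) = min (val (k y)) (val u) for the
-- relevant combinations u of the wᵢ, so that π (k y + u) is π (k y), π u or
-- π (k y) +• π u, according to the order of the values.  Hence the truth of a formula
-- at x, w₁, …, w_p depends only on σ = π y and on the elements π (Σ cᵢ wᵢ), and
-- "y has the greatest possible value" is a condition on σ in the skeleton: σ is not
-- the zero class of a level below ∞, and σ +• π u is not such a class either.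
--
-- Over a fixed field only the finitely many coefficient vectors occurring in the
-- formula matter, and a runs through 0 and the zeros of the terms t x + Σ tᵢ wᵢ.  Over a
-- variable field a runs through the span of the wᵢ, which is quantified over K, and
-- y exists because spans of finitely many vectors admit best approximations.
--
-- The resulting translation of formulas does not depend on the valued vector space,
-- so it transfers truth along the embedding once the skeletons do.

open import Algebra.Bundles using (CommutativeMonoid)
import Algebra.Construct.NaturalChoice.Min as Min
import Algebra.Construct.NaturalChoice.MinOp as MinOp
import Algebra.Properties.AbelianGroup as AbelianGroupProperties
import Algebra.Properties.CommutativeSemigroup as CommutativeSemigroupProperties
open import Axiom.ExcludedMiddle using (ExcludedMiddle)
import Data.Empty.Polymorphic as Empty
open import Data.Fin.Base using (Fin; zero; suc)
open import Data.List.Base using (List; []; _∷_; _++_; map; cartesianProductWith)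
import Data.List.Extrema as Extrema
open import Data.List.Membership.Propositional using (_∈_)
open import Data.List.Membership.Propositional.Properties
  using (∈-map⁺; ∈-++⁺ˡ; ∈-++⁺ʳ; ∈-cartesianProductWith⁺)
open import Data.List.Relation.Unary.All as All using (All; []; _∷_)
import Data.List.Relation.Unary.All.Properties as All
open import Data.List.Relation.Unary.Any using (here; there)
open import Data.Nat.Base using (ℕ; zero; suc)
open import Data.Product.Base using (∃-syntax; _×_; _,_; proj₁; proj₂)
open import Data.Sum.Base using (inj₁; inj₂)
open import Data.Unit.Polymorphic using (⊤)
open import Data.Vec.Functional using () renaming (_∷_ to _◂_)
open import Function.Base using (_∘_; id)
open import Function.Bundles using (_⇔_; mk⇔; Equivalence)
open import Function.Construct.Composition using (_⇔-∘_)
open import Function.Construct.Identity using (⇔-id)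
open import Function.Construct.Symmetry using (⇔-sym)
open import Function.Related.TypeIsomorphisms using (→-cong-⇔)
open import Level using (_⊔_)
open import Relation.Binary.Bundles using (Setoid; TotalOrder)
open import Relation.Binary.Definitions using (tri<; tri≈; tri>)
open import Relation.Binary.PropositionalEquality using (_≡_; refl; sym; trans; cong; cong₂; subst)
import Relation.Binary.Reasoning.Setoid as SetoidReasoning
open import Relation.Nullary.Decidable using (yes; no)
open import Relation.Nullary.Negation using (¬_; contradiction)
open import Defs

-- Valued vector spaces and their skeletons

-- The skeleton keeps only the leading class of a vector, so π (u + w) is lost as soon as leading
-- terms cancel: `π u +• π w` is then a zero class of level below ∞. The choice of y excludes
-- cancellation between its multiples and the combinations that matter, and it is expressible
-- because cancellation itself is visible in the skeleton.
--
-- Over a fixed field scalars are function symbols and cannot be quantified, so orthogonality to a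
-- whole span is not a formula. Hence the coefficient vectors needed by a formula are collected
-- beforehand, and orthogonality is demanded only there. Over a variable field coefficients contain
-- bound variables, no finite list suffices, and orthogonality to the span is stated with scalar
-- quantifiers.
--
-- The second case has a further difficulty with free vectors: in the larger space their span is
-- taken over the larger field, where a best approximation from the smaller space might be improved.
-- Elementarity of the skeleton map, applied to the formula that describes best approximations,
-- rules this out before the formula in question is transferred.

module Skeletal {ℓ} {K : Field ℓ} (𝒱 : ValuedVectorSpace K) where
  open ValuedVectorSpace 𝒱
  open Skeleton 𝒱
  private
    module K = Field K
    module ≤ = TotalOrder Γ-totalOrder
    module ⊓ = MinOp (Min.minOperator Γ-totalOrder)
    module VP = AbelianGroupProperties V.+ᴹ-abelianGroup
    module S = Setoid S
    module VR = SetoidReasoning V-setoid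

  <-≤-trans : ∀ {α β γ} → α < β → β ≤ γ → α < γ
  <-≤-trans p (inj₁ q) = Γ.trans p q
  <-≤-trans p (inj₂ q) = Γ.<-respʳ-≈ q p

  ≤⇒≯ : ∀ {α β} → α ≤ β → ¬ β < α
  ≤⇒≯ p q = Γ.irrefl Γ.Eq.refl (<-≤-trans q p)

  ≯⇒≤ : ∀ {α β} → ¬ β < α → α ≤ β
  ≯⇒≤ {α} {β} ¬q with Γ.compare α β
  ... | tri< p _ _ = inj₁ p
  ... | tri≈ _ p _ = inj₂ p
  ... | tri> _ _ q = contradiction q ¬q

  ≈⇒≤ : ∀ {α β} → α ≈Γ β → α ≤ β
  ≈⇒≤ = inj₂

  val-≈0 : ∀ {v} → v ≈ᴹ 0ᴹ → val v ≈Γ ∞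
  val-≈0 {v} = Equivalence.from (val-∞ v)

  x−0≈x : ∀ x → x − 0ᴹ ≈ᴹ x
  x−0≈x x = V.≈ᴹ-trans (V.+ᴹ-congˡ VP.ε⁻¹≈ε) (V.+ᴹ-identityʳ x)

  x−0*y≈x : ∀ x y → x − K.0# *ₗ y ≈ᴹ x
  x−0*y≈x x y = V.≈ᴹ-trans (V.+ᴹ-congˡ (V.-ᴹ‿cong (V.*ₗ-zeroˡ y))) (x−0≈x x)

  -- The split on the level comes from the empty ball over ∞: equal vectors differ by 0, whose value
  -- ∞ exceeds the level only below ∞.
  mk≃ : ∀ {σ τ} → level σ ≈Γ level τ → vector σ ≈ᴹ vector τ → σ ≃ τ
  mk≃ {σ} {τ} e d with ∞-maximum (level σ)
  ... | inj₂ p = e , inj₂ p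
  ... | inj₁ p = e , inj₁ (Γ.<-respʳ-≈ (Γ.Eq.sym (val-≈0 (VP.x≈y⇒x∙y⁻¹≈ε d))) p)

  val-+-≤ : ∀ {γ} u w → γ ≤ val u → γ ≤ val w → γ ≤ val (u +ᴹ w)
  val-+-≤ u w p q = ≤.trans (⊓.⊓-glb p q) (val-+ u w)

  val-+-< : ∀ {γ} u w → γ < val u → γ < val w → γ < val (u +ᴹ w)
  val-+-< {γ} u w p q with ⊓.⊓-sel (val u) (val w)
  ... | inj₁ e = <-≤-trans (Γ.<-respʳ-≈ (Γ.Eq.sym e) p) (val-+ u w)
  ... | inj₂ e = <-≤-trans (Γ.<-respʳ-≈ (Γ.Eq.sym e) q) (val-+ u w)

  val-neg : ∀ u → val (-ᴹ u) ≈Γ val u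
  val-neg u = ≤.antisym (≤.trans (val-neg-≤ (-ᴹ u)) (≈⇒≤ (val-cong (VP.⁻¹-involutive u))))
                        (val-neg-≤ u)

  val-−-< : ∀ {γ} u w → γ < val u → γ < val w → γ < val (u − w)
  val-−-< u w p q = val-+-< u (-ᴹ w) p (Γ.<-respʳ-≈ (Γ.Eq.sym (val-neg w)) q)

  -- If u + w had larger value than w, then so would w = (u + w) - u.
  val-+-minʳ : ∀ u w → val w < val u → val (u +ᴹ w) ≈Γ val w
  val-+-minʳ u w p = ≤.antisym
    (≯⇒≤ λ q → Γ.irrefl Γ.Eq.refl
      (Γ.<-respʳ-≈ (val-cong (VP.xyx⁻¹≈y u w)) (val-−-< (u +ᴹ w) u q p)))
    (val-+-≤ u w (inj₁ p) ≤.refl)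

  π-0 : ∀ {v} → π v ≃ 𝟎 ⇔ v ≈ᴹ 0ᴹ
  π-0 {v} = mk⇔ (λ e → Equivalence.to (val-∞ v) (proj₁ e)) (λ e → mk≃ {π v} {𝟎} (val-≈0 e) e)

  π-*ₗ : ∀ {k σ y} → ¬ k K.≈ K.0# → σ ≃ π y → k *• σ ≃ π (k *ₗ y)
  π-*ₗ {k} {σ} {y} k≉0 e = S.trans {k *• σ} {k *• π y} {π (k *ₗ y)}
    (*•-cong {σ = σ} {π y} K.refl e)
    (mk≃ {k *• π y} {π (k *ₗ y)} (Γ.Eq.sym (val-scalar k y k≉0)) V.≈ᴹ-refl)

  +•-≈ : ∀ {σ τ} → level σ ≈Γ level τ →
         level (σ +• τ) ≈Γ level σ × vector (σ +• τ) ≈ᴹ vector σ +ᴹ vector τ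
  +•-≈ {σ} {τ} e with level σ Γ.≟ level τ
  ... | yes _ = Γ.Eq.refl , V.≈ᴹ-refl
  ... | no ¬e = contradiction e ¬e

  +•-≉ : ∀ {σ τ} → ¬ level σ ≈Γ level τ → σ +• τ ≃ 𝟎
  +•-≉ {σ} {τ} ¬e with level σ Γ.≟ level τ
  ... | yes e = contradiction e ¬e
  ... | no _ = S.refl {𝟎}

  -- The vectors w and u + w differ by -u, whose value exceeds their common value.
  π-+-minʳ : ∀ {σ τ u w} → σ ≃ π u → τ ≃ π w → level τ < level σ → τ ≃ π (u +ᴹ w)
  π-+-minʳ {σ} {τ} {u} {w} σ≃πu τ≃πw τ<σ = S.trans {τ} {π w} {π (u +ᴹ w)} τ≃πw
    (Γ.Eq.sym (val-+-minʳ u w w<u) , inj₁ (Γ.<-respʳ-≈ (Γ.Eq.sym e) w<u))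
    where
    w<u : val w < val u
    w<u = Γ.<-respʳ-≈ (proj₁ σ≃πu) (Γ.<-respˡ-≈ (proj₁ τ≃πw) τ<σ)

    w−[u+w]≈−u : w − (u +ᴹ w) ≈ᴹ -ᴹ u
    w−[u+w]≈−u = VR.begin
      w − (u +ᴹ w)             VR.≈⟨ V.+ᴹ-congˡ (V.-ᴹ‿cong (V.+ᴹ-comm u w)) ⟩
      w − (w +ᴹ u)             VR.≈⟨ V.+ᴹ-congˡ (VP.⁻¹-∙-comm w u) ⟨
      w +ᴹ (-ᴹ w +ᴹ (-ᴹ u))    VR.≈⟨ V.+ᴹ-assoc w (-ᴹ w) (-ᴹ u) ⟨
      (w − w) +ᴹ (-ᴹ u)        VR.≈⟨ V.+ᴹ-congʳ (V.-ᴹ‿inverseʳ w) ⟩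
      0ᴹ +ᴹ (-ᴹ u)             VR.≈⟨ V.+ᴹ-identityˡ (-ᴹ u) ⟩
      -ᴹ u                     VR.∎

    e : val (w − (u +ᴹ w)) ≈Γ val u
    e = Γ.Eq.trans (val-cong w−[u+w]≈−u) (val-neg u)

  π-+-minˡ : ∀ {σ τ u w} → σ ≃ π u → τ ≃ π w → level σ < level τ → σ ≃ π (u +ᴹ w)
  π-+-minˡ {σ} {τ} {u} {w} p q r = S.trans {σ} {π (w +ᴹ u)} {π (u +ᴹ w)}
    (π-+-minʳ {τ} {σ} q p r) (π-cong (V.+ᴹ-comm w u))

  -- Orthogonality and its trace in the skeleton

  infix 4 _⟂_
  -- Equivalent to val (u + w) being the minimum of both values: the inequality fails only if val u
  -- = val w and the leading terms cancel. The one-sided form is what maximality of val u among the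
  -- vectors u + w provides directly.
  _⟂_ : Carrierᴹ → Carrierᴹ → Set ℓ
  u ⟂ w = val (u +ᴹ w) ≤ val u

  ⟂-cong : ∀ {u u′ w w′} → u ≈ᴹ u′ → w ≈ᴹ w′ → u ⟂ w → u′ ⟂ w′
  ⟂-cong p q r = ≤.trans (≈⇒≤ (Γ.Eq.sym (val-cong (V.+ᴹ-cong p q)))) (≤.trans r (≈⇒≤ (val-cong p)))

  π-+ : ∀ {σ τ u w} → σ ≃ π u → τ ≃ π w → u ⟂ w → level σ ≈Γ level τ → σ +• τ ≃ π (u +ᴹ w)
  π-+ {σ} {τ} {u} {w} p q u⟂w e =
    S.trans {σ +• τ} {π u +• π w} {π (u +ᴹ w)} (+•-cong {σ} {π u} {τ} {π w} p q)
      (mk≃ {π u +• π w} {π (u +ᴹ w)}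
        (Γ.Eq.trans (proj₁ r) (≤.antisym (val-+-≤ u w ≤.refl (≈⇒≤ d)) u⟂w)) (proj₂ r))
    where
    d : val u ≈Γ val w
    d = Γ.Eq.trans (Γ.Eq.sym (proj₁ p)) (Γ.Eq.trans e (proj₁ q))
    r = +•-≈ {π u} {π w} d

  0⟂ : ∀ {u w} → u ≈ᴹ 0ᴹ → u ⟂ w
  0⟂ e = ≤.trans (∞-maximum _) (≈⇒≤ (Γ.Eq.sym (val-≈0 e)))

  -- k y + u = k (y + k⁻¹ u), and nonzero scalars preserve values.
  ⟂-scale : ∀ {k y u} → ¬ k K.≈ K.0# → (∀ l → y ⟂ l *ₗ u) → k *ₗ y ⟂ u
  ⟂-scale {k} {y} {u} k≉0 p with K.inverse k k≉0
  ... | l , kl≈1 = ≤.trans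
    (≈⇒≤ (Γ.Eq.trans (val-cong (V.≈ᴹ-trans (V.+ᴹ-congˡ e) (V.≈ᴹ-sym (V.*ₗ-distribˡ k y (l *ₗ u)))))
                     (val-scalar k _ k≉0)))
    (≤.trans (p l) (≈⇒≤ (Γ.Eq.sym (val-scalar k y k≉0))))
    where
    e : u ≈ᴹ k *ₗ (l *ₗ u)
    e = V.≈ᴹ-trans (V.≈ᴹ-sym (V.*ₗ-identityˡ u)) (V.≈ᴹ-trans (V.*ₗ-congʳ (K.sym kl≈1)) (V.*ₗ-assoc k l u))

  -- `K.0# *• σ` is the zero class at the level of σ. At equal levels below ∞, a sum in that class
  -- means that y + w has larger value than y, that is, cancellation. At distinct levels the sum is
  -- 𝟎, and the equation forces the level of σ to be ∞. The conclusion `σ ≃ 𝟎` lets the level ∞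
  -- pass, where y = 0 is orthogonal to everything.
  ⟂-skeletal : ∀ {σ τ y w} → σ ≃ π y → τ ≃ π w →
               (τ +• σ ≃ K.0# *• σ → σ ≃ 𝟎) ⇔ y ⟂ w
  ⟂-skeletal {σ} {τ} {y} {w} p q = mk⇔ to from
    where
    transport : τ +• σ ≃ K.0# *• σ ⇔ π w +• π y ≃ K.0# *• π y
    transport = mk⇔
      (λ e → S.trans {π w +• π y} {τ +• σ} {K.0# *• π y}
        (S.sym {τ +• σ} {π w +• π y} a) (S.trans {τ +• σ} {K.0# *• σ} {K.0# *• π y} e b))
      (λ e → S.trans {τ +• σ} {π w +• π y} {K.0# *• σ} a
        (S.trans {π w +• π y} {K.0# *• π y} {K.0# *• σ} e (S.sym {K.0# *• σ} {K.0# *• π y} b)))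
      where
      a : τ +• σ ≃ π w +• π y
      a = +•-cong {τ} {π w} {σ} {π y} q p
      b : K.0# *• σ ≃ K.0# *• π y
      b = *•-cong {σ = σ} {π y} K.refl p

    to : (τ +• σ ≃ K.0# *• σ → σ ≃ 𝟎) → y ⟂ w
    to f = ≯⇒≤ λ lt → ≤⇒≯ (∞-maximum (val (y +ᴹ w))) (Γ.<-respˡ-≈
        (Γ.Eq.trans (Γ.Eq.sym (proj₁ p)) (proj₁ (f (Equivalence.from transport (zero-sum lt))))) lt)
      where
      zero-sum : val y < val (y +ᴹ w) → π w +• π y ≃ K.0# *• π y
      zero-sum lt = Γ.Eq.trans (proj₁ r) e , inj₁ (Γ.<-respˡ-≈ (Γ.Eq.sym (Γ.Eq.trans (proj₁ r) e))
          (Γ.<-respʳ-≈ (val-cong d) lt))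
        where
        -- Cancellation forces equal values, since w = (y + w) - y.
        e : val w ≈Γ val y
        e = Γ.Eq.trans (val-cong (V.≈ᴹ-sym (VP.xyx⁻¹≈y y w)))
          (Γ.Eq.trans (val-+-minʳ (y +ᴹ w) (-ᴹ y) (Γ.<-respˡ-≈ (Γ.Eq.sym (val-neg y)) lt)) (val-neg y))
        r = +•-≈ {π w} {π y} e
        d : y +ᴹ w ≈ᴹ vector (π w +• π y) − K.0# *ₗ y
        d = V.≈ᴹ-sym (V.≈ᴹ-trans (x−0*y≈x _ y) (V.≈ᴹ-trans (proj₂ r) (V.+ᴹ-comm w y)))

    from : y ⟂ w → τ +• σ ≃ K.0# *• σ → σ ≃ 𝟎
    from y⟂w e = S.trans {σ} {π y} {𝟎} p (Equivalence.from π-0 (Equivalence.to (val-∞ y) val-y≈∞))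
      where
      e′ : π w +• π y ≃ K.0# *• π y
      e′ = Equivalence.to transport e
      val-y≈∞ : val y ≈Γ ∞
      val-y≈∞ with val w Γ.≟ val y
      ... | no ¬d = Γ.Eq.trans (Γ.Eq.sym (proj₁ e′)) (proj₁ (+•-≉ {π w} {π y} ¬d))
      ... | yes d with +•-≈ {π w} {π y} d | proj₂ e′
      ...   | r | inj₂ i = Γ.Eq.trans (Γ.Eq.sym (proj₁ e′)) i
      ...   | r | inj₁ i = contradiction
        (Γ.<-respˡ-≈ (proj₁ e′) (Γ.<-respʳ-≈
          (val-cong (V.≈ᴹ-trans (x−0*y≈x _ y) (V.≈ᴹ-trans (proj₂ r) (V.+ᴹ-comm w y)))) i))
        (≤⇒≯ y⟂w)

  -- A representative with strict bound has its vector in the ball of its level, so it is the zero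
  -- class there; any other is `π` of its own vector. Among zero classes only the one over ∞ is in
  -- the image, as `π 0ᴹ`.
  π-image : ∀ {σ} → (σ ≃ K.0# *• σ → σ ≃ 𝟎) ⇔ (∃[ y ] σ ≃ π y)
  π-image {σ} = mk⇔ to from
    where
    to : (σ ≃ K.0# *• σ → σ ≃ 𝟎) → ∃[ y ] σ ≃ π y
    to f with bound σ
    ... | inj₂ e = vector σ , mk≃ {σ} {π (vector σ)} e V.≈ᴹ-refl
    ... | inj₁ p = 0ᴹ , S.trans {σ} {𝟎} {π 0ᴹ}
      (f (Γ.Eq.refl , inj₁ (Γ.<-respʳ-≈ (Γ.Eq.sym (val-cong (x−0*y≈x _ _))) p)))
      (S.sym {π 0ᴹ} {𝟎} (Equivalence.from π-0 V.≈ᴹ-refl))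

    from : ∃[ y ] σ ≃ π y → σ ≃ K.0# *• σ → σ ≃ 𝟎
    from (y , p) e with S.trans {π y} {σ} {K.0# *• π y} (S.sym {σ} {π y} p)
                          (S.trans {σ} {K.0# *• σ} {K.0# *• π y} e (*•-cong {σ = σ} {π y} K.refl p))
    ... | _ , inj₁ lt = contradiction (Γ.<-respʳ-≈ (val-cong (x−0*y≈x y y)) lt) (Γ.irrefl Γ.Eq.refl)
    ... | _ , inj₂ i = S.trans {σ} {π y} {𝟎} p (Equivalence.from π-0 (Equivalence.to (val-∞ y) i))

-- Best approximation

-- Zero and one are arguments so that the same vector can be formed both in a field and from terms
-- of the language.
basis : ∀ {a} {A : Set a} → A → A → ∀ {p} → Fin p → Fin p → A
basis 𝟘 𝟙 zero    zero    = 𝟙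
basis 𝟘 𝟙 zero    (suc j) = 𝟘
basis 𝟘 𝟙 (suc i) zero    = 𝟘
basis 𝟘 𝟙 (suc i) (suc j) = basis 𝟘 𝟙 i j

module _ {ℓ} (K : Field ℓ) where
  private module K = Field K

  -- The substitution of y + Σ cᵢ wᵢ for the first vector of a combination.
  shift : ∀ {p} (t : Fin (suc p) → K.Carrier) (c : Fin p → K.Carrier) → Fin p → K.Carrier
  shift t c i = t (suc i) K.+ t zero K.* c i

module CentreVectors {ℓ} (K : Field ℓ) (em : ExcludedMiddle ℓ) where
  private module K = Field K

  -- The value at 0 is arbitrary. It is there because `centre` is applied to all coefficient
  -- vectors, including those whose first entry vanishes.
  inv : K.Carrier → K.Carrier
  inv k with em {P = k K.≈ K.0#}
  ... | yes _ = K.0#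
  ... | no k≉0 = proj₁ (K.inverse k k≉0)

  inv-inverse : ∀ {k} → ¬ k K.≈ K.0# → k K.* inv k K.≈ K.1#
  inv-inverse {k} ¬k≈0 with em {P = k K.≈ K.0#}
  ... | yes k≈0 = contradiction k≈0 ¬k≈0
  ... | no k≉0 = proj₂ (K.inverse k k≉0)

  centre : ∀ {p} → (Fin (suc p) → K.Carrier) → Fin p → K.Carrier
  centre t i = K.- inv (t zero) K.* t (suc i)

  -- The zero vector makes the list nonempty, so that a best centre exists even if no combination
  -- involves x.
  centres : ∀ {p} → List (Fin (suc p) → K.Carrier) → List (Fin p → K.Carrier)
  centres ts = (λ _ → K.0#) ∷ map centre ts

module Combinations {ℓ} {K : Field ℓ} (𝒱 : ValuedVectorSpace K) where
  open ValuedVectorSpace 𝒱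
  open Skeletal 𝒱
  private
    module K = Field K
    module ≤ = TotalOrder Γ-totalOrder
    module VP = AbelianGroupProperties V.+ᴹ-abelianGroup
    module VC = CommutativeSemigroupProperties
                  (CommutativeMonoid.commutativeSemigroup V.+ᴹ-commutativeMonoid)
    module VR = SetoidReasoning V-setoid

  comb : ∀ {p} → (Fin p → K.Carrier) → (Fin p → Carrierᴹ) → Carrierᴹ
  comb {zero}  k w = 0ᴹ
  comb {suc p} k w = k zero *ₗ w zero +ᴹ comb (k ∘ suc) (w ∘ suc)

  comb-cong : ∀ {p} {k l : Fin p → K.Carrier} {w w′ : Fin p → Carrierᴹ} →
              (∀ i → k i K.≈ l i) → (∀ i → w i ≈ᴹ w′ i) → comb k w ≈ᴹ comb l w′
  comb-cong {zero}  p q = V.≈ᴹ-refl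
  comb-cong {suc _} p q = V.+ᴹ-cong (V.*ₗ-cong (p zero) (q zero)) (comb-cong (p ∘ suc) (q ∘ suc))

  comb-congˡ : ∀ {p} {k l : Fin p → K.Carrier} (w : Fin p → Carrierᴹ) →
               (∀ i → k i K.≈ l i) → comb k w ≈ᴹ comb l w
  comb-congˡ w p = comb-cong p (λ _ → V.≈ᴹ-refl)

  comb-0 : ∀ {p} (w : Fin p → Carrierᴹ) → comb (λ _ → K.0#) w ≈ᴹ 0ᴹ
  comb-0 {zero}  w = V.≈ᴹ-refl
  comb-0 {suc _} w = V.≈ᴹ-trans (V.+ᴹ-cong (V.*ₗ-zeroˡ _) (comb-0 (w ∘ suc))) (V.+ᴹ-identityˡ 0ᴹ)

  comb-+ : ∀ {p} (k l : Fin p → K.Carrier) (w : Fin p → Carrierᴹ) →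
           comb (λ i → k i K.+ l i) w ≈ᴹ comb k w +ᴹ comb l w
  comb-+ {zero}  k l w = V.≈ᴹ-sym (V.+ᴹ-identityˡ 0ᴹ)
  comb-+ {suc _} k l w = V.≈ᴹ-trans
    (V.+ᴹ-cong (V.*ₗ-distribʳ _ _ _) (comb-+ (k ∘ suc) (l ∘ suc) (w ∘ suc)))
    (VC.interchange _ _ _ _)

  comb-* : ∀ {p} a (k : Fin p → K.Carrier) (w : Fin p → Carrierᴹ) →
           comb (λ i → a K.* k i) w ≈ᴹ a *ₗ comb k w
  comb-* {zero}  a k w = V.≈ᴹ-sym (V.*ₗ-zeroʳ a)
  comb-* {suc _} a k w = V.≈ᴹ-trans
    (V.+ᴹ-cong (V.*ₗ-assoc _ _ _) (comb-* a (k ∘ suc) (w ∘ suc)))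
    (V.≈ᴹ-sym (V.*ₗ-distribˡ _ _ _))

  comb-basis : ∀ {p} (i : Fin p) (w : Fin p → Carrierᴹ) →
               comb (basis K.0# K.1# i) w ≈ᴹ w i
  comb-basis zero    w = V.≈ᴹ-trans (V.+ᴹ-cong (V.*ₗ-identityˡ _) (comb-0 (w ∘ suc))) (V.+ᴹ-identityʳ _)
  comb-basis (suc i) w = V.≈ᴹ-trans (V.+ᴹ-cong (V.*ₗ-zeroˡ _) (comb-basis i (w ∘ suc))) (V.+ᴹ-identityˡ _)

  -- Minus one enters as any `n` with n + 1 = 0, because over a variable field it is available only
  -- as the value of a variable.
  negate : ∀ {n} v → n K.+ K.1# K.≈ K.0# → n *ₗ v ≈ᴹ -ᴹ v
  negate {n} v e = VP.inverseˡ-unique (n *ₗ v) v (VR.begin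
    n *ₗ v +ᴹ v             VR.≈⟨ V.+ᴹ-congˡ (V.*ₗ-identityˡ v) ⟨
    n *ₗ v +ᴹ K.1# *ₗ v     VR.≈⟨ V.*ₗ-distribʳ v n K.1# ⟨
    (n K.+ K.1#) *ₗ v       VR.≈⟨ V.*ₗ-congʳ e ⟩
    K.0# *ₗ v               VR.≈⟨ V.*ₗ-zeroˡ v ⟩
    0ᴹ                      VR.∎)

  comb-− : ∀ {p n} (k l : Fin p → K.Carrier) (w : Fin p → Carrierᴹ) → n K.+ K.1# K.≈ K.0# →
           comb (λ i → k i K.+ n K.* l i) w ≈ᴹ comb k w − comb l w
  comb-− {n = n} k l w e = V.≈ᴹ-trans (comb-+ k (λ i → n K.* l i) w)
    (V.+ᴹ-congˡ (V.≈ᴹ-trans (comb-* n l w) (negate (comb l w) e)))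

  comb-shift : ∀ {p} (t : Fin (suc p) → K.Carrier) (c : Fin p → K.Carrier) {x y} (w : Fin p → Carrierᴹ) →
               x ≈ᴹ y +ᴹ comb c w →
               t zero *ₗ y +ᴹ comb (shift K t c) w ≈ᴹ comb t (x ◂ w)
  comb-shift t c {x} {y} w e = VR.begin
    k *ₗ y +ᴹ comb (shift K t c) w                VR.≈⟨ V.+ᴹ-congˡ (comb-+ _ _ w) ⟩
    k *ₗ y +ᴹ (u +ᴹ comb (λ i → k K.* c i) w)   VR.≈⟨ V.+ᴹ-congˡ (V.+ᴹ-congˡ (comb-* k c w)) ⟩
    k *ₗ y +ᴹ (u +ᴹ k *ₗ comb c w)              VR.≈⟨ V.+ᴹ-congˡ (V.+ᴹ-comm _ _) ⟩
    k *ₗ y +ᴹ (k *ₗ comb c w +ᴹ u)              VR.≈⟨ V.+ᴹ-assoc _ _ _ ⟨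
    (k *ₗ y +ᴹ k *ₗ comb c w) +ᴹ u              VR.≈⟨ V.+ᴹ-congʳ (V.*ₗ-distribˡ _ _ _) ⟨
    k *ₗ (y +ᴹ comb c w) +ᴹ u                   VR.≈⟨ V.+ᴹ-congʳ (V.*ₗ-congˡ e) ⟨
    k *ₗ x +ᴹ u                                 VR.∎
    where
    k = t zero
    u = comb (t ∘ suc) w

  -- Cosets of a span

  infix 4 _~[_]_
  record _~[_]_ {p} (x : Carrierᴹ) (w : Fin p → Carrierᴹ) (y : Carrierᴹ) : Set ℓ where
    constructor difference
    field
      coefficients  : Fin p → K.Carrier
      decomposition : x ≈ᴹ y +ᴹ comb coefficients w

  module _ {p} {w : Fin p → Carrierᴹ} where

    ≈⇒~ : ∀ {x y} → x ≈ᴹ y → x ~[ w ] y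
    ≈⇒~ e = difference (λ _ → K.0#)
      (V.≈ᴹ-trans e (V.≈ᴹ-sym (V.≈ᴹ-trans (V.+ᴹ-congˡ (comb-0 w)) (V.+ᴹ-identityʳ _))))

    ~-trans : ∀ {x y z} → x ~[ w ] y → y ~[ w ] z → x ~[ w ] z
    ~-trans {x} {y} {z} (difference c e) (difference d f) = difference (λ i → d i K.+ c i) (VR.begin
      x                                  VR.≈⟨ e ⟩
      y +ᴹ comb c w                      VR.≈⟨ V.+ᴹ-congʳ f ⟩
      z +ᴹ comb d w +ᴹ comb c w          VR.≈⟨ V.+ᴹ-assoc _ _ _ ⟩
      z +ᴹ (comb d w +ᴹ comb c w)        VR.≈⟨ V.+ᴹ-congˡ (comb-+ d c w) ⟨
      z +ᴹ comb (λ i → d i K.+ c i) w    VR.∎)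

    ~-sym : ∀ {x y} → x ~[ w ] y → y ~[ w ] x
    ~-sym {x} {y} (difference c e) = difference (λ i → n K.* c i) (V.≈ᴹ-sym (VR.begin
      x +ᴹ comb (λ i → n K.* c i) w    VR.≈⟨ V.+ᴹ-cong e neg-comb ⟩
      (y +ᴹ comb c w) − comb c w       VR.≈⟨ V.+ᴹ-assoc _ _ _ ⟩
      y +ᴹ (comb c w − comb c w)       VR.≈⟨ V.+ᴹ-congˡ (V.-ᴹ‿inverseʳ _) ⟩
      y +ᴹ 0ᴹ                          VR.≈⟨ V.+ᴹ-identityʳ y ⟩
      y                                VR.∎))
      where
      n = K.- K.1#
      neg-comb : comb (λ i → n K.* c i) w ≈ᴹ -ᴹ comb c w
      neg-comb = V.≈ᴹ-trans (comb-* n c w) (negate _ (K.-‿inverseˡ K.1#))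

    ~-+ : ∀ {x x′ y y′} → x ~[ w ] x′ → y ~[ w ] y′ → x +ᴹ y ~[ w ] x′ +ᴹ y′
    ~-+ (difference c e) (difference d f) = difference (λ i → c i K.+ d i) (V.≈ᴹ-trans (V.+ᴹ-cong e f)
      (V.≈ᴹ-trans (VC.interchange _ _ _ _) (V.+ᴹ-congˡ (V.≈ᴹ-sym (comb-+ c d w)))))

    ~-* : ∀ a {x x′} → x ~[ w ] x′ → a *ₗ x ~[ w ] a *ₗ x′
    ~-* a (difference c e) = difference (λ i → a K.* c i) (V.≈ᴹ-trans (V.*ₗ-congˡ e)
      (V.≈ᴹ-trans (V.*ₗ-distribˡ _ _ _) (V.+ᴹ-congˡ (V.≈ᴹ-sym (comb-* a c w)))))

  ~-suc : ∀ {p} {w : Fin (suc p) → Carrierᴹ} {x y} →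
          x ~[ w ] y ⇔ (∃[ k ] x ~[ w ∘ suc ] y +ᴹ k *ₗ w zero)
  ~-suc {w = w} = mk⇔
    (λ (difference c e) → c zero , difference (c ∘ suc) (V.≈ᴹ-trans e (V.≈ᴹ-sym (V.+ᴹ-assoc _ _ _))))
    (λ (k , difference c e) → difference (k ◂ c) (V.≈ᴹ-trans e (V.+ᴹ-assoc _ _ _)))

  module BestApproximation (em : ExcludedMiddle ℓ) where

    -- Values need not be well ordered, so the maximum is found by induction on the number of
    -- vectors. Let y₁ be best modulo `w ∘ suc`. If some y in the full coset is strictly better, let
    -- y₂ be best for y modulo `w ∘ suc`. An improvement on y₂ would give a vector v with val v ≥
    -- val y₂ in the small coset of y₁, against val v ≤ val y₁ < val y ≤ val y₂.
    best : ∀ {p} (w : Fin p → Carrierᴹ) x →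
           ∃[ y ] x ~[ w ] y × (∀ z → z ~[ w ] y → val z ≤ val y)
    best {zero} w x = x , ≈⇒~ {w = w} V.≈ᴹ-refl , λ z (difference _ e) →
      ≈⇒≤ (val-cong (V.≈ᴹ-trans e (V.+ᴹ-identityʳ x)))
    best {suc p} w x with best (w ∘ suc) x
    ... | y₁ , x~y₁ , y₁-max with em {P = ∃[ y ] y ~[ w ] x × val y₁ < val y}
    ...   | no ∄y = y₁ , x~′y₁ , λ z z~y₁ →
      ≯⇒≤ λ lt → ∄y (z , ~-trans z~y₁ (~-sym x~′y₁) , lt)
      where
      x~′y₁ : x ~[ w ] y₁
      x~′y₁ = Equivalence.from ~-suc (K.0# , ~-trans x~y₁ (≈⇒~ (V.≈ᴹ-sym
        (V.≈ᴹ-trans (V.+ᴹ-congˡ (V.*ₗ-zeroˡ _)) (V.+ᴹ-identityʳ _)))))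
    ...   | yes (y , y~x , lt) with best (w ∘ suc) y
    ...     | y₂ , y~y₂ , y₂-max = y₂ , x~y₂ , λ z z~y₂ → ≯⇒≤ (¬better z z~y₂)
      where
      y~′y₂ : y ~[ w ] y₂
      y~′y₂ = Equivalence.from ~-suc (K.0# , ~-trans y~y₂ (≈⇒~ (V.≈ᴹ-sym
        (V.≈ᴹ-trans (V.+ᴹ-congˡ (V.*ₗ-zeroˡ _)) (V.+ᴹ-identityʳ _)))))
      x~y₂ : x ~[ w ] y₂
      x~y₂ = ~-trans (~-sym y~x) y~′y₂

      -- If z improves on y₂, then y₂ − z is a nonzero multiple of w zero modulo the other
      -- vectors, so a multiple of it corrects y₂ to an approximation of x by those only.
      ¬better : ∀ z → z ~[ w ] y₂ → ¬ val y₂ < val z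
      ¬better z z~y₂ y₂<z with Equivalence.to ~-suc (~-sym z~y₂) | Equivalence.to ~-suc x~y₂
      ... | l , y₂~z+lw | k , x~y₂+kw with em {P = l K.≈ K.0#}
      ...   | yes l≈0 = ≤⇒≯ (y₂-max z (~-sym (~-trans y₂~z+lw (≈⇒~ (V.≈ᴹ-trans
                          (V.+ᴹ-congˡ (V.≈ᴹ-trans (V.*ₗ-congʳ l≈0) (V.*ₗ-zeroˡ _)))
                          (V.+ᴹ-identityʳ z)))))) y₂<z
      ...   | no l≉0 with K.inverse l l≉0
      ...     | l⁻¹ , ll⁻¹≈1 = ≤⇒≯ (y₁-max v v~y₁)
                  (<-≤-trans lt (≤.trans (y₂-max y y~y₂)
                    (val-+-≤ y₂ _ ≤.refl (≤.trans
                      (val-+-≤ y₂ (-ᴹ z) ≤.refl (≤.trans (inj₁ y₂<z) (Skeleton.val-neg-≤ 𝒱 z)))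
                      (Skeleton.val-scalar-≤ 𝒱 (k K.* l⁻¹) (y₂ − z))))))
        where
        w₀ = w zero
        -- Modulo the later vectors y₂ - z is l w₀, and x - y₂ is k w₀. The factor k l⁻¹ turns the
        -- first into the second, so v lies in the small coset of x.
        v = y₂ +ᴹ (k K.* l⁻¹) *ₗ (y₂ − z)
        y₂−z~lw : y₂ − z ~[ w ∘ suc ] l *ₗ w₀
        y₂−z~lw = ~-trans (~-+ y₂~z+lw (≈⇒~ V.≈ᴹ-refl)) (≈⇒~ (VP.xyx⁻¹≈y z (l *ₗ w₀)))
        coefficient : (k K.* l⁻¹) *ₗ (l *ₗ w₀) ≈ᴹ k *ₗ w₀
        coefficient = V.≈ᴹ-trans (V.≈ᴹ-sym (V.*ₗ-assoc _ _ _)) (V.*ₗ-congʳ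
          (K.trans (K.*-assoc _ _ _) (K.trans (K.*-congˡ (K.trans (K.*-comm _ _) ll⁻¹≈1)) (K.*-identityʳ k))))
        v~y₁ : v ~[ w ∘ suc ] y₁
        v~y₁ = ~-trans (~-+ (≈⇒~ V.≈ᴹ-refl) (~-trans (~-* _ y₂−z~lw) (≈⇒~ coefficient)))
                       (~-trans (~-sym x~y₂+kw) x~y₁)

    best-in-span : ∀ {p} (w : Fin p → Carrierᴹ) x →
                   ∃[ y ] x ~[ w ] y × (∀ c → y ⟂ comb c w)
    best-in-span w x with best w x
    ... | y , x~y , y-max = y , x~y , λ c → y-max _ (difference c V.≈ᴹ-refl)

  -- The best of finitely many centres

  module Centres (em : ExcludedMiddle ℓ) where
    open CentreVectors K em

    comb-centre : ∀ {p} (t : Fin (suc p) → K.Carrier) x (w : Fin p → Carrierᴹ) → ¬ t zero K.≈ K.0# →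
                  comb t (x ◂ w) ≈ᴹ t zero *ₗ (x − comb (centre t) w)
    comb-centre t x w k≉0 = VR.begin
      k *ₗ x +ᴹ u                              VR.≈⟨ V.+ᴹ-congˡ (V.*ₗ-identityˡ u) ⟨
      k *ₗ x +ᴹ K.1# *ₗ u                      VR.≈⟨ V.+ᴹ-congˡ (V.*ₗ-congʳ (inv-inverse k≉0)) ⟨
      k *ₗ x +ᴹ (k K.* inv k) *ₗ u             VR.≈⟨ V.+ᴹ-congˡ (V.*ₗ-assoc k (inv k) u) ⟩
      k *ₗ x +ᴹ k *ₗ (inv k *ₗ u)              VR.≈⟨ V.*ₗ-distribˡ k x _ ⟨
      k *ₗ (x +ᴹ inv k *ₗ u)                   VR.≈⟨ V.*ₗ-congˡ (V.+ᴹ-congˡ neg-centre) ⟩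
      k *ₗ (x − comb (centre t) w)             VR.∎
      where
      k = t zero
      u = comb (t ∘ suc) w
      neg-centre : inv k *ₗ u ≈ᴹ -ᴹ comb (centre t) w
      neg-centre = VP.inverseˡ-unique _ _ (VR.begin
        inv k *ₗ u +ᴹ comb (centre t) w        VR.≈⟨ V.+ᴹ-congˡ (comb-* (K.- inv k) (t ∘ suc) w) ⟩
        inv k *ₗ u +ᴹ (K.- inv k) *ₗ u         VR.≈⟨ V.*ₗ-distribʳ u _ _ ⟨
        (inv k K.+ (K.- inv k)) *ₗ u           VR.≈⟨ V.*ₗ-congʳ (K.-‿inverseʳ (inv k)) ⟩
        K.0# *ₗ u                              VR.≈⟨ V.*ₗ-zeroˡ u ⟩
        0ᴹ                                     VR.∎)

    -- The centre a is chosen so that y = x - Σ aᵢ wᵢ has greatest value. For t in `ts` with t₀ ≠ 0,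
    -- the vector t₀ y + Σ (shift t a)ᵢ wᵢ equals t₀ x + Σ tᵢ wᵢ, which is t₀ times the difference
    -- of x and the centre of t. Its value is at most val y by the choice of a.
    best-centre : ∀ {p} (ts : List (Fin (suc p) → K.Carrier)) x (w : Fin p → Carrierᴹ) →
      ∃[ a ] a ∈ centres ts × ∃[ y ] x ≈ᴹ y +ᴹ comb a w ×
             (∀ t → t ∈ ts → t zero *ₗ y ⟂ comb (shift K t a) w)
    best-centre {p} ts x w = a , a∈ , y , x≈ , orthogonal
      where
      open Extrema Γ-totalOrder
      f : (Fin p → K.Carrier) → Value
      f c = val (x − comb c w)
      a = argmax f (λ _ → K.0#) (map centre ts)
      y = x − comb a w

      a∈ : a ∈ centres ts
      a∈ with argmax-sel f (λ _ → K.0#) (map centre ts)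
      ... | inj₁ e = here e
      ... | inj₂ m = there m

      x≈ : x ≈ᴹ y +ᴹ comb a w
      x≈ = V.≈ᴹ-sym (V.≈ᴹ-trans (V.+ᴹ-assoc _ _ _)
        (V.≈ᴹ-trans (V.+ᴹ-congˡ (V.-ᴹ‿inverseˡ _)) (V.+ᴹ-identityʳ x)))

      orthogonal : ∀ t → t ∈ ts → t zero *ₗ y ⟂ comb (shift K t a) w
      orthogonal t t∈ts with em {P = t zero K.≈ K.0#}
      ... | yes k≈0 = 0⟂ (V.≈ᴹ-trans (V.*ₗ-congʳ k≈0) (V.*ₗ-zeroˡ y))
      ... | no k≉0 = ≤.trans
        (≈⇒≤ (Γ.Eq.trans (val-cong (V.≈ᴹ-trans (comb-shift t a w x≈) (comb-centre t x w k≉0)))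
                         (val-scalar _ _ k≉0)))
        (≤.trans (All.lookup (f[xs]≤f[argmax] {f = f} (λ _ → K.0#) (map centre ts)) (∈-map⁺ centre t∈ts))
                 (≈⇒≤ (Γ.Eq.sym (val-scalar _ y k≉0))))

-- Definable expansions

∀-cong-⇔ : ∀ {ℓ} {A : Set ℓ} {B C : A → Set ℓ} →
           (∀ x → B x ⇔ C x) → (∀ x → B x) ⇔ (∀ x → C x)
∀-cong-⇔ h = mk⇔ (λ f x → Equivalence.to (h x) (f x)) (λ f x → Equivalence.from (h x) (f x))

cong₂-⇔ : ∀ {a ℓ} {A : Set a} (_R_ : A → A → Set ℓ) {x x′ y y′} →
          x ≡ x′ → y ≡ y′ → (x R y) ⇔ (x′ R y′)
cong₂-⇔ _R_ refl refl = ⇔-id _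

infix 4 _⊑_
_⊑_ : ∀ {I : Set} → List I → List I → Set
Θ ⊑ Θ′ = ∀ {s} → s ∈ Θ → s ∈ Θ′

Extends : ∀ {I : Set} {a} {A : I → Set a} {Θ Θ′ : List I} → Θ ⊑ Θ′ → All A Θ → All A Θ′ → Set a
Extends {Θ = Θ} r θ θ′ = ∀ {s} (i : s ∈ Θ) → All.lookup θ′ (r i) ≡ All.lookup θ i

module Connectives {ℓf} (L : Signature ℓf) where
  open Signature L

  neg : ∀ {Δ} → Formula L Δ → Formula L Δ
  neg φ = φ ⇒ falsum

  infixr 6 _∧_
  _∧_ : ∀ {Δ} → Formula L Δ → Formula L Δ → Formula L Δ
  φ ∧ ψ = neg (φ ⇒ neg ψ)

  ite : ∀ {Δ} → Formula L Δ → Formula L Δ → Formula L Δ → Formula L Δ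
  ite α φ ψ = (α ⇒ φ) ∧ (neg α ⇒ ψ)

  ⋀ : ∀ {Δ a} {A : Set a} → List A → (A → Formula L Δ) → Formula L Δ
  ⋀ []       f = falsum ⇒ falsum
  ⋀ (x ∷ xs) f = f x ∧ ⋀ xs f

  -- A definable element is encoded by the formulas "k holds of it", so that it can
  -- be given by cases without being the value of a term.
  Definable : List Sort → Sort → Set ℓf
  Definable Δ s = (Term L Δ s → Formula L Δ) → Formula L Δ

module Truth {ℓf ℓ} {L : Signature ℓf} (em : ExcludedMiddle ℓ) (M : Structure L ℓ) where
  open Signature L
  open Structure M
  open Semantics M
  open Connectives L

  Sat-neg : ∀ {Δ} (φ : Formula L Δ) {ρ} → Sat (neg φ) ρ ⇔ (¬ Sat φ ρ)
  Sat-neg φ = mk⇔ (λ f x → Empty.⊥-elim (f x)) (λ f x → contradiction x f)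

  Sat-∧ : ∀ {Δ} (φ ψ : Formula L Δ) {ρ} → Sat (φ ∧ ψ) ρ ⇔ (Sat φ ρ × Sat ψ ρ)
  Sat-∧ φ ψ {ρ} = mk⇔ to (λ (x , y) f → f x y)
    where
    to : Sat (φ ∧ ψ) ρ → Sat φ ρ × Sat ψ ρ
    to h with em {P = Sat φ ρ × Sat ψ ρ}
    ... | yes p = p
    ... | no ¬p = Empty.⊥-elim (h λ x y → contradiction (x , y) ¬p)

  Sat-ite : ∀ {Δ} (α φ ψ : Formula L Δ) {ρ} {P : Set ℓ} →
            (Sat α ρ → Sat φ ρ ⇔ P) → (¬ Sat α ρ → Sat ψ ρ ⇔ P) → Sat (ite α φ ψ) ρ ⇔ P
  Sat-ite α φ ψ {ρ} {P} f g = mk⇔ to from ⇔-∘ Sat-∧ (α ⇒ φ) (neg α ⇒ ψ)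
    where
    to : Sat (α ⇒ φ) ρ × Sat (neg α ⇒ ψ) ρ → P
    to (p , q) with em {P = Sat α ρ}
    ... | yes a = Equivalence.to (f a) (p a)
    ... | no ¬a = Equivalence.to (g ¬a) (q (Equivalence.from (Sat-neg α) ¬a))
    from : P → Sat (α ⇒ φ) ρ × Sat (neg α ⇒ ψ) ρ
    from x = (λ a → Equivalence.from (f a) x) ,
             (λ ¬a → Equivalence.from (g (Equivalence.to (Sat-neg α) ¬a)) x)

  Sat-⋀ : ∀ {Δ a} {A : Set a} (xs : List A) (f : A → Formula L Δ) {ρ} →
          Sat (⋀ xs f) ρ ⇔ (∀ {x} → x ∈ xs → Sat (f x) ρ)
  Sat-⋀ []       f = mk⇔ (λ _ ()) (λ _ → id)
  Sat-⋀ (x ∷ xs) f {ρ} = mk⇔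
    (λ (p , q) → λ { (here refl) → p ; (there i) → Equivalence.to (Sat-⋀ xs f) q i })
    (λ h → h (here refl) , Equivalence.from (Sat-⋀ xs f) (λ i → h (there i)))
    ⇔-∘ Sat-∧ (f x) (⋀ xs f)

  -- Which term reaches `k` depends on the model and the assignment, so no single term can be named.
  -- Correctness is therefore stated through all continuations, and definable elements are then
  -- combined by nesting them.
  Represents : ∀ {Δ s} → All ∣_∣ Δ → Definable Δ s → (Term L Δ s → Set ℓ) → Set (ℓf ⊔ Level.suc ℓ)
  Represents ρ g Q = ∀ k {P : Set ℓ} → (∀ t → Q t → Sat (k t) ρ ⇔ P) → Sat (g k) ρ ⇔ P

-- Sums, the image of π and orthogonality as skeletal formulas

module SkeletalFormulas {ℓf} (L : Signature ℓf) (S : Signature.Sort L)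
  (_≺_ : ∀ {Θ} → Term L Θ S → Term L Θ S → Formula L Θ)
  (_⊕_ : ∀ {Θ} → Term L Θ S → Term L Θ S → Term L Θ S)
  (𝟎′ : ∀ {Θ} → Term L Θ S)
  (null : ∀ {Θ} → Term L Θ S → Term L Θ S)
  where
  open Connectives L

  -- The class of u + w for orthogonal u and w: at distinct levels the smaller one dominates, and
  -- `+•` would wrongly give 𝟎.
  sum : ∀ {Θ} → Definable Θ S → Definable Θ S → Definable Θ S
  sum g h k = g λ σ → h λ τ → ite (τ ≺ σ) (k τ) (ite (σ ≺ τ) (k σ) (k (σ ⊕ τ)))

  -- By `π-image`, only the zero classes of level below ∞ have to be excluded.
  inImage : ∀ {Θ} → Term L Θ S → Formula L Θ
  inImage σ = equal σ (null σ) ⇒ equal σ 𝟎′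

  orthogonal : ∀ {Θ} → Definable Θ S → Definable Θ S → Formula L Θ
  orthogonal g h = g λ σ → h λ τ → equal (τ ⊕ σ) (null σ) ⇒ equal σ 𝟎′

  module Correctness {ℓ} (em : ExcludedMiddle ℓ) {K : Field ℓ} (𝒱 : ValuedVectorSpace K)
    (M : Structure L ℓ)
    (⟦_⟧ : ∀ {Θ} → Term L Θ S → All (Structure.∣_∣ M) Θ → Skeleton.Rep 𝒱)
    (Sat-≺ : ∀ {Θ} (σ τ : Term L Θ S) {θ} → Semantics.Sat M (σ ≺ τ) θ ⇔
             ValuedVectorSpace._<_ 𝒱 (Skeleton.valₛ 𝒱 (⟦ σ ⟧ θ)) (Skeleton.valₛ 𝒱 (⟦ τ ⟧ θ)))
    (⟦⊕⟧ : ∀ {Θ} (σ τ : Term L Θ S) {θ} → ⟦ σ ⊕ τ ⟧ θ ≡ Skeleton._+•_ 𝒱 (⟦ σ ⟧ θ) (⟦ τ ⟧ θ))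
    (Sat-zero : ∀ {Θ} (σ : Term L Θ S) {θ} →
                Semantics.Sat M (equal σ 𝟎′) θ ⇔ Skeleton._≃_ 𝒱 (⟦ σ ⟧ θ) (Skeleton.𝟎 𝒱))
    (Sat-null : ∀ {Θ} (σ : Term L Θ S) {θ} → Semantics.Sat M (equal σ (null σ)) θ ⇔
                Skeleton._≃_ 𝒱 (⟦ σ ⟧ θ) (Skeleton._*•_ 𝒱 (Field.0# K) (⟦ σ ⟧ θ)))
    (Sat-⊕-null : ∀ {Θ} (σ τ : Term L Θ S) {θ} → Semantics.Sat M (equal (σ ⊕ τ) (null τ)) θ ⇔
                  Skeleton._≃_ 𝒱 (Skeleton._+•_ 𝒱 (⟦ σ ⟧ θ) (⟦ τ ⟧ θ))
                                 (Skeleton._*•_ 𝒱 (Field.0# K) (⟦ τ ⟧ θ)))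
    where
    open Semantics M
    open Truth em M
    open ValuedVectorSpace 𝒱
    open Skeleton 𝒱 hiding (S)
    open Skeletal 𝒱
    private
      module K = Field K
      module ≃ = Setoid (Skeleton.S 𝒱)

    Denotes : ∀ {Θ} → All (Structure.∣_∣ M) Θ → Definable Θ S → Carrierᴹ → Set (ℓf ⊔ Level.suc ℓ)
    Denotes θ g u = Represents θ g (λ t → ⟦ t ⟧ θ ≃ π u)

    Denotes-cong : ∀ {Θ} {θ : All (Structure.∣_∣ M) Θ} {g u w} → u ≈ᴹ w → Denotes θ g u → Denotes θ g w
    Denotes-cong {θ = θ} {u = u} {w} e d k H = d k λ t p →
      H t (≃.trans {⟦ t ⟧ θ} {π u} {π w} p (π-cong e))

    -- This carries equations between vectors over to the skeleton: they become the vanishing of the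
    -- class of a difference.
    Sat-zero-⇔ : ∀ {Θ} (σ : Term L Θ S) {θ u} → ⟦ σ ⟧ θ ≃ π u → Sat (equal σ 𝟎′) θ ⇔ u ≈ᴹ 0ᴹ
    Sat-zero-⇔ σ {θ} {u} p = π-0 ⇔-∘ (mk⇔
      (≃.trans {π u} {⟦ σ ⟧ θ} {𝟎} (≃.sym {⟦ σ ⟧ θ} {π u} p))
      (≃.trans {⟦ σ ⟧ θ} {π u} {𝟎} p) ⇔-∘ Sat-zero σ)

    sum-denotes : ∀ {Θ} {θ : All (Structure.∣_∣ M) Θ} {g h u w} →
                  Denotes θ g u → Denotes θ h w → u ⟂ w → Denotes θ (sum g h) (u +ᴹ w)
    sum-denotes {θ = θ} {u = u} {w} dg dh u⟂w k H =
      dg _ λ σ p → dh _ λ τ q → Sat-ite (τ ≺ σ) (k τ) (ite (σ ≺ τ) (k σ) (k (σ ⊕ τ)))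
        (λ lt → H τ (π-+-minʳ {⟦ σ ⟧ θ} {⟦ τ ⟧ θ} p q (Equivalence.to (Sat-≺ τ σ) lt)))
        (λ ¬lt → Sat-ite (σ ≺ τ) (k σ) (k (σ ⊕ τ))
          (λ lt → H σ (π-+-minˡ {⟦ σ ⟧ θ} {⟦ τ ⟧ θ} p q (Equivalence.to (Sat-≺ σ τ) lt)))
          (λ ¬lt′ → H (σ ⊕ τ) (subst (_≃ π (u +ᴹ w)) (sym (⟦⊕⟧ σ τ))
            (π-+ {⟦ σ ⟧ θ} {⟦ τ ⟧ θ} p q u⟂w (≮≯⇒≈
              (¬lt′ ∘ Equivalence.from (Sat-≺ σ τ)) (¬lt ∘ Equivalence.from (Sat-≺ τ σ)))))))
      where
      ≮≯⇒≈ : ∀ {α β} → ¬ α < β → ¬ β < α → α ≈Γ β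
      ≮≯⇒≈ {α} {β} ¬p ¬q with Γ.compare α β
      ... | tri< p _ _ = contradiction p ¬p
      ... | tri≈ _ e _ = e
      ... | tri> _ _ q = contradiction q ¬q

    Sat-inImage : ∀ {Θ} (σ : Term L Θ S) {θ} → Sat (inImage σ) θ ⇔ (∃[ y ] ⟦ σ ⟧ θ ≃ π y)
    Sat-inImage σ {θ} = π-image {⟦ σ ⟧ θ} ⇔-∘ →-cong-⇔ (Sat-null σ) (Sat-zero σ)

    Sat-orthogonal : ∀ {Θ} {θ : All (Structure.∣_∣ M) Θ} {g h y w} →
                     Denotes θ g y → Denotes θ h w → Sat (orthogonal g h) θ ⇔ y ⟂ w
    Sat-orthogonal {θ = θ} dg dh = dg _ λ σ p → dh _ λ τ q →
      ⟂-skeletal {⟦ σ ⟧ θ} {⟦ τ ⟧ θ} p q ⇔-∘ →-cong-⇔ (Sat-⊕-null τ σ) (Sat-zero σ)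

-- Fixed base field

module FixedTranslation {ℓ} (em : ExcludedMiddle ℓ) (K : Field ℓ) where
  open FixedField K
  open Connectives SkL
  open CentreVectors K em
  private module K = Field K

  _≺_ : ∀ {Θ} → Term SkL Θ S → Term SkL Θ S → Formula SkL Θ
  σ ≺ τ = rel less (app valₛᶠ (σ ∷ []) ∷ app valₛᶠ (τ ∷ []) ∷ [])

  _⊕_ : ∀ {Θ} → Term SkL Θ S → Term SkL Θ S → Term SkL Θ S
  σ ⊕ τ = app +•ᶠ (σ ∷ τ ∷ [])

  𝟎′ : ∀ {Θ} → Term SkL Θ S
  𝟎′ = app 𝟎ᶠ []

  null : ∀ {Θ} → Term SkL Θ S → Term SkL Θ S
  null σ = app (scal• K.0#) (σ ∷ [])

  open SkeletalFormulas SkL S _≺_ _⊕_ 𝟎′ null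

  -- Zero needs its own case: `scal• K.0#` keeps the level of σ, whereas π (0 y) is 𝟎. The scalar
  -- belongs to the language, so the case is decided outside the formula.
  scale : ∀ {Θ} → K.Carrier → Term SkL Θ S → Definable Θ S
  scale k σ f with em {P = k K.≈ K.0#}
  ... | yes _ = f 𝟎′
  ... | no  _ = f (app (scal• k) (σ ∷ []))

  ⌊_⌋ : SkSort → Sort
  ⌊ Γ ⌋ = Γ
  ⌊ S ⌋ = S

  -- Vector variables disappear from the translated context. Only their positions among w₁, ..., w_p
  -- are kept.
  Index : List Sort → ℕ → Set
  Index Δ p = V ∈ Δ → Fin p

  Names : List Sort → List SkSort → Set
  Names Δ Θ = ∀ s → ⌊ s ⌋ ∈ Δ → s ∈ Θ

  addVector : ∀ {Δ p} → Index Δ p → Index (V ∷ Δ) (suc p)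
  addVector ι (here refl) = zero
  addVector ι (there i)   = suc (ι i)

  skipIndex : ∀ s {Δ p} → Index Δ p → Index (⌊ s ⌋ ∷ Δ) p
  skipIndex Γ ι (there i) = ι i
  skipIndex S ι (there i) = ι i

  skipNames : ∀ {Δ Θ} → Names Δ Θ → Names (V ∷ Δ) Θ
  skipNames e Γ (there i) = e Γ i
  skipNames e S (there i) = e S i

  addName : ∀ s {Δ Θ} → Names Δ Θ → Names (⌊ s ⌋ ∷ Δ) (s ∷ Θ)
  addName Γ e Γ (here refl) = here refl
  addName Γ e Γ (there i)   = there (e Γ i)
  addName Γ e S (there i)   = there (e S i)
  addName S e Γ (there i)   = there (e Γ i)
  addName S e S (here refl) = here refl
  addName S e S (there i)   = there (e S i)

  Coefficients : ℕ → Sort → Set ℓ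
  Coefficients p V = Fin p → K.Carrier
  Coefficients p _ = ⊤

  variableCoefficients : ∀ {Δ p} s → Index Δ p → s ∈ Δ → Coefficients p s
  variableCoefficients V ι i = basis K.0# K.1# (ι i)
  variableCoefficients Γ ι i = _
  variableCoefficients S ι i = _

  -- No symbol with values in V takes arguments of another sort, so every vector term is a fixed
  -- linear combination of vector variables.
  coefficients : ∀ {Δ p s} → Index Δ p → Term L Δ s → Coefficients p s
  coefficients ι (var {s} i) = variableCoefficients s ι i
  coefficients ι (app +ⱽ (t ∷ u ∷ [])) i = coefficients ι t i K.+ coefficients ι u i
  coefficients ι (app 0ⱽ []) i = K.0#
  coefficients ι (app (scal k) (t ∷ [])) i = k K.* coefficients ι t i
  coefficients ι (app ∞ᶠ ts) = _
  coefficients ι (app valᶠ ts) = _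
  coefficients ι (app +•ᶠ ts) = _
  coefficients ι (app 𝟎ᶠ ts) = _
  coefficients ι (app (scal• x) ts) = _
  coefficients ι (app valₛᶠ ts) = _
  coefficients ι (app πᶠ ts) = _

  difference-coefficients : ∀ {Δ p} → Index Δ p → Term L Δ V → Term L Δ V → Fin p → K.Carrier
  difference-coefficients ι t u i = coefficients ι t i K.+ (K.- K.1#) K.* coefficients ι u i

  -- The coefficient vectors c for which a translation refers to π (Σ cᵢ wᵢ).

  usedByTerm : ∀ {Δ p s} → Index Δ p → Term L Δ s → List (Fin p → K.Carrier)
  usedByTerm ι (app valᶠ (t ∷ []))      = coefficients ι t ∷ []
  usedByTerm ι (app πᶠ (t ∷ []))        = coefficients ι t ∷ []
  usedByTerm ι (app +•ᶠ (t ∷ u ∷ []))   = usedByTerm ι t ++ usedByTerm ι u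
  usedByTerm ι (app (scal• k) (t ∷ [])) = usedByTerm ι t
  usedByTerm ι (app valₛᶠ (t ∷ []))     = usedByTerm ι t
  usedByTerm ι _                        = []

  used : ∀ {Δ p} → Index Δ p → Formula L Δ → List (Fin p → K.Carrier)
  used ι falsum               = []
  used ι (equal {V} t u)      = difference-coefficients ι t u ∷ []
  used ι (equal {Γ} t u)      = usedByTerm ι t ++ usedByTerm ι u
  used ι (equal {S} t u)      = usedByTerm ι t ++ usedByTerm ι u
  used ι (rel less (t ∷ u ∷ [])) = usedByTerm ι t ++ usedByTerm ι u
  used ι (φ ⇒ ψ)              = used ι φ ++ used ι ψ
  -- For each centre a, the translated body and the orthogonality conditions refer to t at (x, w)
  -- through `shift K t a` at w, so all these shifts are needed one quantifier further out.
  used ι (all V φ)            =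
    cartesianProductWith (shift K) (used (addVector ι) φ) (centres (used (addVector ι) φ))
  used ι (all Γ φ)            = used (skipIndex Γ ι) φ
  used ι (all S φ)            = used (skipIndex S ι) φ

  -- An oracle sends c to π (Σ cᵢ wᵢ), in every extension of the context.
  Oracle : ℕ → List SkSort → Set ℓ
  Oracle p Θ = ∀ {Θ′} → Θ ⊑ Θ′ → (Fin p → K.Carrier) → Definable Θ′ S

  -- For x = y + Σ aᵢ wᵢ, with π y as the newest variable, the combination t of (x, w) is t₀ y plus
  -- the combination `shift K t a` of w. The answer is right where these two summands are
  -- orthogonal.
  extendOracle : ∀ {p Θ} → (Fin p → K.Carrier) → Oracle p Θ → Oracle (suc p) (S ∷ Θ)
  extendOracle a F r t = sum (scale (t zero) (var (r (here refl)))) (F (r ∘ there) (shift K t a))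

  admissible : ∀ {p Θ} → (Fin p → K.Carrier) → Oracle p Θ → List (Fin (suc p) → K.Carrier) →
               Formula SkL (S ∷ Θ)
  admissible a F ts = inImage (var (here refl)) ∧
    ⋀ ts (λ t → orthogonal (scale (t zero) (var (here refl))) (F there (shift K t a)))

  TranslatedTerm : List SkSort → Sort → Set ℓ
  TranslatedTerm Θ V = ⊤
  TranslatedTerm Θ Γ = Definable Θ Γ
  TranslatedTerm Θ S = Definable Θ S

  translateVariable : ∀ {Δ Θ} s → Names Δ Θ → s ∈ Δ → TranslatedTerm Θ s
  translateVariable V e i = _
  translateVariable Γ e i k = k (var (e Γ i))
  translateVariable S e i k = k (var (e S i))

  translateTerm : ∀ {Δ p Θ s} → Index Δ p → Names Δ Θ → ((Fin p → K.Carrier) → Definable Θ S) →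
                  Term L Δ s → TranslatedTerm Θ s
  translateTerm ι e F (var {s} i) = translateVariable s e i
  translateTerm ι e F (app +ⱽ ts) = _
  translateTerm ι e F (app 0ⱽ ts) = _
  translateTerm ι e F (app (scal _) ts) = _
  translateTerm ι e F (app ∞ᶠ []) k = k (app valₛᶠ (𝟎′ ∷ []))
  translateTerm ι e F (app valᶠ (t ∷ [])) k = F (coefficients ι t) λ σ → k (app valₛᶠ (σ ∷ []))
  translateTerm ι e F (app +•ᶠ (t ∷ u ∷ [])) k =
    translateTerm ι e F t λ σ → translateTerm ι e F u λ τ → k (σ ⊕ τ)
  translateTerm ι e F (app 𝟎ᶠ []) k = k 𝟎′
  translateTerm ι e F (app (scal• a) (t ∷ [])) k =
    translateTerm ι e F t λ σ → k (app (scal• a) (σ ∷ []))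
  translateTerm ι e F (app valₛᶠ (t ∷ [])) k = translateTerm ι e F t λ σ → k (app valₛᶠ (σ ∷ []))
  translateTerm ι e F (app πᶠ (t ∷ [])) k = F (coefficients ι t) k

  translate : ∀ {Δ p Θ} → Index Δ p → Names Δ Θ → Oracle p Θ → Formula L Δ → Formula SkL Θ
  translate ι e F falsum = falsum
  translate ι e F (equal {V} t u) = F id (difference-coefficients ι t u) λ σ → equal σ 𝟎′
  translate ι e F (equal {Γ} t u) =
    translateTerm ι e (F id) t λ α → translateTerm ι e (F id) u λ β → equal α β
  translate ι e F (equal {S} t u) =
    translateTerm ι e (F id) t λ σ → translateTerm ι e (F id) u λ τ → equal σ τ
  translate ι e F (rel less (t ∷ u ∷ [])) =
    translateTerm ι e (F id) t λ α → translateTerm ι e (F id) u λ β → rel less (α ∷ β ∷ [])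
  translate ι e F (φ ⇒ ψ) = translate ι e F φ ⇒ translate ι e F ψ
  -- Every x has a centre a and an admissible class π y with x = y + Σ aᵢ wᵢ, and every centre with
  -- an admissible class arises from some x. Hence the quantifier over x becomes a conjunction over
  -- centres of quantifiers over classes.
  translate ι e F (all V φ) = ⋀ (centres ts) λ a → all S
    (admissible a F ts ⇒
     translate (addVector ι) (λ s i → there (skipNames e s i)) (extendOracle a F) φ)
    where ts = used (addVector ι) φ
  translate ι e F (all Γ φ) = all Γ (translate (skipIndex Γ ι) (addName Γ e) (λ r → F (r ∘ there)) φ)
  translate ι e F (all S φ) = all S (translate (skipIndex S ι) (addName S e) (λ r → F (r ∘ there)) φ)

  -- Correctness of the translation over a fixed field

  module Translated (𝒱 : ValuedVectorSpace K) where
    open ValuedVectorSpace 𝒱 hiding (module V; module Γ)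
    open Skeleton 𝒱 hiding (S)
    open Skeletal 𝒱
    open Combinations 𝒱
    open Centres em
    private
      module V′ = ValuedVectorSpace.V 𝒱
      module Γ′ = ValuedVectorSpace.Γ 𝒱
      module VP = AbelianGroupProperties V′.+ᴹ-abelianGroup
      module ≃ = Setoid (Skeleton.S 𝒱)
      M = structure 𝒱
      N = skeleton 𝒱
      module M = Semantics M
      module N = Semantics N
      module MS = Structure M
      module NS = Structure N
    open Truth em N
    open Correctness em 𝒱 N N.eval (λ σ τ → ⇔-id _) (λ σ τ → refl)
      (λ σ → ⇔-id _) (λ σ → ⇔-id _) (λ σ τ → ⇔-id _)

    -- The identity, written by cases because the two carriers agree only once the sort is known.
    down : ∀ s → MS.∣ ⌊ s ⌋ ∣ → NS.∣ s ∣
    down Γ x = x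
    down S x = x

    scale-denotes : ∀ {Θ} {θ : All NS.∣_∣ Θ} k σ {y} → N.eval σ θ ≃ π y → Denotes θ (scale k σ) (k *ₗ y)
    scale-denotes {θ = θ} k σ {y} p f H with em {P = k K.≈ K.0#}
    ... | yes k≈0 = H 𝟎′ (≃.sym {π (k *ₗ y)} {𝟎}
            (Equivalence.from π-0 (V′.≈ᴹ-trans (V′.*ₗ-congʳ k≈0) (V′.*ₗ-zeroˡ y))))
    ... | no k≉0 = H _ (π-*ₗ {σ = N.eval σ θ} k≉0 p)

    IndexCorrect : ∀ {Δ p} → Index Δ p → All MS.∣_∣ Δ → (Fin p → Carrierᴹ) → Set ℓ
    IndexCorrect {Δ} ι ρ w = ∀ i → All.lookup ρ i ≡ w (ι i)

    NamesCorrect : ∀ {Δ Θ} → Names Δ Θ → All MS.∣_∣ Δ → All NS.∣_∣ Θ → Set ℓ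
    NamesCorrect e ρ θ = ∀ s i → All.lookup θ (e s i) ≡ down s (All.lookup ρ i)

    -- Restricted to `ts`, because orthogonality is ensured only for finitely many coefficient
    -- vectors.
    OracleCorrect : ∀ {p Θ} → Oracle p Θ → List (Fin p → K.Carrier) →
                    All NS.∣_∣ Θ → (Fin p → Carrierᴹ) → Set (Level.suc ℓ)
    OracleCorrect {Θ = Θ} F ts θ w = ∀ {Θ′} (r : Θ ⊑ Θ′) θ′ → Extends r θ θ′ →
      ∀ {t} → t ∈ ts → Denotes θ′ (F r t) (comb t w)

    CoefficientsCorrect : ∀ {p} s → Coefficients p s → (Fin p → Carrierᴹ) → MS.∣ s ∣ → Set ℓ
    CoefficientsCorrect V c w v = comb c w ≈ᴹ v
    CoefficientsCorrect _ _ _ _ = ⊤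

    variableCoefficients-correct : ∀ {Δ p} s {ι : Index Δ p} {ρ w} → IndexCorrect ι ρ w → (i : s ∈ Δ) →
      CoefficientsCorrect s (variableCoefficients s ι i) w (All.lookup ρ i)
    variableCoefficients-correct V {ι} {w = w} h i =
      V′.≈ᴹ-trans (comb-basis (ι i) w) (Setoid.reflexive V-setoid (sym (h i)))
    variableCoefficients-correct Γ h i = _
    variableCoefficients-correct S h i = _

    coefficients-correct : ∀ {Δ p s} {ι : Index Δ p} {ρ w} → IndexCorrect ι ρ w → (t : Term L Δ s) →
                           CoefficientsCorrect s (coefficients ι t) w (M.eval t ρ)
    coefficients-correct {ι = ι} {ρ} {w} h (var {s} i) = variableCoefficients-correct s {ι} {ρ} {w} h i
    coefficients-correct {ι = ι} {w = w} h (app +ⱽ (t ∷ u ∷ [])) =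
      V′.≈ᴹ-trans (comb-+ (coefficients ι t) (coefficients ι u) w)
      (V′.+ᴹ-cong (coefficients-correct {ι = ι} {w = w} h t) (coefficients-correct {ι = ι} {w = w} h u))
    coefficients-correct {w = w} h (app 0ⱽ []) = comb-0 w
    coefficients-correct {ι = ι} {w = w} h (app (scal k) (t ∷ [])) =
      V′.≈ᴹ-trans (comb-* k (coefficients ι t) w)
      (V′.*ₗ-congˡ (coefficients-correct {ι = ι} {w = w} h t))
    coefficients-correct h (app ∞ᶠ ts) = _
    coefficients-correct h (app valᶠ ts) = _
    coefficients-correct h (app +•ᶠ ts) = _
    coefficients-correct h (app 𝟎ᶠ ts) = _
    coefficients-correct h (app (scal• x) ts) = _
    coefficients-correct h (app valₛᶠ ts) = _
    coefficients-correct h (app πᶠ ts) = _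

    TermCorrect : ∀ {Θ} s → TranslatedTerm Θ s → All NS.∣_∣ Θ → MS.∣ s ∣ → Set (Level.suc ℓ)
    TermCorrect V _ θ v = ⊤
    TermCorrect Γ g θ v = Represents θ g (λ t → N.eval t θ ≈Γ v)
    TermCorrect S g θ v = Represents θ g (λ t → N.eval t θ ≃ v)

    translateVariable-correct : ∀ {Δ Θ} s {e : Names Δ Θ} {ρ θ} → NamesCorrect e ρ θ → (i : s ∈ Δ) →
      TermCorrect s (translateVariable s e i) θ (All.lookup ρ i)
    translateVariable-correct V he i = _
    translateVariable-correct Γ he i k H = H _ (Γ′.Eq.reflexive (he Γ i))
    translateVariable-correct S he i k H = H _ (≃.reflexive (he S i))

    translateTerm-correct : ∀ {Δ p Θ s} {ι : Index Δ p} {e : Names Δ Θ} {F ρ w} {θ : All NS.∣_∣ Θ} →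
      IndexCorrect ι ρ w → NamesCorrect e ρ θ → (t : Term L Δ s) →
      (∀ {c} → c ∈ usedByTerm ι t → Denotes θ (F c) (comb c w)) →
      TermCorrect s (translateTerm ι e F t) θ (M.eval t ρ)
    translateTerm-correct {ρ = ρ} hι he (var {s} i) hF = translateVariable-correct s {ρ = ρ} he i
    translateTerm-correct hι he (app +ⱽ ts) hF = _
    translateTerm-correct hι he (app 0ⱽ ts) hF = _
    translateTerm-correct hι he (app (scal _) ts) hF = _
    translateTerm-correct hι he (app ∞ᶠ []) hF k H = H _ Γ′.Eq.refl
    translateTerm-correct {ι = ι} {w = w} hι he (app valᶠ (t ∷ [])) hF k H = hF (here refl) _ λ σ p →
      H _ (Γ′.Eq.trans (proj₁ p) (val-cong (coefficients-correct {ι = ι} {w = w} hι t)))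
    translateTerm-correct {ι = ι} {ρ = ρ} {w = w} {θ = θ} hι he (app +•ᶠ (t ∷ u ∷ [])) hF k H =
      translateTerm-correct {w = w} hι he t (λ i → hF (∈-++⁺ˡ i)) _ λ σ p →
      translateTerm-correct {w = w} hι he u (λ i → hF (∈-++⁺ʳ (usedByTerm ι t) i)) _ λ τ q →
      H _ (+•-cong {N.eval σ θ} {M.eval t ρ} {N.eval τ θ} {M.eval u ρ} p q)
    translateTerm-correct hι he (app 𝟎ᶠ []) hF k H = H _ (≃.refl {𝟎})
    translateTerm-correct {ρ = ρ} {w = w} {θ = θ} hι he (app (scal• a) (t ∷ [])) hF k H =
      translateTerm-correct {w = w} hι he t hF _ λ σ p →
      H _ (*•-cong {σ = N.eval σ θ} {M.eval t ρ} K.refl p)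
    translateTerm-correct {w = w} hι he (app valₛᶠ (t ∷ [])) hF k H =
      translateTerm-correct {w = w} hι he t hF _ λ σ p → H _ (proj₁ p)
    translateTerm-correct {ι = ι} {F = F} {w = w} hι he (app πᶠ (t ∷ [])) hF =
      Denotes-cong {g = F (coefficients ι t)} (coefficients-correct {ι = ι} {w = w} hι t) (hF (here refl))

    skipIndex-correct : ∀ s {Δ p} {ι : Index Δ p} {ρ w x} →
                        IndexCorrect ι ρ w → IndexCorrect (skipIndex s ι) (x ∷ ρ) w
    skipIndex-correct Γ h (there i) = h i
    skipIndex-correct S h (there i) = h i

    addVector-correct : ∀ {Δ p} {ι : Index Δ p} {ρ w x} →
                        IndexCorrect ι ρ w → IndexCorrect (addVector ι) (x ∷ ρ) (x ◂ w)
    addVector-correct h (here refl) = refl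
    addVector-correct h (there i)   = h i

    addName-correct : ∀ s {Δ Θ} {e : Names Δ Θ} {ρ θ x} →
                      NamesCorrect e ρ θ → NamesCorrect (addName s e) (x ∷ ρ) (down s x ∷ θ)
    addName-correct Γ h Γ (here refl) = refl
    addName-correct Γ h Γ (there i)   = h Γ i
    addName-correct Γ h S (there i)   = h S i
    addName-correct S h Γ (there i)   = h Γ i
    addName-correct S h S (here refl) = refl
    addName-correct S h S (there i)   = h S i

    skipNames-correct : ∀ {Δ Θ} {e : Names Δ Θ} {ρ θ} {x : MS.∣ V ∣} →
      NamesCorrect e ρ θ → NamesCorrect (skipNames e) (x ∷ ρ) θ
    skipNames-correct h Γ (there i) = h Γ i
    skipNames-correct h S (there i) = h S i

    weaken-correct : ∀ {p Θ s} {F : Oracle p Θ} {ts θ w} {x : NS.∣ s ∣} → OracleCorrect F ts θ w →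
      OracleCorrect (λ {Θ′} (r : (s ∷ Θ) ⊑ Θ′) → F (r ∘ there)) ts (x ∷ θ) w
    weaken-correct h r θ′ ext = h (r ∘ there) θ′ (ext ∘ there)

    extendOracle-correct : ∀ {p Θ} {a : Fin p → K.Carrier} {F : Oracle p Θ} {ts us θ w} {σ : NS.∣ S ∣} {x y} →
      OracleCorrect F us θ w → (∀ t → t ∈ ts → shift K t a ∈ us) →
      σ ≃ π y → x ≈ᴹ y +ᴹ comb a w → (∀ t → t ∈ ts → t zero *ₗ y ⟂ comb (shift K t a) w) →
      OracleCorrect (extendOracle a F) ts (σ ∷ θ) (x ◂ w)
    extendOracle-correct {a = a} {F} {w = w} {σ} {x} {y} hF us p x≈ orth r θ′ ext {t} t∈ =
      Denotes-cong {g = extendOracle a F r t} (comb-shift t a w x≈) (sum-denotes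
        {g = scale (t zero) (var (r (here refl)))} {h = F (r ∘ there) (shift K t a)}
        (scale-denotes (t zero) (var (r (here refl)))
          (≃.trans {All.lookup θ′ (r (here refl))} {σ} {π y} (≃.reflexive (ext (here refl))) p))
        (hF (r ∘ there) θ′ (ext ∘ there) (us t t∈))
        (orth t t∈))

    admissible⇒image : ∀ {p Θ} {a : Fin p → K.Carrier} (F : Oracle p Θ) ts {θ σ} →
      N.Sat (admissible a F ts) (σ ∷ θ) → ∃[ y ] σ ≃ π y
    admissible⇒image F ts {θ} {σ} h = Equivalence.to (Sat-inImage (var (here refl)) {σ ∷ θ})
      (proj₁ (Equivalence.to (Sat-∧ (inImage (var (here refl))) (⋀ ts _)) h))

    Sat-admissible : ∀ {p Θ} {a : Fin p → K.Carrier} {F : Oracle p Θ} {ts us θ w σ y} →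
      OracleCorrect F us θ w → (∀ t → t ∈ ts → shift K t a ∈ us) → σ ≃ π y →
      N.Sat (admissible a F ts) (σ ∷ θ) ⇔ (∀ t → t ∈ ts → t zero *ₗ y ⟂ comb (shift K t a) w)
    Sat-admissible {Θ = Θ} {a} {F} {ts} {θ = θ} {w} {σ} {y} hF us p = mk⇔
      (λ (_ , h) t t∈ → Equivalence.to (orth t t∈) (Equivalence.to (Sat-⋀ ts f) h t∈))
      (λ h → Equivalence.from (Sat-inImage (var (here refl)) {σ ∷ θ}) (y , p) ,
             Equivalence.from (Sat-⋀ ts f) (λ {t} t∈ → Equivalence.from (orth t t∈) (h t t∈)))
      ⇔-∘ Sat-∧ (inImage (var (here refl))) (⋀ ts f)
      where
      f : (Fin (suc _) → K.Carrier) → Formula SkL (S ∷ Θ)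
      f t = orthogonal (scale (t zero) (var (here refl))) (F there (shift K t a))
      orth : ∀ t → t ∈ ts → N.Sat (f t) (σ ∷ θ) ⇔ t zero *ₗ y ⟂ comb (shift K t a) w
      orth t t∈ = Sat-orthogonal
        {g = scale (t zero) (var (here refl))} {h = F there (shift K t a)}
        (scale-denotes (t zero) (var (here refl)) p)
        (hF there (σ ∷ θ) (λ _ → refl) (us t t∈))

    -- Context, vectors and oracle vary in the induction: under a vector quantifier the vectors are
    -- extended by x, but the skeletal context only by π y.
    translate-correct : ∀ {Δ p Θ} {ι : Index Δ p} {e : Names Δ Θ} {F : Oracle p Θ} {ρ w} {θ : All NS.∣_∣ Θ} →
      IndexCorrect ι ρ w → NamesCorrect e ρ θ → (φ : Formula L Δ) → OracleCorrect F (used ι φ) θ w →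
      N.Sat (translate ι e F φ) θ ⇔ M.Sat φ ρ
    translate-correct hι he falsum hF = ⇔-id _
    translate-correct {ι = ι} {w = w} {θ = θ} hι he (equal {V} t u) hF =
      hF id θ (λ _ → refl) (here refl) _ λ σ p →
      mk⇔ (λ z → VP.x∙y⁻¹≈ε⇒x≈y _ _ (V′.≈ᴹ-trans (V′.≈ᴹ-sym difference≈) z))
          (λ t≈u → V′.≈ᴹ-trans difference≈ (VP.x≈y⇒x∙y⁻¹≈ε t≈u))
      ⇔-∘ Sat-zero-⇔ σ p
      where
      difference≈ = V′.≈ᴹ-trans (comb-− (coefficients ι t) (coefficients ι u) w (K.-‿inverseˡ K.1#))
        (V′.+ᴹ-cong (coefficients-correct {ι = ι} {w = w} hι t)
                    (V′.-ᴹ‿cong (coefficients-correct {ι = ι} {w = w} hι u)))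
    translate-correct {ι = ι} {w = w} {θ = θ} hι he (equal {Γ} t u) hF =
      translateTerm-correct {w = w} hι he t (λ i → hF id θ (λ _ → refl) (∈-++⁺ˡ i)) _ λ α p →
      translateTerm-correct {w = w} hι he u (λ i → hF id θ (λ _ → refl) (∈-++⁺ʳ (usedByTerm ι t) i)) _ λ β q →
      mk⇔ (λ z → Γ′.Eq.trans (Γ′.Eq.sym p) (Γ′.Eq.trans z q))
          (λ z → Γ′.Eq.trans p (Γ′.Eq.trans z (Γ′.Eq.sym q)))
    translate-correct {ι = ι} {ρ = ρ} {w = w} {θ = θ} hι he (equal {S} t u) hF =
      translateTerm-correct {w = w} hι he t (λ i → hF id θ (λ _ → refl) (∈-++⁺ˡ i)) _ λ σ p →
      translateTerm-correct {w = w} hι he u (λ i → hF id θ (λ _ → refl) (∈-++⁺ʳ (usedByTerm ι t) i)) _ λ τ q →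
      mk⇔ (λ z → ≃.trans {M.eval t ρ} {N.eval σ θ} {M.eval u ρ} (≃.sym {N.eval σ θ} {M.eval t ρ} p)
                   (≃.trans {N.eval σ θ} {N.eval τ θ} {M.eval u ρ} z q))
          (λ z → ≃.trans {N.eval σ θ} {M.eval t ρ} {N.eval τ θ} p
                   (≃.trans {M.eval t ρ} {M.eval u ρ} {N.eval τ θ} z (≃.sym {N.eval τ θ} {M.eval u ρ} q)))
    translate-correct {ι = ι} {w = w} {θ = θ} hι he (rel less (t ∷ u ∷ [])) hF =
      translateTerm-correct {w = w} hι he t (λ i → hF id θ (λ _ → refl) (∈-++⁺ˡ i)) _ λ α p →
      translateTerm-correct {w = w} hι he u (λ i → hF id θ (λ _ → refl) (∈-++⁺ʳ (usedByTerm ι t) i)) _ λ β q →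
      mk⇔ (λ z → Γ′.<-respˡ-≈ p (Γ′.<-respʳ-≈ q z))
          (λ z → Γ′.<-respˡ-≈ (Γ′.Eq.sym p) (Γ′.<-respʳ-≈ (Γ′.Eq.sym q) z))
    translate-correct {ι = ι} {w = w} hι he (φ ⇒ ψ) hF = →-cong-⇔
      (translate-correct {w = w} hι he φ (λ r θ′ ext i → hF r θ′ ext (∈-++⁺ˡ i)))
      (translate-correct {w = w} hι he ψ (λ r θ′ ext i → hF r θ′ ext (∈-++⁺ʳ (used ι φ) i)))
    translate-correct {ι = ι} {e} {F} {ρ} {w} {θ} hι he (all V φ) hF = mk⇔ to from ⇔-∘ Sat-⋀ (centres ts) f
      where
      ts = used (addVector ι) φ
      body : (Fin _ → K.Carrier) → Formula SkL (S ∷ _)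
      body a = translate (addVector ι) (λ s i → there (skipNames e s i)) (extendOracle a F) φ
      f : (Fin _ → K.Carrier) → Formula SkL _
      f a = all S (admissible a F ts ⇒ body a)

      shift∈ : ∀ {a} → a ∈ centres ts → ∀ t → t ∈ ts → shift K t a ∈ used ι (all V φ)
      shift∈ a∈ t t∈ = ∈-cartesianProductWith⁺ (shift K) t∈ a∈

      induction : ∀ {a σ x y} → a ∈ centres ts → σ ≃ π y → x ≈ᴹ y +ᴹ comb a w →
        (∀ t → t ∈ ts → t zero *ₗ y ⟂ comb (shift K t a) w) →
        N.Sat (body a) (σ ∷ θ) ⇔ M.Sat φ (x ∷ ρ)
      induction {σ = σ} {x} a∈ p x≈ orth = translate-correct {w = x ◂ w} {θ = σ ∷ θ}
        (addVector-correct {ι = ι} {w = w} hι) (λ s i → skipNames-correct {e = e} {θ = θ} {x = x} he s i) φ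
        (extendOracle-correct {F = F} hF (shift∈ a∈) p x≈ orth)

      to : (∀ {a} → a ∈ centres ts → N.Sat (f a) θ) → ∀ x → M.Sat φ (x ∷ ρ)
      to h x with best-centre ts x w
      ... | a , a∈ , y , x≈ , orth = Equivalence.to (induction a∈ (≃.refl {π y}) x≈ orth)
        (h a∈ (π y) (Equivalence.from (Sat-admissible {F = F} hF (shift∈ a∈) (≃.refl {π y})) orth))

      from : (∀ x → M.Sat φ (x ∷ ρ)) → ∀ {a} → a ∈ centres ts → N.Sat (f a) θ
      from h {a} a∈ σ adm
        with admissible⇒image F ts adm
      -- The vector to which `h` is applied is y + Σ aᵢ wᵢ, with a given by the conjunct and y by
      -- the admissible class.
      ... | y , p = Equivalence.from
        (induction a∈ p V′.≈ᴹ-refl (Equivalence.to (Sat-admissible {F = F} hF (shift∈ a∈) p) adm)) (h _)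
    translate-correct {ι = ι} {F = F} {w = w} hι he (all Γ φ) hF = ∀-cong-⇔ λ x →
      translate-correct {w = w} (skipIndex-correct Γ {ι = ι} {w = w} {x = x} hι)
        (addName-correct Γ he) φ (weaken-correct {F = F} hF)
    translate-correct {ι = ι} {F = F} {w = w} hι he (all S φ) hF = ∀-cong-⇔ λ x →
      translate-correct {w = w} (skipIndex-correct S {ι = ι} {w = w} {x = x} hι)
        (addName-correct S he) φ (weaken-correct {F = F} hF)

    -- Free variables as parameters in the skeleton

    record Reading {Δ} (ρ : All MS.∣_∣ Δ) : Set ℓ where
      field
        {size}        : ℕ
        {context}     : List SkSort
        index         : Index Δ size
        names         : Names Δ context
        vectors       : Fin size → Carrierᴹ
        values        : All NS.∣_∣ context
        index-correct : IndexCorrect index ρ vectors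
        names-correct : NamesCorrect names ρ values

    reading : ∀ {Δ} (ρ : All MS.∣_∣ Δ) → Reading ρ
    reading [] = record
      { size = 0 ; context = [] ; index = λ () ; names = λ _ () ; vectors = λ () ; values = []
      ; index-correct = λ () ; names-correct = λ _ () }
    reading (_∷_ {V} x ρ) = record
      { index = addVector index ; names = skipNames names ; vectors = x ◂ vectors ; values = values
      ; index-correct = addVector-correct {ι = index} {w = vectors} index-correct
      ; names-correct = skipNames-correct {e = names} {θ = values} {x = x} names-correct }
      where open Reading (reading ρ)
    reading (_∷_ {Γ} x ρ) = record
      { index = skipIndex Γ index ; names = addName Γ names ; vectors = vectors ; values = x ∷ values
      ; index-correct = skipIndex-correct Γ {ι = index} {w = vectors} {x = x} index-correct
      ; names-correct = addName-correct Γ {e = names} {θ = values} names-correct }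
      where open Reading (reading ρ)
    reading (_∷_ {S} x ρ) = record
      { index = skipIndex S index ; names = addName S names ; vectors = vectors ; values = x ∷ values
      ; index-correct = skipIndex-correct S {ι = index} {w = vectors} {x = x} index-correct
      ; names-correct = addName-correct S {e = names} {θ = values} names-correct }
      where open Reading (reading ρ)

    -- The classes of the finitely many combinations that the formula uses become parameters, so the
    -- initial oracle is a lookup. `stored` covers every membership proof, since the lookup uses the
    -- one supplied by excluded middle.
    record Storage {Θ p} (θ : All NS.∣_∣ Θ) (w : Fin p → Carrierᴹ) (ts : List (Fin p → K.Carrier)) :
           Set ℓ where
      field
        {context′} : List SkSort
        values′    : All NS.∣_∣ context′
        rename     : Θ ⊑ context′
        extends    : Extends rename θ values′
        slot       : ∀ t → t ∈ ts → S ∈ context′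
        stored     : ∀ t (i : t ∈ ts) → All.lookup values′ (slot t i) ≡ π (comb t w)

    storage : ∀ {Θ p} (θ : All NS.∣_∣ Θ) (w : Fin p → Carrierᴹ) ts → Storage θ w ts
    storage θ w [] = record
      { values′ = θ ; rename = id ; extends = λ _ → refl ; slot = λ _ () ; stored = λ _ () }
    storage θ w (t ∷ ts) = record
      { context′ = S ∷ context′ ; values′ = π (comb t w) ∷ values′
      ; rename = λ i → there (rename i) ; extends = extends
      ; slot = λ { u (here _) → here refl ; u (there i) → there (slot u i) }
      ; stored = λ { u (here refl) → refl ; u (there i) → stored u i } }
      where open Storage (storage θ w ts)

  -- Coefficient vectors are functions, so membership is decided by excluded middle. The answer
  -- outside `ts` is arbitrary.
  lookupOracle : ∀ {p Θ} (ts : List (Fin p → K.Carrier)) → (∀ t → t ∈ ts → S ∈ Θ) → Oracle p Θ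
  lookupOracle ts slot r t k with em {P = t ∈ ts}
  ... | yes i = k (var (r (slot t i)))
  ... | no _  = k 𝟎′

  -- The skeleton as part of the full structure

  raiseTerm : ∀ {Δ Θ s} → (∀ s → s ∈ Θ → ⌊ s ⌋ ∈ Δ) → Term SkL Θ s → Term L Δ ⌊ s ⌋
  raiseTerm e (var {s} i) = var (e s i)
  raiseTerm e (app +•ᶠ (t ∷ u ∷ [])) = app +•ᶠ (raiseTerm e t ∷ raiseTerm e u ∷ [])
  raiseTerm e (app 𝟎ᶠ []) = app 𝟎ᶠ []
  raiseTerm e (app (scal• k) (t ∷ [])) = app (scal• k) (raiseTerm e t ∷ [])
  raiseTerm e (app valₛᶠ (t ∷ [])) = app valₛᶠ (raiseTerm e t ∷ [])

  lift : ∀ {Δ Θ s} → (∀ s → s ∈ Θ → ⌊ s ⌋ ∈ Δ) → ∀ t → t ∈ (s ∷ Θ) → ⌊ t ⌋ ∈ (⌊ s ⌋ ∷ Δ)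
  lift e s (here refl) = here refl
  lift e s (there i)   = there (e s i)

  raise : ∀ {Δ Θ} → (∀ s → s ∈ Θ → ⌊ s ⌋ ∈ Δ) → Formula SkL Θ → Formula L Δ
  raise e falsum = falsum
  raise e (equal t u) = equal (raiseTerm e t) (raiseTerm e u)
  raise e (rel less (t ∷ u ∷ [])) = rel less (raiseTerm e t ∷ raiseTerm e u ∷ [])
  raise e (φ ⇒ ψ) = raise e φ ⇒ raise e ψ
  raise e (all s φ) = all ⌊ s ⌋ (raise (lift e) φ)

  module Raised (𝒱 : ValuedVectorSpace K) where
    open ValuedVectorSpace 𝒱 hiding (module V; module Γ)
    open Skeleton 𝒱 hiding (S)
    open Translated 𝒱 using (down)
    private
      M = structure 𝒱
      N = skeleton 𝒱
      module M = Semantics M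
      module N = Semantics N
      module MS = Structure M
      module NS = Structure N

    RaisedNames : ∀ {Δ Θ} → (∀ s → s ∈ Θ → ⌊ s ⌋ ∈ Δ) → All MS.∣_∣ Δ → All NS.∣_∣ Θ → Set ℓ
    RaisedNames e ρ θ = ∀ s i → down s (All.lookup ρ (e s i)) ≡ All.lookup θ i

    module _ {Δ Θ} {e : ∀ s → s ∈ Θ → ⌊ s ⌋ ∈ Δ} {ρ θ} (h : RaisedNames e ρ θ) where

      raiseTerm-correct : ∀ {s} (t : Term SkL Θ s) → down s (M.eval (raiseTerm e t) ρ) ≡ N.eval t θ
      raiseTerm-correct (var {s} i) = h s i
      raiseTerm-correct (app +•ᶠ (t ∷ u ∷ [])) = cong₂ _+•_ (raiseTerm-correct t) (raiseTerm-correct u)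
      raiseTerm-correct (app 𝟎ᶠ []) = refl
      raiseTerm-correct (app (scal• k) (t ∷ [])) = cong (k *•_) (raiseTerm-correct t)
      raiseTerm-correct (app valₛᶠ (t ∷ [])) = cong valₛ (raiseTerm-correct t)

    lift-correct : ∀ {Δ Θ s} {e : ∀ s → s ∈ Θ → ⌊ s ⌋ ∈ Δ} {ρ θ} {x : MS.∣ ⌊ s ⌋ ∣} → RaisedNames e ρ θ →
                   RaisedNames {⌊ s ⌋ ∷ Δ} {s ∷ Θ} (lift e) (x ∷ ρ) (down s x ∷ θ)
    lift-correct h s (here refl) = refl
    lift-correct h s (there i)   = h s i

    raise-correct : ∀ {Δ Θ} {e : ∀ s → s ∈ Θ → ⌊ s ⌋ ∈ Δ} {ρ θ} → RaisedNames e ρ θ →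
                    (φ : Formula SkL Θ) → M.Sat (raise e φ) ρ ⇔ N.Sat φ θ
    raise-correct {Θ = Θ} {e} {ρ} {θ} h = sound
      where
      tc : ∀ {s} (t : Term SkL Θ s) → down s (M.eval (raiseTerm e t) ρ) ≡ N.eval t θ
      tc = raiseTerm-correct {ρ = ρ} {θ} h

      sound : (φ : Formula SkL Θ) → M.Sat (raise e φ) ρ ⇔ N.Sat φ θ
      sound falsum = ⇔-id _
      sound (equal {Γ} t u) = cong₂-⇔ _≈Γ_ (tc t) (tc u)
      sound (equal {S} t u) = cong₂-⇔ _≃_ (tc t) (tc u)
      sound (rel less (t ∷ u ∷ [])) = cong₂-⇔ _<_ (tc t) (tc u)
      sound (φ ⇒ ψ) = →-cong-⇔ (sound φ) (sound ψ)
      sound (all Γ φ) = ∀-cong-⇔ λ x →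
        raise-correct {ρ = x ∷ ρ} {x ∷ θ} (lift-correct {e = e} {ρ} {θ} {x} h) φ
      sound (all S φ) = ∀-cong-⇔ λ x →
        raise-correct {ρ = x ∷ ρ} {x ∷ θ} (lift-correct {e = e} {ρ} {θ} {x} h) φ

    record RaisedReading {Θ} (θ : All NS.∣_∣ Θ) : Set ℓ where
      field
        {context} : List Sort
        names     : ∀ s → s ∈ Θ → ⌊ s ⌋ ∈ context
        values    : All MS.∣_∣ context
        correct   : RaisedNames names values θ

    raisedReading : ∀ {Θ} (θ : All NS.∣_∣ Θ) → RaisedReading θ
    raisedReading [] = record { context = [] ; names = λ _ () ; values = [] ; correct = λ _ () }
    raisedReading (_∷_ {Γ} x θ) = record
      { names = lift names ; values = x ∷ values
      ; correct = lift-correct {e = names} {values} {θ} {x} correct }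
      where open RaisedReading (raisedReading θ)
    raisedReading (_∷_ {S} x θ) = record
      { names = lift names ; values = x ∷ values
      ; correct = lift-correct {e = names} {values} {θ} {x} correct }
      where open RaisedReading (raisedReading θ)

  -- Transfer along an embedding over a fixed field

  module _ {𝒱 𝒲 : ValuedVectorSpace K} (h : Embedding (structure 𝒱) (structure 𝒲)) where
    open Embedding h using (map-func) renaming (map to ⟨h⟩)
    private
      ĥ = skeletonEmbedding {𝒱} {𝒲} h
      module V = Translated 𝒱
      module W = Translated 𝒲
      module VR = Raised 𝒱
      module WR = Raised 𝒲
      module 𝒱 = ValuedVectorSpace 𝒱
      module 𝒲 = ValuedVectorSpace 𝒲
      module W≃ = Setoid (Skeleton.S 𝒲)
      hᵥ : 𝒱.Carrierᴹ → 𝒲.Carrierᴹ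
      hᵥ = ⟨h⟩ {V}
      ⟨ĥ⟩ : ∀ {s} → Structure.∣_∣ (skeleton 𝒱) s → Structure.∣_∣ (skeleton 𝒲) s
      ⟨ĥ⟩ {s} = Embedding.map ĥ {s}

    mapM : ∀ {Δ} → All (Structure.∣_∣ (structure 𝒱)) Δ → All (Structure.∣_∣ (structure 𝒲)) Δ
    mapM = All.map (λ {s} → ⟨h⟩ {s})

    mapN : ∀ {Θ} → All (Structure.∣_∣ (skeleton 𝒱)) Θ → All (Structure.∣_∣ (skeleton 𝒲)) Θ
    mapN = All.map (λ {s} → ⟨ĥ⟩ {s})

    lookup-mapM : ∀ {Δ s} (ρ : All _ Δ) (i : s ∈ Δ) → All.lookup (mapM ρ) i ≡ ⟨h⟩ {s} (All.lookup ρ i)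
    lookup-mapM = All.lookup-map

    lookup-mapN : ∀ {Θ s} (θ : All _ Θ) (i : s ∈ Θ) → All.lookup (mapN θ) i ≡ ⟨ĥ⟩ {s} (All.lookup θ i)
    lookup-mapN = All.lookup-map

    down-map : ∀ s (x : Structure.∣_∣ (structure 𝒱) ⌊ s ⌋) →
               ⟨ĥ⟩ {s} (V.down s x) ≡ W.down s (⟨h⟩ {⌊ s ⌋} x)
    down-map Γ x = refl
    down-map S x = refl

    map-comb : ∀ {p} (t : Fin p → K.Carrier) w →
      hᵥ (Combinations.comb 𝒱 t w) 𝒲.≈ᴹ Combinations.comb 𝒲 t (hᵥ ∘ w)
    map-comb {zero} t w = map-func 0ⱽ []
    map-comb {suc p} t w = 𝒲.V.≈ᴹ-trans (map-func +ⱽ (_ ∷ _ ∷ []))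
      (𝒲.V.+ᴹ-cong (map-func (scal (t zero)) (w zero ∷ [])) (map-comb (t ∘ suc) (w ∘ suc)))

    elementary⇒skeleton : IsElementary h → IsElementary ĥ
    elementary⇒skeleton el φ θ =
      WR.raise-correct {ρ = mapM values} {mapN θ} correct′ φ
      ⇔-∘ (el (raise names φ) values ⇔-∘ ⇔-sym (VR.raise-correct {ρ = values} {θ} correct φ))
      where
      open VR.RaisedReading (VR.raisedReading θ)
      correct′ : WR.RaisedNames names (mapM values) (mapN θ)
      correct′ s i = trans (cong (W.down s) (lookup-mapM values (names s i)))
        (trans (sym (down-map s (All.lookup values (names s i))))
        (trans (cong (⟨ĥ⟩ {s}) (correct s i)) (sym (lookup-mapN θ i))))

    -- Both spaces share the translated formula. The stored classes go to the classes of the mapped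
    -- combinations because the embedding commutes with π and with linear combinations, so
    -- elementarity of `ĥ` at this one formula suffices.
    skeleton⇒elementary : IsElementary ĥ → IsElementary h
    skeleton⇒elementary el φ ρ =
      W.translate-correct {w = hᵥ ∘ vectors}
        (λ i → trans (lookup-mapM ρ i) (cong hᵥ (index-correct i)))
        (λ s i → trans (lookup-mapN values′ (rename (names s i)))
          (trans (cong (⟨ĥ⟩ {s}) (trans (extends (names s i)) (names-correct s i)))
          (trans (down-map s (All.lookup ρ i)) (cong (W.down s) (sym (lookup-mapM ρ i))))))
        φ oracleʷ
      ⇔-∘ (el (translate index names′ F φ) values′
      ⇔-∘ ⇔-sym (V.translate-correct {w = vectors} index-correct
        (λ s i → trans (extends (names s i)) (names-correct s i)) φ oracleᵛ))
      where
      open V.Reading (V.reading ρ)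
      ts = used index φ
      open V.Storage (V.storage values vectors ts)
      names′ : Names _ context′
      names′ s i = rename (names s i)
      F : Oracle size context′
      F = lookupOracle ts slot

      oracleᵛ : V.OracleCorrect F ts values′ vectors
      oracleᵛ r θ′ ext {t} t∈ k H with em {P = t ∈ ts}
      ... | yes i = H _ (Setoid.reflexive (Skeleton.S 𝒱) (trans (ext (slot t i)) (stored t i)))
      ... | no ¬i = contradiction t∈ ¬i

      oracleʷ : W.OracleCorrect F ts (mapN values′) (hᵥ ∘ vectors)
      oracleʷ r θ′ ext {t} t∈ k H with em {P = t ∈ ts}
      ... | no ¬i = contradiction t∈ ¬i
      ... | yes i = H _ (W≃.trans {All.lookup θ′ (r (slot t i))} {⟨h⟩ {S} (Skeleton.π 𝒱 u)} {πu′}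
          (W≃.reflexive (trans (ext (slot t i))
            (trans (lookup-mapN values′ (slot t i)) (cong (⟨ĥ⟩ {S}) (stored t i)))))
          (W≃.trans {⟨h⟩ {S} (Skeleton.π 𝒱 u)} {Skeleton.π 𝒲 (hᵥ u)} {πu′}
            (map-func πᶠ (u ∷ [])) (Skeleton.π-cong 𝒲 (map-comb t vectors))))
        where
        u = Combinations.comb 𝒱 t vectors
        πu′ = Skeleton.π 𝒲 (Combinations.comb 𝒲 t (hᵥ ∘ vectors))

-- Variable base field

module VariableTranslation where
  open VariableField
  open Connectives SkL

  _≺_ : ∀ {Θ} → Term SkL Θ S → Term SkL Θ S → Formula SkL Θ
  σ ≺ τ = rel less (app valₛᶠ (σ ∷ []) ∷ app valₛᶠ (τ ∷ []) ∷ [])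

  _⊕_ : ∀ {Θ} → Term SkL Θ S → Term SkL Θ S → Term SkL Θ S
  σ ⊕ τ = app +•ᶠ (σ ∷ τ ∷ [])

  𝟎′ : ∀ {Θ} → Term SkL Θ S
  𝟎′ = app 𝟎ᶠ []

  null : ∀ {Θ} → Term SkL Θ S → Term SkL Θ S
  null σ = app scal• (app 0ᴷ [] ∷ σ ∷ [])

  open SkeletalFormulas SkL S _≺_ _⊕_ 𝟎′ null

  infixl 6 _+′_
  _+′_ : ∀ {Θ} → Term SkL Θ K → Term SkL Θ K → Term SkL Θ K
  a +′ b = app +ᴷ (a ∷ b ∷ [])

  infixl 7 _*′_
  _*′_ : ∀ {Θ} → Term SkL Θ K → Term SkL Θ K → Term SkL Θ K
  a *′ b = app *ᴷ (a ∷ b ∷ [])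

  -- The scalar is now a term whose vanishing depends on the assignment, so the case distinction
  -- moves into the formula.
  scale : ∀ {Θ} → Term SkL Θ K → Term SkL Θ S → Definable Θ S
  scale k σ f = ite (equal k (app 0ᴷ [])) (f 𝟎′) (f (app scal• (k ∷ σ ∷ [])))

  forallScalars : ∀ p {Θ} → (∀ {Θ′} → Θ ⊑ Θ′ → (Fin p → K ∈ Θ′) → Formula SkL Θ′) → Formula SkL Θ
  forallScalars zero    f = f id (λ ())
  forallScalars (suc p) f = all K (forallScalars p λ r c → f (r ∘ there) (r (here refl) ◂ c))

  ⌊_⌋ : SkSort → Sort
  ⌊ K ⌋ = K
  ⌊ Γ ⌋ = Γ
  ⌊ S ⌋ = S

  Index : List Sort → ℕ → Set
  Index Δ p = V ∈ Δ → Fin p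

  Names : List Sort → List SkSort → Set
  Names Δ Θ = ∀ s → ⌊ s ⌋ ∈ Δ → s ∈ Θ

  addVector : ∀ {Δ p} → Index Δ p → Index (V ∷ Δ) (suc p)
  addVector ι (here refl) = zero
  addVector ι (there i)   = suc (ι i)

  skipIndex : ∀ s {Δ p} → Index Δ p → Index (⌊ s ⌋ ∷ Δ) p
  skipIndex K ι (there i) = ι i
  skipIndex Γ ι (there i) = ι i
  skipIndex S ι (there i) = ι i

  skipNames : ∀ {Δ Θ} → Names Δ Θ → Names (V ∷ Δ) Θ
  skipNames e K (there i) = e K i
  skipNames e Γ (there i) = e Γ i
  skipNames e S (there i) = e S i

  addName : ∀ s {Δ Θ} → Names Δ Θ → Names (⌊ s ⌋ ∷ Δ) (s ∷ Θ)
  addName K e K (here refl) = here refl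
  addName K e K (there i)   = there (e K i)
  addName K e Γ (there i)   = there (e Γ i)
  addName K e S (there i)   = there (e S i)
  addName Γ e K (there i)   = there (e K i)
  addName Γ e Γ (here refl) = here refl
  addName Γ e Γ (there i)   = there (e Γ i)
  addName Γ e S (there i)   = there (e S i)
  addName S e K (there i)   = there (e K i)
  addName S e Γ (there i)   = there (e Γ i)
  addName S e S (here refl) = here refl
  addName S e S (there i)   = there (e S i)

  -- Scalars may contain bound variables, so coefficients are terms and not field elements.
  Coefficients : List SkSort → ℕ → Sort → Set
  Coefficients Θ p V = Fin p → Term SkL Θ K
  Coefficients Θ p K = Term SkL Θ K
  Coefficients Θ p _ = ⊤

  variableCoefficients : ∀ {Δ Θ p} s → Index Δ p → Names Δ Θ → s ∈ Δ → Coefficients Θ p s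
  variableCoefficients V ι e i = basis (app 0ᴷ []) (app 1ᴷ []) (ι i)
  variableCoefficients K ι e i = var (e K i)
  variableCoefficients Γ ι e i = _
  variableCoefficients S ι e i = _

  coefficients : ∀ {Δ Θ p s} → Index Δ p → Names Δ Θ → Term L Δ s → Coefficients Θ p s
  coefficients ι e (var {s} i) = variableCoefficients s ι e i
  coefficients ι e (app +ⱽ (t ∷ u ∷ [])) i = coefficients ι e t i +′ coefficients ι e u i
  coefficients ι e (app 0ⱽ []) i = app 0ᴷ []
  coefficients ι e (app scal (k ∷ t ∷ [])) i = coefficients ι e k *′ coefficients ι e t i
  coefficients ι e (app +ᴷ (a ∷ b ∷ [])) = coefficients ι e a +′ coefficients ι e b
  coefficients ι e (app *ᴷ (a ∷ b ∷ [])) = coefficients ι e a *′ coefficients ι e b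
  coefficients ι e (app 0ᴷ []) = app 0ᴷ []
  coefficients ι e (app 1ᴷ []) = app 1ᴷ []
  coefficients ι e (app ∞ᶠ ts) = _
  coefficients ι e (app valᶠ ts) = _
  coefficients ι e (app +•ᶠ ts) = _
  coefficients ι e (app 𝟎ᶠ ts) = _
  coefficients ι e (app scal• ts) = _
  coefficients ι e (app valₛᶠ ts) = _
  coefficients ι e (app πᶠ ts) = _

  -- An oracle sends c to π (Σ cᵢ wᵢ), in every extension of the context.
  Oracle : ℕ → List SkSort → Set
  Oracle p Θ = ∀ {Θ′} → Θ ⊑ Θ′ → (Fin p → Term SkL Θ′ K) → Definable Θ′ S

  shiftTerm : ∀ {p Θ} → (Fin (suc p) → Term SkL Θ K) → (Fin p → K ∈ Θ) → Fin p → Term SkL Θ K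
  shiftTerm t c i = t (suc i) +′ t zero *′ var (c i)

  -- The coefficients of x - y are variables `c` introduced after π y. The renaming `r` leads to the
  -- context containing them, and `r′` to the one where the oracle is asked.
  extendOracle : ∀ {p Θ Θ′} → (S ∷ Θ) ⊑ Θ′ → (Fin p → K ∈ Θ′) → Oracle p Θ → Oracle (suc p) Θ′
  extendOracle r c F r′ t = sum (scale (t zero) (var (r′ (r (here refl)))))
                                (F (λ i → r′ (r (there i))) (shiftTerm t (λ i → r′ (c i))))

  -- Testing y alone is enough: the span is closed under scalars, so `⟂-scale` extends orthogonality
  -- to the nonzero multiples of y.
  orthogonalToSpan : ∀ {p Θ} → Oracle p Θ → Formula SkL (S ∷ Θ)
  orthogonalToSpan {p} F = forallScalars p λ r c →
    orthogonal (λ k → k (var (r (here refl)))) (F (r ∘ there) (var ∘ c))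

  admissible : ∀ {p Θ} → Oracle p Θ → Formula SkL (S ∷ Θ)
  admissible F = inImage (var (here refl)) ∧ orthogonalToSpan F

  TranslatedTerm : List SkSort → Sort → Set
  TranslatedTerm Θ V = ⊤
  TranslatedTerm Θ K = ⊤
  TranslatedTerm Θ Γ = Definable Θ Γ
  TranslatedTerm Θ S = Definable Θ S

  translateVariable : ∀ {Δ Θ} s → Names Δ Θ → s ∈ Δ → TranslatedTerm Θ s
  translateVariable V e i = _
  translateVariable K e i = _
  translateVariable Γ e i k = k (var (e Γ i))
  translateVariable S e i k = k (var (e S i))

  translateTerm : ∀ {Δ p Θ s} → Index Δ p → Names Δ Θ → ((Fin p → Term SkL Θ K) → Definable Θ S) →
                  Term L Δ s → TranslatedTerm Θ s
  translateTerm ι e F (var {s} i) = translateVariable s e i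
  translateTerm ι e F (app +ⱽ ts) = _
  translateTerm ι e F (app 0ⱽ ts) = _
  translateTerm ι e F (app scal ts) = _
  translateTerm ι e F (app +ᴷ ts) = _
  translateTerm ι e F (app *ᴷ ts) = _
  translateTerm ι e F (app 0ᴷ ts) = _
  translateTerm ι e F (app 1ᴷ ts) = _
  translateTerm ι e F (app ∞ᶠ []) k = k (app valₛᶠ (𝟎′ ∷ []))
  translateTerm ι e F (app valᶠ (t ∷ [])) k = F (coefficients ι e t) λ σ → k (app valₛᶠ (σ ∷ []))
  translateTerm ι e F (app +•ᶠ (t ∷ u ∷ [])) k =
    translateTerm ι e F t λ σ → translateTerm ι e F u λ τ → k (σ ⊕ τ)
  translateTerm ι e F (app 𝟎ᶠ []) k = k 𝟎′
  translateTerm ι e F (app scal• (a ∷ t ∷ [])) k =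
    translateTerm ι e F t λ σ → k (app scal• (coefficients ι e a ∷ σ ∷ []))
  translateTerm ι e F (app valₛᶠ (t ∷ [])) k = translateTerm ι e F t λ σ → k (app valₛᶠ (σ ∷ []))
  translateTerm ι e F (app πᶠ (t ∷ [])) k = F (coefficients ι e t) k

  -- The name n denotes −1, for which the language of fields has no term.
  translate : ∀ {Δ p Θ} → Index Δ p → Names Δ Θ → K ∈ Θ → Oracle p Θ → Formula L Δ → Formula SkL Θ
  translate ι e n F falsum = falsum
  translate ι e n F (equal {V} t u) =
    F id (λ i → coefficients ι e t i +′ var n *′ coefficients ι e u i) λ σ → equal σ 𝟎′
  translate ι e n F (equal {K} a b) = equal (coefficients ι e a) (coefficients ι e b)
  translate ι e n F (equal {Γ} t u) =
    translateTerm ι e (F id) t λ α → translateTerm ι e (F id) u λ β → equal α β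
  translate ι e n F (equal {S} t u) =
    translateTerm ι e (F id) t λ σ → translateTerm ι e (F id) u λ τ → equal σ τ
  translate ι e n F (rel less (t ∷ u ∷ [])) =
    translateTerm ι e (F id) t λ α → translateTerm ι e (F id) u λ β → rel less (α ∷ β ∷ [])
  translate ι e n F (φ ⇒ ψ) = translate ι e n F φ ⇒ translate ι e n F ψ
  -- Admissibility concerns y alone, so the coefficients of x - y are quantified afterwards without
  -- any condition.
  translate {p = p} ι e n F (all V φ) = all S (admissible F ⇒ forallScalars p λ r c →
    translate (addVector ι) (λ s i → r (there (skipNames e s i))) (r (there n)) (extendOracle r c F) φ)
  translate ι e n F (all K φ) = all K (translate (skipIndex K ι) (addName K e) (there n)
    (λ r → F (r ∘ there)) φ)
  translate ι e n F (all Γ φ) = all Γ (translate (skipIndex Γ ι) (addName Γ e) (there n)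
    (λ r → F (r ∘ there)) φ)
  translate ι e n F (all S φ) = all S (translate (skipIndex S ι) (addName S e) (there n)
    (λ r → F (r ∘ there)) φ)

  -- Correctness of the translation over a variable field

  module Translated {ℓ} (em : ExcludedMiddle ℓ) {𝔽 : Field ℓ} (𝒱 : ValuedVectorSpace 𝔽) where
    open ValuedVectorSpace 𝒱 hiding (module V; module Γ)
    open Skeleton 𝒱 hiding (S)
    open Skeletal 𝒱
    open Combinations 𝒱
    private
      module 𝔽 = Field 𝔽
      module V′ = ValuedVectorSpace.V 𝒱
      module Γ′ = ValuedVectorSpace.Γ 𝒱
      module VP = AbelianGroupProperties V′.+ᴹ-abelianGroup
      module ≃ = Setoid (Skeleton.S 𝒱)
      M = structure 𝒱
      N = skeleton 𝒱
      module M = Semantics M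
      module N = Semantics N
      module MS = Structure M
      module NS = Structure N
    open Truth em N
    open Correctness em 𝒱 N N.eval (λ σ τ → ⇔-id _) (λ σ τ → refl)
      (λ σ → ⇔-id _) (λ σ → ⇔-id _) (λ σ τ → ⇔-id _)

    down : ∀ s → MS.∣ ⌊ s ⌋ ∣ → NS.∣ s ∣
    down K x = x
    down Γ x = x
    down S x = x

    scale-denotes : ∀ {Θ} {θ : All NS.∣_∣ Θ} k σ {y} → N.eval σ θ ≃ π y →
                    Denotes θ (scale k σ) (N.eval k θ *ₗ y)
    scale-denotes {θ = θ} k σ {y} p f H = Sat-ite (equal k (app 0ᴷ [])) (f 𝟎′) (f (app scal• (k ∷ σ ∷ [])))
      (λ k≈0 → H 𝟎′ (≃.sym {π (N.eval k θ *ₗ y)} {𝟎}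
        (Equivalence.from π-0 (V′.≈ᴹ-trans (V′.*ₗ-congʳ k≈0) (V′.*ₗ-zeroˡ y)))))
      (λ k≉0 → H _ (π-*ₗ {σ = N.eval σ θ} k≉0 p))

    -- The assignment reached inside `forallScalars` when its scalars are g. `valuation` follows the
    -- same recursion, so `forallScalars⁻` needs no transport.
    record Valuation {p Θ} (θ : All NS.∣_∣ Θ) (g : Fin p → 𝔽.Carrier) : Set ℓ where
      field
        {context} : List SkSort
        values    : All NS.∣_∣ context
        rename    : Θ ⊑ context
        extends   : Extends rename θ values
        scalar    : Fin p → K ∈ context
        correct   : ∀ i → All.lookup values (scalar i) ≡ g i

    valuation : ∀ {p Θ} (θ : All NS.∣_∣ Θ) (g : Fin p → 𝔽.Carrier) → Valuation θ g
    valuation {zero} θ g = record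
      { values = θ ; rename = id ; extends = λ _ → refl ; scalar = λ () ; correct = λ () }
    valuation {suc p} θ g = record
      { values = values ; rename = rename ∘ there ; extends = extends ∘ there
      ; scalar = rename (here refl) ◂ scalar
      ; correct = λ { zero → extends (here refl) ; (suc i) → correct i } }
      where open Valuation (valuation {p} (_∷_ {x = K} (g zero) θ) (g ∘ suc))

    module _ where
      open Valuation

      forallScalars⁻ : ∀ p {Θ} {f : ∀ {Θ′} → Θ ⊑ Θ′ → (Fin p → K ∈ Θ′) → Formula SkL Θ′} {θ} →
        N.Sat (forallScalars p f) θ → ∀ g →
        let v = valuation θ g in N.Sat (f (rename v) (scalar v)) (values v)
      forallScalars⁻ zero    h g = h
      forallScalars⁻ (suc p) h g = forallScalars⁻ p (h (g zero)) (g ∘ suc)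

    forallScalars⁺ : ∀ p {Θ} {f : ∀ {Θ′} → Θ ⊑ Θ′ → (Fin p → K ∈ Θ′) → Formula SkL Θ′} {θ} →
      (∀ {Θ′} (r : Θ ⊑ Θ′) θ′ → Extends r θ θ′ → (c : Fin p → K ∈ Θ′) → N.Sat (f r c) θ′) →
      N.Sat (forallScalars p f) θ
    forallScalars⁺ zero    {θ = θ} h = h id θ (λ _ → refl) (λ ())
    forallScalars⁺ (suc p) h x = forallScalars⁺ p λ r θ′ ext c →
      h (r ∘ there) θ′ (ext ∘ there) (r (here refl) ◂ c)

    IndexCorrect : ∀ {Δ p} → Index Δ p → All MS.∣_∣ Δ → (Fin p → Carrierᴹ) → Set ℓ
    IndexCorrect {Δ} ι ρ w = ∀ i → All.lookup ρ i ≡ w (ι i)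

    NamesCorrect : ∀ {Δ Θ} → Names Δ Θ → All MS.∣_∣ Δ → All NS.∣_∣ Θ → Set ℓ
    NamesCorrect e ρ θ = ∀ s i → All.lookup θ (e s i) ≡ down s (All.lookup ρ i)

    ⟦_⟧ : ∀ {p Θ} → (Fin p → Term SkL Θ K) → All NS.∣_∣ Θ → Fin p → 𝔽.Carrier
    ⟦ t ⟧ θ i = N.eval (t i) θ

    -- All coefficient terms are covered, since orthogonality now holds for the whole span.
    OracleCorrect : ∀ {p Θ} → Oracle p Θ → All NS.∣_∣ Θ → (Fin p → Carrierᴹ) → Set (Level.suc ℓ)
    OracleCorrect {p} {Θ} F θ w = ∀ {Θ′} (r : Θ ⊑ Θ′) θ′ → Extends r θ θ′ →
      (t : Fin p → Term SkL Θ′ K) → Denotes θ′ (F r t) (comb (⟦ t ⟧ θ′) w)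

    CoefficientsCorrect : ∀ {p Θ} s → Coefficients Θ p s → All NS.∣_∣ Θ → (Fin p → Carrierᴹ) →
                          MS.∣ s ∣ → Set ℓ
    CoefficientsCorrect V c θ w v = comb (⟦ c ⟧ θ) w ≈ᴹ v
    CoefficientsCorrect K c θ w v = N.eval c θ 𝔽.≈ v
    CoefficientsCorrect _ _ _ _ _ = ⊤

    eval-basis : ∀ {p Θ} {θ : All NS.∣_∣ Θ} (i j : Fin p) →
                 N.eval (basis (app 0ᴷ []) (app 1ᴷ []) i j) θ ≡ basis 𝔽.0# 𝔽.1# i j
    eval-basis zero    zero    = refl
    eval-basis zero    (suc j) = refl
    eval-basis (suc i) zero    = refl
    eval-basis (suc i) (suc j) = eval-basis i j

    variableCoefficients-correct : ∀ {Δ Θ p} s {ι : Index Δ p} {e : Names Δ Θ} {ρ θ w} →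
      IndexCorrect ι ρ w → NamesCorrect e ρ θ → (i : s ∈ Δ) →
      CoefficientsCorrect s (variableCoefficients s ι e i) θ w (All.lookup ρ i)
    variableCoefficients-correct V {ι} {θ = θ} {w} h he i =
      V′.≈ᴹ-trans (comb-congˡ w (λ j → 𝔽.reflexive (eval-basis {θ = θ} (ι i) j)))
        (V′.≈ᴹ-trans (comb-basis (ι i) w) (Setoid.reflexive V-setoid (sym (h i))))
    variableCoefficients-correct K h he i = 𝔽.reflexive (he K i)
    variableCoefficients-correct Γ h he i = _
    variableCoefficients-correct S h he i = _

    module _ {Δ Θ p} {ι : Index Δ p} {e : Names Δ Θ} {ρ w} {θ : All NS.∣_∣ Θ}
             (hι : IndexCorrect ι ρ w) (he : NamesCorrect e ρ θ) where

      coefficients-correct : ∀ {s} (t : Term L Δ s) →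
                             CoefficientsCorrect s (coefficients ι e t) θ w (M.eval t ρ)
      coefficients-correct (var {s} i) = variableCoefficients-correct s {ι} {e} {ρ} {θ} {w} hι he i
      coefficients-correct (app +ⱽ (t ∷ u ∷ [])) =
        V′.≈ᴹ-trans (comb-+ (⟦ coefficients ι e t ⟧ θ) (⟦ coefficients ι e u ⟧ θ) w)
          (V′.+ᴹ-cong (coefficients-correct t) (coefficients-correct u))
      coefficients-correct (app 0ⱽ []) = comb-0 w
      coefficients-correct (app scal (k ∷ t ∷ [])) =
        V′.≈ᴹ-trans (comb-* (N.eval (coefficients ι e k) θ) (⟦ coefficients ι e t ⟧ θ) w)
          (V′.*ₗ-cong (coefficients-correct k) (coefficients-correct t))
      coefficients-correct (app +ᴷ (a ∷ b ∷ [])) = 𝔽.+-cong (coefficients-correct a) (coefficients-correct b)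
      coefficients-correct (app *ᴷ (a ∷ b ∷ [])) = 𝔽.*-cong (coefficients-correct a) (coefficients-correct b)
      coefficients-correct (app 0ᴷ []) = 𝔽.refl
      coefficients-correct (app 1ᴷ []) = 𝔽.refl
      coefficients-correct (app ∞ᶠ ts) = _
      coefficients-correct (app valᶠ ts) = _
      coefficients-correct (app +•ᶠ ts) = _
      coefficients-correct (app 𝟎ᶠ ts) = _
      coefficients-correct (app scal• ts) = _
      coefficients-correct (app valₛᶠ ts) = _
      coefficients-correct (app πᶠ ts) = _

    TermCorrect : ∀ {Θ} s → TranslatedTerm Θ s → All NS.∣_∣ Θ → MS.∣ s ∣ → Set (Level.suc ℓ)
    TermCorrect V _ θ v = ⊤
    TermCorrect K _ θ v = ⊤
    TermCorrect Γ g θ v = Represents θ g (λ t → N.eval t θ ≈Γ v)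
    TermCorrect S g θ v = Represents θ g (λ t → N.eval t θ ≃ v)

    translateVariable-correct : ∀ {Δ Θ} s {e : Names Δ Θ} {ρ θ} → NamesCorrect e ρ θ → (i : s ∈ Δ) →
      TermCorrect s (translateVariable s e i) θ (All.lookup ρ i)
    translateVariable-correct V he i = _
    translateVariable-correct K he i = _
    translateVariable-correct Γ he i k H = H _ (Γ′.Eq.reflexive (he Γ i))
    translateVariable-correct S he i k H = H _ (≃.reflexive (he S i))

    module _ {Δ Θ p} {ι : Index Δ p} {e : Names Δ Θ} {F : (Fin p → Term SkL Θ K) → Definable Θ S}
             {ρ w} {θ : All NS.∣_∣ Θ} (hι : IndexCorrect ι ρ w) (he : NamesCorrect e ρ θ)
             (hF : ∀ c → Denotes θ (F c) (comb (⟦ c ⟧ θ) w)) where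
      private
        cc : ∀ {s} (t : Term L Δ s) → CoefficientsCorrect s (coefficients ι e t) θ w (M.eval t ρ)
        cc = coefficients-correct {ι = ι} {e} {ρ} {w} {θ} hι he

      translateTerm-correct : ∀ {s} (t : Term L Δ s) → TermCorrect s (translateTerm ι e F t) θ (M.eval t ρ)
      translateTerm-correct (var {s} i) = translateVariable-correct s {e} {ρ} {θ} he i
      translateTerm-correct (app +ⱽ ts) = _
      translateTerm-correct (app 0ⱽ ts) = _
      translateTerm-correct (app scal ts) = _
      translateTerm-correct (app +ᴷ ts) = _
      translateTerm-correct (app *ᴷ ts) = _
      translateTerm-correct (app 0ᴷ ts) = _
      translateTerm-correct (app 1ᴷ ts) = _
      translateTerm-correct (app ∞ᶠ []) k H = H _ Γ′.Eq.refl
      translateTerm-correct (app valᶠ (t ∷ [])) k H = hF _ _ λ σ p →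
        H _ (Γ′.Eq.trans (proj₁ p) (val-cong (cc t)))
      translateTerm-correct (app +•ᶠ (t ∷ u ∷ [])) k H =
        translateTerm-correct t _ λ σ p → translateTerm-correct u _ λ τ q →
        H _ (+•-cong {N.eval σ θ} {M.eval t ρ} {N.eval τ θ} {M.eval u ρ} p q)
      translateTerm-correct (app 𝟎ᶠ []) k H = H _ (≃.refl {𝟎})
      translateTerm-correct (app scal• (a ∷ t ∷ [])) k H = translateTerm-correct t _ λ σ p →
        H _ (*•-cong {σ = N.eval σ θ} {M.eval t ρ} (cc a) p)
      translateTerm-correct (app valₛᶠ (t ∷ [])) k H = translateTerm-correct t _ λ σ p → H _ (proj₁ p)
      translateTerm-correct (app πᶠ (t ∷ [])) = Denotes-cong {g = F (coefficients ι e t)} (cc t) (hF _)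

    skipIndex-correct : ∀ s {Δ p} {ι : Index Δ p} {ρ w x} →
                        IndexCorrect ι ρ w → IndexCorrect (skipIndex s ι) (x ∷ ρ) w
    skipIndex-correct K h (there i) = h i
    skipIndex-correct Γ h (there i) = h i
    skipIndex-correct S h (there i) = h i

    addVector-correct : ∀ {Δ p} {ι : Index Δ p} {ρ w x} →
                        IndexCorrect ι ρ w → IndexCorrect (addVector ι) (x ∷ ρ) (x ◂ w)
    addVector-correct h (here refl) = refl
    addVector-correct h (there i)   = h i

    addName-correct : ∀ s {Δ Θ} {e : Names Δ Θ} {ρ θ x} →
                      NamesCorrect e ρ θ → NamesCorrect (addName s e) (x ∷ ρ) (down s x ∷ θ)
    addName-correct K h K (here refl) = refl
    addName-correct K h K (there i)   = h K i
    addName-correct K h Γ (there i)   = h Γ i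
    addName-correct K h S (there i)   = h S i
    addName-correct Γ h K (there i)   = h K i
    addName-correct Γ h Γ (here refl) = refl
    addName-correct Γ h Γ (there i)   = h Γ i
    addName-correct Γ h S (there i)   = h S i
    addName-correct S h K (there i)   = h K i
    addName-correct S h Γ (there i)   = h Γ i
    addName-correct S h S (here refl) = refl
    addName-correct S h S (there i)   = h S i

    skipNames-correct : ∀ {Δ Θ} {e : Names Δ Θ} {ρ θ} {x : MS.∣ V ∣} →
      NamesCorrect e ρ θ → NamesCorrect (skipNames e) (x ∷ ρ) θ
    skipNames-correct h K (there i) = h K i
    skipNames-correct h Γ (there i) = h Γ i
    skipNames-correct h S (there i) = h S i

    weaken-correct : ∀ {p Θ s} {F : Oracle p Θ} {θ w} {x : NS.∣ s ∣} → OracleCorrect F θ w →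
      OracleCorrect (λ {Θ′} (r : (s ∷ Θ) ⊑ Θ′) → F (r ∘ there)) (x ∷ θ) w
    weaken-correct h r θ′ ext = h (r ∘ there) θ′ (ext ∘ there)

    extendOracle-correct : ∀ {p Θ Θ′} {r : (S ∷ Θ) ⊑ Θ′} {c : Fin p → K ∈ Θ′} {F : Oracle p Θ}
        {θ θ′ w} {σ : NS.∣ S ∣} {g x y} →
      OracleCorrect F θ w → Extends r (σ ∷ θ) θ′ → (∀ i → All.lookup θ′ (c i) ≡ g i) →
      σ ≃ π y → x ≈ᴹ y +ᴹ comb g w → (∀ d → y ⟂ comb d w) →
      OracleCorrect (extendOracle r c F) θ′ (x ◂ w)
    extendOracle-correct {r = r} {c} {F} {θ′ = θ′} {w} {σ} {g} {x} {y} hF ext hc p x≈ orth {Θ″} r′ θ″ ext′ t =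
      Denotes-cong {g = extendOracle r c F r′ t} (comb-shift (⟦ t ⟧ θ″) g w x≈) (sum-denotes
        {g = scale (t zero) (var (r′ (r (here refl))))} {h = F (λ i → r′ (r (there i))) t′}
        (scale-denotes (t zero) (var (r′ (r (here refl))))
          (≃.trans {All.lookup θ″ (r′ (r (here refl)))} {σ} {π y}
            (≃.reflexive (trans (ext′ (r (here refl))) (ext (here refl)))) p))
        (Denotes-cong {g = F (λ i → r′ (r (there i))) t′}
          (comb-congˡ w λ i → 𝔽.+-congˡ (𝔽.*-congˡ (𝔽.reflexive (trans (ext′ (c i)) (hc i)))))
          (hF (λ i → r′ (r (there i))) θ″ (λ i → trans (ext′ (r (there i))) (ext (there i))) t′))
        orth′)
      where
      t′ : Fin _ → Term SkL Θ″ K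
      t′ = shiftTerm t (λ i → r′ (c i))
      k = N.eval (t zero) θ″
      orth′ : k *ₗ y ⟂ comb (shift 𝔽 (⟦ t ⟧ θ″) g) w
      orth′ with em {P = k 𝔽.≈ 𝔽.0#}
      ... | yes k≈0 = 0⟂ (V′.≈ᴹ-trans (V′.*ₗ-congʳ k≈0) (V′.*ₗ-zeroˡ y))
      ... | no k≉0 = ⟂-scale k≉0 λ l → ⟂-cong V′.≈ᴹ-refl (comb-* l _ w) (orth _)

    admissible⇒image : ∀ {p Θ} (F : Oracle p Θ) {θ σ} →
      N.Sat (admissible F) (σ ∷ θ) → ∃[ y ] σ ≃ π y
    admissible⇒image F {θ} {σ} h = Equivalence.to (Sat-inImage (var (here refl)) {σ ∷ θ})
      (proj₁ (Equivalence.to (Sat-∧ (inImage (var (here refl))) (orthogonalToSpan F) {_∷_ {x = S} σ θ}) h))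

    Sat-admissible : ∀ {p Θ} {F : Oracle p Θ} {θ w σ y} → OracleCorrect F θ w → σ ≃ π y →
      N.Sat (admissible F) (σ ∷ θ) ⇔ (∀ d → y ⟂ comb d w)
    Sat-admissible {p} {Θ} {F} {θ} {w} {σ} {y} hF σ≃πy = mk⇔
      (λ (_ , h) d → let open Valuation (valuation (_∷_ {x = S} σ θ) d) in
        ⟂-cong V′.≈ᴹ-refl (comb-congˡ w (λ i → 𝔽.reflexive (correct i)))
          (Equivalence.to (orth rename values extends scalar) (forallScalars⁻ p {f = f} {_∷_ {x = S} σ θ} h d)))
      (λ h → Equivalence.from (Sat-inImage (var (here refl)) {σ ∷ θ}) (y , σ≃πy) ,
             forallScalars⁺ p (λ r θ′ ext c → Equivalence.from (orth r θ′ ext c) (h _)))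
      ⇔-∘ Sat-∧ (inImage (var (here refl))) (orthogonalToSpan F)
      where
      f : ∀ {Θ′} → (S ∷ Θ) ⊑ Θ′ → (Fin p → K ∈ Θ′) → Formula SkL Θ′
      f r c = orthogonal (λ k → k (var (r (here refl)))) (F (r ∘ there) (var ∘ c))
      orth : ∀ {Θ′} (r : (S ∷ Θ) ⊑ Θ′) θ′ → Extends r (σ ∷ θ) θ′ → (c : Fin p → K ∈ Θ′) →
             N.Sat (f r c) θ′ ⇔ y ⟂ comb (⟦ var ∘ c ⟧ θ′) w
      orth r θ′ ext c = Sat-orthogonal
        {g = λ k → k (var (r (here refl)))} {h = F (r ∘ there) (var ∘ c)}
        (λ k H → H (var (r (here refl)))
          (≃.trans {All.lookup θ′ (r (here refl))} {σ} {π y} (≃.reflexive (ext (here refl))) σ≃πy))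
        (hF (r ∘ there) θ′ (ext ∘ there) (var ∘ c))

    -- The condition on `n` mentions only +, 0 and 1, which embeddings preserve, so it also holds at
    -- the image of -1.
    translate-correct : ∀ {Δ p Θ} {ι : Index Δ p} {e : Names Δ Θ} {n} {F : Oracle p Θ} {ρ w}
        {θ : All NS.∣_∣ Θ} →
      IndexCorrect ι ρ w → NamesCorrect e ρ θ → All.lookup θ n 𝔽.+ 𝔽.1# 𝔽.≈ 𝔽.0# → OracleCorrect F θ w →
      (φ : Formula L Δ) → N.Sat (translate ι e n F φ) θ ⇔ M.Sat φ ρ
    translate-correct {Δ} {p} {Θ} {ι} {e} {n} {F} {ρ} {w} {θ} hι he hn hF = sound
      where
      cc : ∀ {s} (t : Term L Δ s) → CoefficientsCorrect s (coefficients ι e t) θ w (M.eval t ρ)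
      cc = coefficients-correct {ι = ι} {e} {ρ} {w} {θ} hι he

      tc : ∀ {s} (t : Term L Δ s) → TermCorrect s (translateTerm ι e (F id) t) θ (M.eval t ρ)
      tc = translateTerm-correct {ι = ι} {e} {F id} {ρ} {w} {θ} hι he (hF id θ (λ _ → refl))

      sound : (φ : Formula L Δ) → N.Sat (translate ι e n F φ) θ ⇔ M.Sat φ ρ
      sound falsum = ⇔-id _
      sound (equal {V} t u) = hF id θ (λ _ → refl) _ _ λ σ p →
        mk⇔ (λ z → VP.x∙y⁻¹≈ε⇒x≈y _ _ (V′.≈ᴹ-trans (V′.≈ᴹ-sym difference≈) z))
            (λ t≈u → V′.≈ᴹ-trans difference≈ (VP.x≈y⇒x∙y⁻¹≈ε t≈u))
        ⇔-∘ Sat-zero-⇔ σ p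
        where
        difference≈ = V′.≈ᴹ-trans (comb-− (⟦ coefficients ι e t ⟧ θ) (⟦ coefficients ι e u ⟧ θ) w hn)
          (V′.+ᴹ-cong (cc t) (V′.-ᴹ‿cong (cc u)))
      sound (equal {K} a b) =
        mk⇔ (λ z → 𝔽.trans (𝔽.sym (cc a)) (𝔽.trans z (cc b)))
            (λ z → 𝔽.trans (cc a) (𝔽.trans z (𝔽.sym (cc b))))
      sound (equal {Γ} t u) = tc t _ λ α p → tc u _ λ β q →
        mk⇔ (λ z → Γ′.Eq.trans (Γ′.Eq.sym p) (Γ′.Eq.trans z q))
            (λ z → Γ′.Eq.trans p (Γ′.Eq.trans z (Γ′.Eq.sym q)))
      sound (equal {S} t u) = tc t _ λ σ p → tc u _ λ τ q →
        mk⇔ (λ z → ≃.trans {M.eval t ρ} {N.eval σ θ} {M.eval u ρ} (≃.sym {N.eval σ θ} {M.eval t ρ} p)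
                     (≃.trans {N.eval σ θ} {N.eval τ θ} {M.eval u ρ} z q))
            (λ z → ≃.trans {N.eval σ θ} {M.eval t ρ} {N.eval τ θ} p
                     (≃.trans {M.eval t ρ} {M.eval u ρ} {N.eval τ θ} z (≃.sym {N.eval τ θ} {M.eval u ρ} q)))
      sound (rel less (t ∷ u ∷ [])) = tc t _ λ α p → tc u _ λ β q →
        mk⇔ (λ z → Γ′.<-respˡ-≈ p (Γ′.<-respʳ-≈ q z))
            (λ z → Γ′.<-respˡ-≈ (Γ′.Eq.sym p) (Γ′.<-respʳ-≈ (Γ′.Eq.sym q) z))
      sound (φ ⇒ ψ) = →-cong-⇔ (sound φ) (sound ψ)
      sound (all V φ) = mk⇔ to from
        where
        f : ∀ {Θ′} → (S ∷ Θ) ⊑ Θ′ → (Fin p → K ∈ Θ′) → Formula SkL Θ′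
        f r c = translate (addVector ι) (λ s i → r (there (skipNames e s i))) (r (there n))
                          (extendOracle r c F) φ

        induction : ∀ {σ : NS.∣ S ∣} {x y Θ′} {r : (S ∷ Θ) ⊑ Θ′} {θ′ g} {c : Fin p → K ∈ Θ′} →
          σ ≃ π y → (∀ d → y ⟂ comb d w) → Extends r (σ ∷ θ) θ′ → (∀ i → All.lookup θ′ (c i) ≡ g i) →
          x ≈ᴹ y +ᴹ comb g w → N.Sat (f r c) θ′ ⇔ M.Sat φ (x ∷ ρ)
        induction {x = x} {r = r} {θ′} {c = c} σ≃πy orth ext hc x≈ = translate-correct
          {n = r (there n)} {F = extendOracle r c F} {w = x ◂ w} {θ = θ′}
          (addVector-correct {ι = ι} {w = w} hι)
          (λ s i → trans (ext (there (skipNames e s i))) (skipNames-correct {e = e} {θ = θ} {x = x} he s i))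
          (𝔽.trans (𝔽.+-congʳ (𝔽.reflexive (ext (there n)))) hn)
          (extendOracle-correct {r = r} {F = F} {θ′ = θ′} hF ext hc σ≃πy x≈ orth) φ

        to : N.Sat (translate ι e n F (all V φ)) θ → ∀ x → M.Sat φ (x ∷ ρ)
        to h x with BestApproximation.best-in-span em w x
        ... | y , difference g x≈ , orth =
          Equivalence.to (induction {π y} {r = rename} {θ′ = values} (≃.refl {π y}) orth extends correct x≈)
            (forallScalars⁻ p (h (π y) (Equivalence.from (Sat-admissible {F = F} hF (≃.refl {π y})) orth)) g)
          where open Valuation (valuation (_∷_ {x = S} (π y) θ) g)

        from : (∀ x → M.Sat φ (x ∷ ρ)) → N.Sat (translate ι e n F (all V φ)) θ
        from h σ adm with admissible⇒image F adm
        ... | y , σ≃πy = forallScalars⁺ p λ r θ′ ext c → Equivalence.from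
          (induction {r = r} {θ′ = θ′} {c = c} σ≃πy (Equivalence.to (Sat-admissible {F = F} hF σ≃πy) adm)
            ext (λ _ → refl) V′.≈ᴹ-refl) (h _)
      sound (all K φ) = ∀-cong-⇔ λ x → translate-correct {w = w}
        (skipIndex-correct K {ι = ι} {w = w} {x = x} hι) (addName-correct K {e = e} he) hn
        (weaken-correct {F = F} hF) φ
      sound (all Γ φ) = ∀-cong-⇔ λ x → translate-correct {w = w}
        (skipIndex-correct Γ {ι = ι} {w = w} {x = x} hι) (addName-correct Γ {e = e} he) hn
        (weaken-correct {F = F} hF) φ
      sound (all S φ) = ∀-cong-⇔ λ x → translate-correct {w = w}
        (skipIndex-correct S {ι = ι} {w = w} {x = x} hι) (addName-correct S {e = e} he) hn
        (weaken-correct {F = F} hF) φ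

    -- Free variables as parameters in the skeleton

    record Reading {Δ} (ρ : All MS.∣_∣ Δ) : Set ℓ where
      field
        {size}        : ℕ
        {context}     : List SkSort
        index         : Index Δ size
        names         : Names Δ context
        vectors       : Fin size → Carrierᴹ
        values        : All NS.∣_∣ context
        index-correct : IndexCorrect index ρ vectors
        names-correct : NamesCorrect names ρ values

    reading : ∀ {Δ} (ρ : All MS.∣_∣ Δ) → Reading ρ
    reading [] = record
      { size = 0 ; context = [] ; index = λ () ; names = λ _ () ; vectors = λ () ; values = []
      ; index-correct = λ () ; names-correct = λ _ () }
    reading (_∷_ {V} x ρ) = record
      { index = addVector index ; names = skipNames names ; vectors = x ◂ vectors ; values = values
      ; index-correct = addVector-correct {ι = index} {w = vectors} index-correct
      ; names-correct = skipNames-correct {e = names} {θ = values} {x = x} names-correct }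
      where open Reading (reading ρ)
    reading (_∷_ {Γ} x ρ) = record
      { index = skipIndex Γ index ; names = addName Γ names ; vectors = vectors ; values = x ∷ values
      ; index-correct = skipIndex-correct Γ {ι = index} {w = vectors} {x = x} index-correct
      ; names-correct = addName-correct Γ {e = names} {θ = values} names-correct }
      where open Reading (reading ρ)
    reading (_∷_ {K} x ρ) = record
      { index = skipIndex K index ; names = addName K names ; vectors = vectors ; values = x ∷ values
      ; index-correct = skipIndex-correct K {ι = index} {w = vectors} {x = x} index-correct
      ; names-correct = addName-correct K {e = names} {θ = values} names-correct }
      where open Reading (reading ρ)
    reading (_∷_ {S} x ρ) = record
      { index = skipIndex S index ; names = addName S names ; vectors = vectors ; values = x ∷ values
      ; index-correct = skipIndex-correct S {ι = index} {w = vectors} {x = x} index-correct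
      ; names-correct = addName-correct S {e = names} {θ = values} names-correct }
      where open Reading (reading ρ)

  -- The skeleton as part of the full structure

  raiseTerm : ∀ {Δ Θ s} → (∀ s → s ∈ Θ → ⌊ s ⌋ ∈ Δ) → Term SkL Θ s → Term L Δ ⌊ s ⌋
  raiseTerm e (var {s} i) = var (e s i)
  raiseTerm e (app +ᴷ (a ∷ b ∷ [])) = app +ᴷ (raiseTerm e a ∷ raiseTerm e b ∷ [])
  raiseTerm e (app *ᴷ (a ∷ b ∷ [])) = app *ᴷ (raiseTerm e a ∷ raiseTerm e b ∷ [])
  raiseTerm e (app 0ᴷ []) = app 0ᴷ []
  raiseTerm e (app 1ᴷ []) = app 1ᴷ []
  raiseTerm e (app +•ᶠ (t ∷ u ∷ [])) = app +•ᶠ (raiseTerm e t ∷ raiseTerm e u ∷ [])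
  raiseTerm e (app 𝟎ᶠ []) = app 𝟎ᶠ []
  raiseTerm e (app scal• (k ∷ t ∷ [])) = app scal• (raiseTerm e k ∷ raiseTerm e t ∷ [])
  raiseTerm e (app valₛᶠ (t ∷ [])) = app valₛᶠ (raiseTerm e t ∷ [])

  lift : ∀ {Δ Θ s} → (∀ s → s ∈ Θ → ⌊ s ⌋ ∈ Δ) → ∀ t → t ∈ (s ∷ Θ) → ⌊ t ⌋ ∈ (⌊ s ⌋ ∷ Δ)
  lift e s (here refl) = here refl
  lift e s (there i)   = there (e s i)

  raise : ∀ {Δ Θ} → (∀ s → s ∈ Θ → ⌊ s ⌋ ∈ Δ) → Formula SkL Θ → Formula L Δ
  raise e falsum = falsum
  raise e (equal t u) = equal (raiseTerm e t) (raiseTerm e u)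
  raise e (rel less (t ∷ u ∷ [])) = rel less (raiseTerm e t ∷ raiseTerm e u ∷ [])
  raise e (φ ⇒ ψ) = raise e φ ⇒ raise e ψ
  raise e (all s φ) = all ⌊ s ⌋ (raise (lift e) φ)

  module Raised {ℓ} (em : ExcludedMiddle ℓ) {𝔽 : Field ℓ} (𝒱 : ValuedVectorSpace 𝔽) where
    open ValuedVectorSpace 𝒱 hiding (module V; module Γ)
    open Skeleton 𝒱 hiding (S)
    open Translated em 𝒱 using (down)
    private
      module 𝔽 = Field 𝔽
      M = structure 𝒱
      N = skeleton 𝒱
      module M = Semantics M
      module N = Semantics N
      module MS = Structure M
      module NS = Structure N

    RaisedNames : ∀ {Δ Θ} → (∀ s → s ∈ Θ → ⌊ s ⌋ ∈ Δ) → All MS.∣_∣ Δ → All NS.∣_∣ Θ → Set ℓ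
    RaisedNames e ρ θ = ∀ s i → down s (All.lookup ρ (e s i)) ≡ All.lookup θ i

    module _ {Δ Θ} {e : ∀ s → s ∈ Θ → ⌊ s ⌋ ∈ Δ} {ρ θ} (h : RaisedNames e ρ θ) where

      raiseTerm-correct : ∀ {s} (t : Term SkL Θ s) → down s (M.eval (raiseTerm e t) ρ) ≡ N.eval t θ
      raiseTerm-correct (var {s} i) = h s i
      raiseTerm-correct (app +•ᶠ (t ∷ u ∷ [])) = cong₂ _+•_ (raiseTerm-correct t) (raiseTerm-correct u)
      raiseTerm-correct (app 𝟎ᶠ []) = refl
      raiseTerm-correct (app scal• (k ∷ t ∷ [])) = cong₂ _*•_ (raiseTerm-correct k) (raiseTerm-correct t)
      raiseTerm-correct (app +ᴷ (a ∷ b ∷ [])) = cong₂ 𝔽._+_ (raiseTerm-correct a) (raiseTerm-correct b)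
      raiseTerm-correct (app *ᴷ (a ∷ b ∷ [])) = cong₂ 𝔽._*_ (raiseTerm-correct a) (raiseTerm-correct b)
      raiseTerm-correct (app 0ᴷ []) = refl
      raiseTerm-correct (app 1ᴷ []) = refl
      raiseTerm-correct (app valₛᶠ (t ∷ [])) = cong valₛ (raiseTerm-correct t)

    lift-correct : ∀ {Δ Θ s} {e : ∀ s → s ∈ Θ → ⌊ s ⌋ ∈ Δ} {ρ θ} {x : MS.∣ ⌊ s ⌋ ∣} → RaisedNames e ρ θ →
                   RaisedNames {⌊ s ⌋ ∷ Δ} {s ∷ Θ} (lift e) (x ∷ ρ) (down s x ∷ θ)
    lift-correct h s (here refl) = refl
    lift-correct h s (there i)   = h s i

    raise-correct : ∀ {Δ Θ} {e : ∀ s → s ∈ Θ → ⌊ s ⌋ ∈ Δ} {ρ θ} → RaisedNames e ρ θ →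
                    (φ : Formula SkL Θ) → M.Sat (raise e φ) ρ ⇔ N.Sat φ θ
    raise-correct {Θ = Θ} {e} {ρ} {θ} h = sound
      where
      tc : ∀ {s} (t : Term SkL Θ s) → down s (M.eval (raiseTerm e t) ρ) ≡ N.eval t θ
      tc = raiseTerm-correct {ρ = ρ} {θ} h

      sound : (φ : Formula SkL Θ) → M.Sat (raise e φ) ρ ⇔ N.Sat φ θ
      sound falsum = ⇔-id _
      sound (equal {K} t u) = cong₂-⇔ 𝔽._≈_ (tc t) (tc u)
      sound (equal {Γ} t u) = cong₂-⇔ _≈Γ_ (tc t) (tc u)
      sound (equal {S} t u) = cong₂-⇔ _≃_ (tc t) (tc u)
      sound (rel less (t ∷ u ∷ [])) = cong₂-⇔ _<_ (tc t) (tc u)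
      sound (φ ⇒ ψ) = →-cong-⇔ (sound φ) (sound ψ)
      sound (all K φ) = ∀-cong-⇔ λ x →
        raise-correct {ρ = x ∷ ρ} {x ∷ θ} (lift-correct {e = e} {ρ} {θ} {x} h) φ
      sound (all Γ φ) = ∀-cong-⇔ λ x →
        raise-correct {ρ = x ∷ ρ} {x ∷ θ} (lift-correct {e = e} {ρ} {θ} {x} h) φ
      sound (all S φ) = ∀-cong-⇔ λ x →
        raise-correct {ρ = x ∷ ρ} {x ∷ θ} (lift-correct {e = e} {ρ} {θ} {x} h) φ

    record RaisedReading {Θ} (θ : All NS.∣_∣ Θ) : Set ℓ where
      field
        {context} : List Sort
        names     : ∀ s → s ∈ Θ → ⌊ s ⌋ ∈ context
        values    : All MS.∣_∣ context
        correct   : RaisedNames names values θ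

    raisedReading : ∀ {Θ} (θ : All NS.∣_∣ Θ) → RaisedReading θ
    raisedReading [] = record { context = [] ; names = λ _ () ; values = [] ; correct = λ _ () }
    raisedReading (_∷_ {K} x θ) = record
      { names = lift names ; values = x ∷ values
      ; correct = lift-correct {e = names} {values} {θ} {x} correct }
      where open RaisedReading (raisedReading θ)
    raisedReading (_∷_ {Γ} x θ) = record
      { names = lift names ; values = x ∷ values
      ; correct = lift-correct {e = names} {values} {θ} {x} correct }
      where open RaisedReading (raisedReading θ)
    raisedReading (_∷_ {S} x θ) = record
      { names = lift names ; values = x ∷ values
      ; correct = lift-correct {e = names} {values} {θ} {x} correct }
      where open RaisedReading (raisedReading θ)

  -- Transfer along an embedding over a variable field

  module _ {ℓ} (em : ExcludedMiddle ℓ) {F G : Field ℓ} {𝒱 : ValuedVectorSpace F} {𝒲 : ValuedVectorSpace G}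
           (h : Embedding (structure 𝒱) (structure 𝒲)) where
    open Embedding h using (map-func; map-cong) renaming (map to ⟨h⟩)
    private
      ĥ = skeletonEmbedding {𝒱 = 𝒱} {𝒲 = 𝒲} h
      module V = Translated em 𝒱
      module W = Translated em 𝒲
      module VR = Raised em 𝒱
      module WR = Raised em 𝒲
      module 𝒱 = ValuedVectorSpace 𝒱
      module 𝒲 = ValuedVectorSpace 𝒲
      module F = Field F
      module G = Field G
      module V≃ = Setoid (Skeleton.S 𝒱)
      module W≃ = Setoid (Skeleton.S 𝒲)
      hᵥ : 𝒱.Carrierᴹ → 𝒲.Carrierᴹ
      hᵥ = ⟨h⟩ {V}
      hₖ : F.Carrier → G.Carrier
      hₖ = ⟨h⟩ {K}
      ⟨ĥ⟩ : ∀ {s} → Structure.∣_∣ (skeleton 𝒱) s → Structure.∣_∣ (skeleton 𝒲) s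
      ⟨ĥ⟩ {s} = Embedding.map ĥ {s}

    mapM : ∀ {Δ} → All (Structure.∣_∣ (structure 𝒱)) Δ → All (Structure.∣_∣ (structure 𝒲)) Δ
    mapM = All.map (λ {s} → ⟨h⟩ {s})

    mapN : ∀ {Θ} → All (Structure.∣_∣ (skeleton 𝒱)) Θ → All (Structure.∣_∣ (skeleton 𝒲)) Θ
    mapN = All.map (λ {s} → ⟨ĥ⟩ {s})

    lookup-mapM : ∀ {Δ s} (ρ : All _ Δ) (i : s ∈ Δ) → All.lookup (mapM ρ) i ≡ ⟨h⟩ {s} (All.lookup ρ i)
    lookup-mapM = All.lookup-map

    lookup-mapN : ∀ {Θ s} (θ : All _ Θ) (i : s ∈ Θ) → All.lookup (mapN θ) i ≡ ⟨ĥ⟩ {s} (All.lookup θ i)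
    lookup-mapN = All.lookup-map

    down-map : ∀ s (x : Structure.∣_∣ (structure 𝒱) ⌊ s ⌋) →
               ⟨ĥ⟩ {s} (V.down s x) ≡ W.down s (⟨h⟩ {⌊ s ⌋} x)
    down-map K x = refl
    down-map Γ x = refl
    down-map S x = refl

    map-comb : ∀ {p} (t : Fin p → F.Carrier) w →
      hᵥ (Combinations.comb 𝒱 t w) 𝒲.≈ᴹ Combinations.comb 𝒲 (hₖ ∘ t) (hᵥ ∘ w)
    map-comb {zero} t w = map-func 0ⱽ []
    map-comb {suc p} t w = 𝒲.V.≈ᴹ-trans (map-func +ⱽ (_ ∷ _ ∷ []))
      (𝒲.V.+ᴹ-cong (map-func scal (t zero ∷ w zero ∷ [])) (map-comb (t ∘ suc) (w ∘ suc)))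

    elementary⇒skeleton : IsElementary h → IsElementary ĥ
    elementary⇒skeleton el φ θ =
      WR.raise-correct {ρ = mapM values} {mapN θ} correct′ φ
      ⇔-∘ (el (raise names φ) values ⇔-∘ ⇔-sym (VR.raise-correct {ρ = values} {θ} correct φ))
      where
      open VR.RaisedReading (VR.raisedReading θ)
      correct′ : WR.RaisedNames names (mapM values) (mapN θ)
      correct′ s i = trans (cong (W.down s) (lookup-mapM values (names s i)))
        (trans (sym (down-map s (All.lookup values (names s i))))
        (trans (cong (⟨ĥ⟩ {s}) (correct s i)) (sym (lookup-mapN θ i))))

    module _ (el : IsElementary ĥ) where

      -- The combinations needed cannot be listed, so each vector is instead decomposed as a best
      -- approximation y plus a combination of the later vectors. The classes π y and the
      -- coefficients are the parameters, and the oracle is assembled by `extendOracle`. Both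
      -- correctness fields are built together because orthogonality over the larger field is
      -- inferred through `el` from that in the smaller space.
      record Storage {Θ p} (θ : All (Structure.∣_∣ (skeleton 𝒱)) Θ) (w : Fin p → 𝒱.Carrierᴹ) :
             Set (Level.suc ℓ) where
        field
          {context′} : List SkSort
          values′    : All (Structure.∣_∣ (skeleton 𝒱)) context′
          rename     : Θ ⊑ context′
          extends    : Extends rename θ values′
          oracle     : Oracle p context′
          correctᵛ   : V.OracleCorrect oracle values′ w
          correctʷ   : W.OracleCorrect oracle (mapN values′) (hᵥ ∘ w)

      storage : ∀ {Θ p} (θ : All (Structure.∣_∣ (skeleton 𝒱)) Θ) (w : Fin p → 𝒱.Carrierᴹ) → Storage θ w
      -- Without vectors the only combination is 0.
      storage {p = zero} θ w = record
        { values′ = θ ; rename = id ; extends = λ _ → refl ; oracle = λ _ _ k → k 𝟎′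
        ; correctᵛ = λ _ _ _ _ k H → H 𝟎′ (Setoid.sym (Skeleton.S 𝒱) {Skeleton.π 𝒱 𝒱.0ᴹ} {Skeleton.𝟎 𝒱}
            (Equivalence.from (Skeletal.π-0 𝒱) 𝒱.V.≈ᴹ-refl))
        ; correctʷ = λ _ _ _ _ k H → H 𝟎′ (W≃.sym {Skeleton.π 𝒲 𝒲.0ᴹ} {Skeleton.𝟎 𝒲}
            (Equivalence.from (Skeletal.π-0 𝒲) 𝒲.V.≈ᴹ-refl)) }
      storage {Θ} {suc p} θ w with Combinations.BestApproximation.best-in-span 𝒱 em (w ∘ suc) (w zero)
      ... | y , Combinations.difference g x≈ , orth = record
        { values′  = values
        ; rename   = λ i → rename (there (T.rename i))
        ; extends  = λ i → trans (extends (there (T.rename i))) (T.extends i)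
        ; oracle   = extendOracle rename scalar T.oracle
        ; correctᵛ = V.extendOracle-correct {r = rename} {F = T.oracle} {θ′ = values}
            {σ = Skeleton.π 𝒱 y} {g} {w zero} {y}
            T.correctᵛ extends correct (V≃.refl {Skeleton.π 𝒱 y}) x≈ orth
        ; correctʷ = W.extendOracle-correct {r = rename} {F = T.oracle} {θ′ = mapN values}
            {σ = hσ} {hₖ ∘ g} {hᵥ (w zero)} {hᵥ y}
            T.correctʷ
            (λ {s} i → trans (lookup-mapN values (rename i))
              (trans (cong (⟨ĥ⟩ {s}) (extends i)) (sym (lookup-mapN θ₁ i))))
            (λ i → trans (lookup-mapN values (scalar i)) (cong hₖ (correct i)))
            (map-func πᶠ (y ∷ []))
            (𝒲.V.≈ᴹ-trans (map-cong {V} x≈)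
              (𝒲.V.≈ᴹ-trans (map-func +ⱽ (y ∷ _ ∷ [])) (𝒲.V.+ᴹ-congˡ (map-comb g (w ∘ suc)))))
            orthʷ }
        where
        module T = Storage (storage {Θ} {p} θ (w ∘ suc))
        θ₁ : All (Structure.∣_∣ (skeleton 𝒱)) (S ∷ T.context′)
        θ₁ = Skeleton.π 𝒱 y ∷ T.values′
        open V.Valuation (V.valuation θ₁ g)
        hσ : Skeleton.Rep 𝒲
        hσ = ⟨h⟩ {S} (Skeleton.π 𝒱 y)
        -- The skeletal description of y as a best approximation is what makes
        -- h y a best approximation in the larger space.
        orthʷ : ∀ d → Skeletal._⟂_ 𝒲 (hᵥ y) (Combinations.comb 𝒲 d (hᵥ ∘ w ∘ suc))
        orthʷ = Equivalence.to
          (W.Sat-admissible {F = T.oracle} {θ = mapN T.values′} {σ = hσ} T.correctʷ (map-func πᶠ (y ∷ [])))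
          (Equivalence.to (el (admissible T.oracle) θ₁)
            (Equivalence.from
              (V.Sat-admissible {F = T.oracle} {θ = T.values′} {σ = Skeleton.π 𝒱 y} T.correctᵛ
                (V≃.refl {Skeleton.π 𝒱 y}))
              orth))

      skeleton⇒elementary : IsElementary h
      skeleton⇒elementary φ ρ =
        W.translate-correct {n = n} {F = oracle} {w = hᵥ ∘ vectors}
          (λ i → trans (lookup-mapM ρ i) (cong hᵥ (index-correct i)))
          (λ s i → trans (lookup-mapN values′ (rename (there (names s i))))
            (trans (cong (⟨ĥ⟩ {s}) (trans (extends (there (names s i))) (names-correct s i)))
            (trans (down-map s (All.lookup ρ i)) (cong (W.down s) (sym (lookup-mapM ρ i))))))
          (G.trans (G.+-cong (G.reflexive (trans (lookup-mapN values′ n) (cong hₖ (extends (here refl)))))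
                             (G.sym (map-func 1ᴷ [])))
            (G.trans (G.sym (map-func +ᴷ (_ ∷ _ ∷ [])))
            (G.trans (map-cong {K} (F.-‿inverseˡ F.1#)) (map-func 0ᴷ []))))
          correctʷ φ
        ⇔-∘ (el (translate index names′ n oracle φ) values′
        ⇔-∘ ⇔-sym (V.translate-correct {n = n} {F = oracle} {w = vectors} index-correct
          (λ s i → trans (extends (there (names s i))) (names-correct s i))
          (F.trans (F.+-congʳ (F.reflexive (extends (here refl)))) (F.-‿inverseˡ F.1#))
          correctᵛ φ))
        where
        open V.Reading (V.reading ρ)
        -- The parameter -1 is added before the decomposition, to be named by `n`.
        open Storage (storage (_∷_ {x = K} (F.- F.1#) values) vectors)
        n : K ∈ context′
        n = rename (here refl)
        names′ : Names _ context′
        names′ s i = rename (there (names s i))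

proposition3p5 : ∀ {ℓ} → ExcludedMiddle ℓ →
    ((K : Field ℓ) (𝒱 𝒲 : ValuedVectorSpace K)
    (ι : Embedding (FixedField.structure K 𝒱) (FixedField.structure K 𝒲)) →
    IsElementary ι ⇔ IsElementary (FixedField.skeletonEmbedding K {𝒱} {𝒲} ι))
    ×
    ((F G : Field ℓ) (𝒱 : ValuedVectorSpace F) (𝒲 : ValuedVectorSpace G)
    (ι : Embedding (VariableField.structure 𝒱) (VariableField.structure 𝒲)) →
    IsElementary ι ⇔ IsElementary (VariableField.skeletonEmbedding {𝒱 = 𝒱} {𝒲 = 𝒲} ι))
proposition3p5 em =
  (λ K 𝒱 𝒲 ι → let open FixedTranslation em K in
    mk⇔ (elementary⇒skeleton {𝒱} {𝒲} ι) (skeleton⇒elementary {𝒱} {𝒲} ι)) ,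
  (λ F G 𝒱 𝒲 ι → let open VariableTranslation in
    mk⇔ (elementary⇒skeleton em {𝒱 = 𝒱} {𝒲} ι) (skeleton⇒elementary em {𝒱 = 𝒱} {𝒲} ι))
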